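{- For every constant $\epsilon>0$: for every sufficiently large $n$ there is a cardinality bound $k=k(n)$ such that, for every distribution $\mathcal D$ on $2^N$ (where $|N|=n$), the class of coverage functions on $N$ is not $n^{ -1/5+\epsilon}$-optimizable from samples over $\mathcal D$ under the constraint $\{S\subseteq N:|S|\le k\}$. In addition, there is a cardinality bound $k=k(n)$ such that, for every distribution $\mathcal D$, the class of polynomial-sized coverage functions on $N$ is not $2^{ -\Omega(\sqrt{\log n})}$-optimizable from samples over $\mathcal D$ under the constraint $\{S\subseteq N:|S|\le k\}$.
   Context: Let $N$ be a ground set with $n=|N|$. A function $f:2^N\to\mathbb R$ is a coverage function if there is a finite set $U$ of "children" with nonnegative weights $w(a)$, $a\in U$, and sets $T_e\subseteq U$ for $e\in N$, such that $f(S)=\sum_{a\in\bigcup_{e\in S}T_e}w(a)$ for all $S\subseteq N$. It is polynomial-sized if $|U|$ is polynomial in $n$. Optimization from samples: a class $\mathcal F$ of functions $2^N\to\mathbb R$ is $\alpha$-optimizable from samples over a distribution $\mathcal D$ on $2^N$ under the constraint $\mathcal M=\{S:|S|\le k\}$ if there exists a (not necessarily polynomial-time, possibly randomized) algorithm which, for every $f\in\mathcal F$, given as input $m\in\mathrm{poly}(n)$ pairs $(S_i,f(S_i))_{i=1}^m$ with $S_1,\dots,S_m$ drawn i.i.d. from $\mathcal D$, returns a set $S\in\mathcal M$ such that $\Pr_{S_1,\dots,S_m\sim\mathcal D}\big[\mathbb E[f(S)]\ge\alpha\max_{T\in\mathcal M}f(T)\big]\ge 1-\delta$, where the expectation is over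 the algorithm's randomness and $\delta\in[0,1)$ is a constant. All statements are asymptotic in $n$. -}

module Defs where

open import Data.Bool.Base using (Bool; true; if_then_else_)
open import Data.Fin.Base using (Fin)
open import Data.Fin.Subset using (Subset; inside; outside; ⊥; ⋃; ∣_∣)
open import Data.Fin.Subset.Properties using (_∈?_)
open import Data.Integer.Base using (+_)
open import Data.List.Base as List using (List; []; _∷_; _++_; foldr; filter; allFin)
open import Data.Nat.Base as ℕ using (ℕ; zero; suc)
import Data.Nat.Properties as ℕ
open import Data.Product.Base using (∃; ∃₂; ∃-syntax; Σ-syntax; _×_; _,_)
open import Data.Product.Relation.Binary.Pointwise.NonDependent
  using () renaming (Pointwise to ×-Pointwise)
open import Data.Rational.Base as ℚ using (ℚ; 0ℚ; 1ℚ; ½)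
import Data.Rational.Properties as ℚ
open import Data.Rational.Solver using (module +-*-Solver)
open import Data.Sum.Base using (inj₁; inj₂)
open import Data.Vec.Base as Vec using (Vec; []; _∷_)
open import Data.Vec.Relation.Binary.Pointwise.Inductive using (Pointwise)
open import Function.Base using (_∘_)
open import Relation.Binary.PropositionalEquality
  using (_≡_; refl; sym; trans; cong; subst)
open import Relation.Nullary.Negation.Core using (¬_)

-- A real is a Cauchy sequence of rationals; equality of reals is _≈ᵣ_ below.

IsCauchy : (ℕ → ℚ) → Set
IsCauchy x = ∀ ε → 0ℚ ℚ.< ε →
  ∃[ N ] (∀ m n → N ℕ.≤ m → N ℕ.≤ n → ℚ.∣ x m ℚ.- x n ∣ ℚ.≤ ε)

record ℝ : Set where
  no-eta-equality
  constructor mkℝ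
  field
    seq    : ℕ → ℚ
    cauchy : IsCauchy seq

open ℝ public

private
  module Estimates where
    open ℚ.≤-Reasoning
    open +-*-Solver using (solve; _:=_; _:+_; _:-_; _:*_; :-_)

    p≤∣p∣ : ∀ p → p ℚ.≤ ℚ.∣ p ∣
    p≤∣p∣ p with ℚ.≤-total 0ℚ p
    ... | inj₁ 0≤p = ℚ.≤-reflexive (sym (ℚ.0≤p⇒∣p∣≡p 0≤p))
    ... | inj₂ p≤0 = ℚ.≤-trans p≤0 (ℚ.0≤∣p∣ p)

    dist-sym : ∀ a b → ℚ.∣ a ℚ.- b ∣ ≡ ℚ.∣ b ℚ.- a ∣
    dist-sym a b = trans (sym (ℚ.∣-p∣≡∣p∣ (a ℚ.- b)))
      (cong ℚ.∣_∣ (solve 2 (λ a b → :- (a :- b) := b :- a) refl a b))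

    dist⇒≤ : ∀ {ε} a b → ℚ.∣ a ℚ.- b ∣ ℚ.≤ ε → a ℚ.≤ b ℚ.+ ε
    dist⇒≤ {ε} a b h = begin
      a                    ≡⟨ solve 2 (λ a b → a := b :+ (a :- b)) refl a b ⟩
      b ℚ.+ (a ℚ.- b)      ≤⟨ ℚ.+-monoʳ-≤ b (p≤∣p∣ (a ℚ.- b)) ⟩
      b ℚ.+ ℚ.∣ a ℚ.- b ∣  ≤⟨ ℚ.+-monoʳ-≤ b h ⟩
      b ℚ.+ ε              ∎

    ≤⇒diff≤ : ∀ {ε} a b → a ℚ.≤ b ℚ.+ ε → a ℚ.- b ℚ.≤ ε
    ≤⇒diff≤ {ε} a b h = begin
      a ℚ.- b          ≤⟨ ℚ.+-monoˡ-≤ (ℚ.- b) h ⟩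
      b ℚ.+ ε ℚ.- b    ≡⟨ solve 2 (λ b e → b :+ e :- b := e) refl b ε ⟩
      ε                ∎

    ≤⇒dist : ∀ {ε} a b → a ℚ.≤ b ℚ.+ ε → b ℚ.≤ a ℚ.+ ε → ℚ.∣ a ℚ.- b ∣ ℚ.≤ ε
    ≤⇒dist {ε} a b h k with ℚ.∣p∣≡p∨∣p∣≡-p (a ℚ.- b)
    ... | inj₁ eq = subst (ℚ._≤ ε) (sym eq) (≤⇒diff≤ a b h)
    ... | inj₂ eq = subst (ℚ._≤ ε)
      (sym (trans eq (solve 2 (λ a b → :- (a :- b) := b :- a) refl a b))) (≤⇒diff≤ b a k)

    dist-self : ∀ {ε} a → 0ℚ ℚ.< ε → ℚ.∣ a ℚ.- a ∣ ℚ.≤ ε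
    dist-self {ε} a 0<ε = subst (λ d → ℚ.∣ d ∣ ℚ.≤ ε) (sym (ℚ.+-inverseʳ a)) (ℚ.<⇒≤ 0<ε)

    halve : ∀ ε → ½ ℚ.* ε ℚ.+ ½ ℚ.* ε ≡ ε
    halve ε = trans (sym (ℚ.*-distribʳ-+ ε ½ ½)) (ℚ.*-identityˡ ε)

    0<½* : ∀ {ε} → 0ℚ ℚ.< ε → 0ℚ ℚ.< ½ ℚ.* ε
    0<½* {ε} 0<ε = ℚ.*-monoʳ-<-pos ½ 0<ε

    bound : (x : ℝ) → ∃₂ λ B N → ℚ.Positive B × (∀ n → N ℕ.≤ n → ℚ.∣ seq x n ∣ ℚ.≤ B)
    bound x with cauchy x 1ℚ (ℚ.positive⁻¹ 1ℚ)
    ... | N , h = ℚ.∣ c ∣ ℚ.+ 1ℚ , N ,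
        ℚ.nonNeg+pos⇒pos ℚ.∣ c ∣ {{ℚ.∣-∣-nonNeg c}} 1ℚ , λ n N≤n → begin
          ℚ.∣ seq x n ∣                        ≡⟨ cong ℚ.∣_∣ (solve 2 (λ a c → a := c :+ (a :- c)) refl (seq x n) c) ⟩
          ℚ.∣ c ℚ.+ (seq x n ℚ.- c) ∣          ≤⟨ ℚ.∣p+q∣≤∣p∣+∣q∣ c (seq x n ℚ.- c) ⟩
          ℚ.∣ c ∣ ℚ.+ ℚ.∣ seq x n ℚ.- c ∣      ≤⟨ ℚ.+-monoʳ-≤ ℚ.∣ c ∣ (h n N N≤n ℕ.≤-refl) ⟩
          ℚ.∣ c ∣ ℚ.+ 1ℚ                       ∎
      where c = seq x N

    dist-+ : ∀ {δ} a b c d → ℚ.∣ a ℚ.- c ∣ ℚ.≤ δ → ℚ.∣ b ℚ.- d ∣ ℚ.≤ δ →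
             ℚ.∣ (a ℚ.+ b) ℚ.- (c ℚ.+ d) ∣ ℚ.≤ δ ℚ.+ δ
    dist-+ {δ} a b c d h k = begin
      ℚ.∣ (a ℚ.+ b) ℚ.- (c ℚ.+ d) ∣
        ≡⟨ cong ℚ.∣_∣ (solve 4 (λ a b c d → (a :+ b) :- (c :+ d) := (a :- c) :+ (b :- d)) refl a b c d) ⟩
      ℚ.∣ (a ℚ.- c) ℚ.+ (b ℚ.- d) ∣
        ≤⟨ ℚ.∣p+q∣≤∣p∣+∣q∣ (a ℚ.- c) (b ℚ.- d) ⟩
      ℚ.∣ a ℚ.- c ∣ ℚ.+ ℚ.∣ b ℚ.- d ∣
        ≤⟨ ℚ.+-mono-≤ h k ⟩
      δ ℚ.+ δ ∎

    dist-* : ∀ {A B δ} a b c d → ℚ.Positive A → ℚ.Positive B →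
             ℚ.∣ a ∣ ℚ.≤ A → ℚ.∣ d ∣ ℚ.≤ B → ℚ.∣ a ℚ.- c ∣ ℚ.≤ δ → ℚ.∣ b ℚ.- d ∣ ℚ.≤ δ →
             ℚ.∣ a ℚ.* b ℚ.- c ℚ.* d ∣ ℚ.≤ (A ℚ.+ B) ℚ.* δ
    dist-* {A} {B} {δ} a b c d A>0 B>0 ha hd hac hbd = begin
      ℚ.∣ a ℚ.* b ℚ.- c ℚ.* d ∣
        ≡⟨ cong ℚ.∣_∣ (solve 4 (λ a b c d → a :* b :- c :* d := a :* (b :- d) :+ d :* (a :- c)) refl a b c d) ⟩
      ℚ.∣ a ℚ.* (b ℚ.- d) ℚ.+ d ℚ.* (a ℚ.- c) ∣
        ≤⟨ ℚ.∣p+q∣≤∣p∣+∣q∣ (a ℚ.* (b ℚ.- d)) (d ℚ.* (a ℚ.- c)) ⟩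
      ℚ.∣ a ℚ.* (b ℚ.- d) ∣ ℚ.+ ℚ.∣ d ℚ.* (a ℚ.- c) ∣
        ≤⟨ ℚ.+-mono-≤ (prod a (b ℚ.- d) A>0 ha hbd) (prod d (a ℚ.- c) B>0 hd hac) ⟩
      A ℚ.* δ ℚ.+ B ℚ.* δ
        ≡⟨ sym (ℚ.*-distribʳ-+ δ A B) ⟩
      (A ℚ.+ B) ℚ.* δ ∎
      where
      prod : ∀ {C} p q → ℚ.Positive C → ℚ.∣ p ∣ ℚ.≤ C → ℚ.∣ q ∣ ℚ.≤ δ → ℚ.∣ p ℚ.* q ∣ ℚ.≤ C ℚ.* δ
      prod {C} p q C>0 hp hq = begin
        ℚ.∣ p ℚ.* q ∣            ≡⟨ ℚ.∣p*q∣≡∣p∣*∣q∣ p q ⟩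
        ℚ.∣ p ∣ ℚ.* ℚ.∣ q ∣      ≤⟨ ℚ.*-monoʳ-≤-nonNeg ℚ.∣ q ∣ {{ℚ.∣-∣-nonNeg q}} hp ⟩
        C ℚ.* ℚ.∣ q ∣            ≤⟨ ℚ.*-monoˡ-≤-nonNeg C {{ℚ.pos⇒nonNeg C {{C>0}}}} hq ⟩
        C ℚ.* δ                  ∎

    quotient : ∀ C → ℚ.Positive C → ∀ ε → 0ℚ ℚ.< ε → ∃[ δ ] (0ℚ ℚ.< δ × C ℚ.* δ ≡ ε)
    quotient C C>0 ε 0<ε = r ℚ.* ε ,
      subst (ℚ._< r ℚ.* ε) (ℚ.*-zeroʳ r) (ℚ.*-monoʳ-<-pos r {{ℚ.1/pos⇒pos C {{C>0}}}} 0<ε) ,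
      trans (sym (ℚ.*-assoc C r ε))
        (trans (cong (ℚ._* ε) (ℚ.*-inverseʳ C {{C≢0}})) (ℚ.*-identityˡ ε))
      where
      C≢0 : ℚ.NonZero C
      C≢0 = ℚ.pos⇒nonZero C {{C>0}}
      r : ℚ
      r = (ℚ.1/ C) {{C≢0}}

    dist-⊔ : ∀ {ε} a b c d → ℚ.∣ a ℚ.- c ∣ ℚ.≤ ε → ℚ.∣ b ℚ.- d ∣ ℚ.≤ ε →
             ℚ.∣ (a ℚ.⊔ b) ℚ.- (c ℚ.⊔ d) ∣ ℚ.≤ ε
    dist-⊔ {ε} a b c d h k = ≤⇒dist (a ℚ.⊔ b) (c ℚ.⊔ d) (half a b c d h k)
      (half c d a b (subst (ℚ._≤ ε) (dist-sym a c) h) (subst (ℚ._≤ ε) (dist-sym b d) k))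
      where
      half : ∀ a b c d → ℚ.∣ a ℚ.- c ∣ ℚ.≤ ε → ℚ.∣ b ℚ.- d ∣ ℚ.≤ ε →
             a ℚ.⊔ b ℚ.≤ (c ℚ.⊔ d) ℚ.+ ε
      half a b c d h k = ℚ.⊔-lub
        (ℚ.≤-trans (dist⇒≤ a c h) (ℚ.+-monoˡ-≤ ε (ℚ.p≤p⊔q c d)))
        (ℚ.≤-trans (dist⇒≤ b d k) (ℚ.+-monoˡ-≤ ε (ℚ.p≤q⊔p c d)))

  open Estimates

abstract
  const-cauchy : ∀ q → IsCauchy (λ _ → q)
  const-cauchy q ε 0<ε = 0 , λ _ _ _ _ → dist-self q 0<ε

  +-cauchy : ∀ x y → IsCauchy (λ n → seq x n ℚ.+ seq y n)
  +-cauchy x y ε 0<ε =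
    let (M , h) = cauchy x (½ ℚ.* ε) (0<½* 0<ε)
        (N , k) = cauchy y (½ ℚ.* ε) (0<½* 0<ε)
    in M ℕ.⊔ N , λ m n ≤m ≤n → subst (ℚ.∣ (seq x m ℚ.+ seq y m) ℚ.- (seq x n ℚ.+ seq y n) ∣ ℚ.≤_)
         (halve ε)
         (dist-+ (seq x m) (seq y m) (seq x n) (seq y n)
           (h m n (ℕ.m⊔n≤o⇒m≤o M N ≤m) (ℕ.m⊔n≤o⇒m≤o M N ≤n))
           (k m n (ℕ.m⊔n≤o⇒n≤o M N ≤m) (ℕ.m⊔n≤o⇒n≤o M N ≤n)))

  neg-cauchy : ∀ x → IsCauchy (λ n → ℚ.- seq x n)
  neg-cauchy x ε 0<ε =
    let (N , h) = cauchy x ε 0<ε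
    in N , λ m n ≤m ≤n → subst (ℚ._≤ ε)
      (trans (sym (ℚ.∣-p∣≡∣p∣ (seq x m ℚ.- seq x n)))
             (cong ℚ.∣_∣ (ℚ.neg-distrib-+ (seq x m) (ℚ.- seq x n))))
      (h m n ≤m ≤n)

  *-cauchy : ∀ x y → IsCauchy (λ n → seq x n ℚ.* seq y n)
  *-cauchy x y ε 0<ε =
    let (A , M , A>0 , hA) = bound x
        (B , N , B>0 , hB) = bound y
        (δ , 0<δ , eq)     = quotient (A ℚ.+ B) (ℚ.pos+pos⇒pos A {{A>0}} B {{B>0}}) ε 0<ε
        (P , hx)           = cauchy x δ 0<δ
        (Q , hy)           = cauchy y δ 0<δ
        K                  = (M ℕ.⊔ N) ℕ.⊔ (P ℕ.⊔ Q)
        inMN : ∀ {m} → K ℕ.≤ m → M ℕ.⊔ N ℕ.≤ m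
        inMN               = ℕ.m⊔n≤o⇒m≤o (M ℕ.⊔ N) (P ℕ.⊔ Q)
        inPQ : ∀ {m} → K ℕ.≤ m → P ℕ.⊔ Q ℕ.≤ m
        inPQ               = ℕ.m⊔n≤o⇒n≤o (M ℕ.⊔ N) (P ℕ.⊔ Q)
    in K , λ m n ≤m ≤n → subst (ℚ.∣ seq x m ℚ.* seq y m ℚ.- seq x n ℚ.* seq y n ∣ ℚ.≤_) eq
         (dist-* (seq x m) (seq y m) (seq x n) (seq y n) A>0 B>0
           (hA m (ℕ.m⊔n≤o⇒m≤o M N (inMN ≤m))) (hB n (ℕ.m⊔n≤o⇒n≤o M N (inMN ≤n)))
           (hx m n (ℕ.m⊔n≤o⇒m≤o P Q (inPQ ≤m)) (ℕ.m⊔n≤o⇒m≤o P Q (inPQ ≤n)))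
           (hy m n (ℕ.m⊔n≤o⇒n≤o P Q (inPQ ≤m)) (ℕ.m⊔n≤o⇒n≤o P Q (inPQ ≤n))))

  ⊔-cauchy : ∀ x y → IsCauchy (λ n → seq x n ℚ.⊔ seq y n)
  ⊔-cauchy x y ε 0<ε =
    let (M , h) = cauchy x ε 0<ε
        (N , k) = cauchy y ε 0<ε
    in M ℕ.⊔ N , λ m n ≤m ≤n → dist-⊔ (seq x m) (seq y m) (seq x n) (seq y n)
         (h m n (ℕ.m⊔n≤o⇒m≤o M N ≤m) (ℕ.m⊔n≤o⇒m≤o M N ≤n))
         (k m n (ℕ.m⊔n≤o⇒n≤o M N ≤m) (ℕ.m⊔n≤o⇒n≤o M N ≤n))

infix 4 _≤ᵣ_ _<ᵣ_ _≈ᵣ_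

_≤ᵣ_ : ℝ → ℝ → Set
x ≤ᵣ y = ∀ ε → 0ℚ ℚ.< ε → ∃[ N ] (∀ n → N ℕ.≤ n → seq x n ℚ.≤ seq y n ℚ.+ ε)

_<ᵣ_ : ℝ → ℝ → Set
x <ᵣ y = ∃[ ε ] (0ℚ ℚ.< ε × ∃[ N ] (∀ n → N ℕ.≤ n → seq x n ℚ.+ ε ℚ.≤ seq y n))

_≈ᵣ_ : ℝ → ℝ → Set
x ≈ᵣ y = x ≤ᵣ y × y ≤ᵣ x

fromℚ : ℚ → ℝ
fromℚ q = mkℝ (λ _ → q) (const-cauchy q)

fromℕ : ℕ → ℝ
fromℕ n = fromℚ (+ n ℚ./ 1)

0ᵣ 1ᵣ : ℝ
0ᵣ = fromℚ 0ℚ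
1ᵣ = fromℚ 1ℚ

infixl 6 _+ᵣ_ _-ᵣ_ _⊔ᵣ_
infixl 7 _*ᵣ_
infixr 8 -ᵣ_ _^ᵣ_

_+ᵣ_ : ℝ → ℝ → ℝ
x +ᵣ y = mkℝ (λ n → seq x n ℚ.+ seq y n) (+-cauchy x y)

-ᵣ_ : ℝ → ℝ
-ᵣ x = mkℝ (λ n → ℚ.- seq x n) (neg-cauchy x)

_-ᵣ_ : ℝ → ℝ → ℝ
x -ᵣ y = x +ᵣ (-ᵣ y)

_*ᵣ_ : ℝ → ℝ → ℝ
x *ᵣ y = mkℝ (λ n → seq x n ℚ.* seq y n) (*-cauchy x y)

_⊔ᵣ_ : ℝ → ℝ → ℝ
x ⊔ᵣ y = mkℝ (λ n → seq x n ℚ.⊔ seq y n) (⊔-cauchy x y)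

_^ᵣ_ : ℝ → ℕ → ℝ
x ^ᵣ zero  = 1ᵣ
x ^ᵣ suc n = x *ᵣ x ^ᵣ n

-- IsPower b x y says y = bˣ (for b ≥ 1): y lies above b^r for every rational r ≤ x
-- and below b^r for every rational r ≥ x, which determines y uniquely. Writing
-- r = (u − v)/q and clearing denominators, r ≤ x becomes u ≤ q x + v and
-- b^r ≤ y becomes bᵘ ≤ y^q bᵛ. (The case q = 0 holds trivially.)
IsPower : ℕ → ℝ → ℝ → Set
IsPower b x y = 0ᵣ ≤ᵣ y × (∀ q u v →
  (fromℕ u ≤ᵣ fromℕ q *ᵣ x +ᵣ fromℕ v → fromℕ b ^ᵣ u ≤ᵣ y ^ᵣ q *ᵣ fromℕ b ^ᵣ v) ×
  (fromℕ q *ᵣ x +ᵣ fromℕ v ≤ᵣ fromℕ u → y ^ᵣ q *ᵣ fromℕ b ^ᵣ v ≤ᵣ fromℕ b ^ᵣ u))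

-- s = √(log₂ n)
IsSqrtLog₂ : ℕ → ℝ → Set
IsSqrtLog₂ n s = 0ᵣ ≤ᵣ s × IsPower 2 (s *ᵣ s) (fromℕ n)

∑ : ∀ {A : Set} → List A → (A → ℝ) → ℝ
∑ xs g = foldr (λ a r → g a +ᵣ r) 0ᵣ xs

subsets : ∀ n → List (Subset n)
subsets zero    = [] ∷ []
subsets (suc n) = List.map (outside ∷_) (subsets n) ++ List.map (inside ∷_) (subsets n)

SetFunction : ℕ → Set
SetFunction n = Subset n → ℝ

-- The empty set is feasible for every k, so it can serve as the initial value.
maxUpTo : ∀ {n} → ℕ → SetFunction n → ℝ
maxUpTo {n} k f = foldr (λ T r → f T ⊔ᵣ r) (f ⊥) (filter (λ T → ∣ T ∣ ℕ.≤? k) (subsets n))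

toList : ∀ {n} → Subset n → List (Fin n)
toList {n} S = filter (_∈? S) (allFin n)

covered : ∀ {n u} → (Fin n → Subset u) → Subset n → Subset u
covered T S = ⋃ (List.map T (toList S))

IsCoverageOver : ∀ {n} → ℕ → SetFunction n → Set
IsCoverageOver {n} u f =
  Σ[ w ∈ (Fin u → ℝ) ] Σ[ T ∈ (Fin n → Subset u) ]
    (∀ a → 0ᵣ ≤ᵣ w a) × (∀ S → f S ≈ᵣ ∑ (toList (covered T S)) w)

Class : Set₁
Class = ∀ {n} → SetFunction n → Set

Coverage : Class
Coverage f = ∃[ u ] IsCoverageOver u f

CoverageOfSize≤ : (ℕ → ℕ) → Class
CoverageOfSize≤ p {n} f = ∃[ u ] (u ℕ.≤ p n × IsCoverageOver u f)

PolynomiallyBounded : (ℕ → ℕ) → Set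
PolynomiallyBounded p = ∃₂ λ c n₀ → ∀ n → n₀ ℕ.≤ n → p n ℕ.≤ n ℕ.^ c

record Distribution (n : ℕ) : Set where
  field
    mass   : Subset n → ℝ
    nonneg : ∀ S → 0ᵣ ≤ᵣ mass S
    total  : ∑ (subsets n) mass ≈ᵣ 1ᵣ

open Distribution public

𝔼 : ∀ {n} → Distribution n → SetFunction n → ℝ
𝔼 {n} D g = ∑ (subsets n) (λ S → mass D S *ᵣ g S)

-- Expectation over m independent draws.
𝔼ⁿ : ∀ {n} → Distribution n → ∀ m → (Vec (Subset n) m → ℝ) → ℝ
𝔼ⁿ D zero    g = g []
𝔼ⁿ D (suc m) g = 𝔼 D (λ S → 𝔼ⁿ D m (λ Ss → g (S ∷ Ss)))

-- The event need not be decidable (it compares real numbers), so it is bounded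
-- from below by a decidable event contained in it; classically the event itself
-- can be taken.
Pr[_,_]_≥_ : ∀ {n} → Distribution n → ∀ m → (Vec (Subset n) m → Set) → ℝ → Set
Pr[ D , m ] P ≥ r = Σ[ E ∈ (Vec (Subset _) m → Bool) ]
  (∀ Ss → E Ss ≡ true → P Ss) × r ≤ᵣ 𝔼ⁿ D m (λ Ss → if E Ss then 1ᵣ else 0ᵣ)

Samples : ℕ → ℕ → Set
Samples n m = Vec (Subset n × ℝ) m

_≈ˢ_ : ∀ {n m} → Samples n m → Samples n m → Set
_≈ˢ_ = Pointwise (×-Pointwise _≡_ _≈ᵣ_)

-- A randomized algorithm is identified with its output distribution as a function
-- of the samples; this function must respect equality of real numbers.
record Algorithm (n k m : ℕ) : Set where
  field
    output      : Samples n m → Distribution n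
    extensional : ∀ {s t} → s ≈ˢ t → ∀ S → mass (output s) S ≈ᵣ mass (output t) S
    feasible    : ∀ s S → k ℕ.< ∣ S ∣ → mass (output s) S ≈ᵣ 0ᵣ

open Algorithm public

labelled : ∀ {n m} → SetFunction n → Vec (Subset n) m → Samples n m
labelled f = Vec.map (λ S → S , f S)

-- Optimizability for one fixed n, with m samples and failure probability δ.
OptimizableAt : ∀ {n} → Class → Distribution n → (k m : ℕ) → (α δ : ℝ) → Set
OptimizableAt {n} F D k m α δ = Σ[ A ∈ Algorithm n k m ] (∀ (f : SetFunction n) → F f →
  Pr[ D , m ] (λ Ss → α *ᵣ maxUpTo k f ≤ᵣ 𝔼 (output A (labelled f Ss)) f) ≥ (1ᵣ -ᵣ δ))

-- The ratio is given by a predicate: Ratio n α means that α is the ratio for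
-- ground sets of size n.
NotOptimizable : Class → (k : ℕ → ℕ) → (Ratio : ℕ → ℝ → Set) → Set
NotOptimizable F k Ratio =
  ∀ (m : ℕ → ℕ) → PolynomiallyBounded m →
  ∀ (δ : ℝ) → 0ᵣ ≤ᵣ δ → δ <ᵣ 1ᵣ →
  ∃[ n₀ ] (∀ n → n₀ ℕ.≤ n → ∀ α → Ratio n α →
    ∀ (D : Distribution n) → ¬ OptimizableAt F D (k n) (m n) α δ)

{-# OPTIONS --safe #-}

-- Two families g, b of weighted sets on a ground set X define coverage functions that
-- agree on all lists of at most ℓ points, although g contains every single point while b
-- has small total weight (relative to |X|). Take r disjoint copies of X; the i-th hard
-- function uses g on copy i and b on all others. In addition there are t mask colours,
-- and hitting all of them covers everything. Under a random labelling of the ground set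
-- by points of the copies and colours, a fixed sample almost surely either hits every
-- colour, or hits no copy more than ℓ times; in both cases its value does not depend on i.
-- So the output of the algorithm does not depend on i either, and averaged over i a set of
-- k = r² elements achieves only about a 1/r fraction of the optimum, which is attained on
-- copy i. The pair (g, b) comes from a pair on a constant-size set: if d = g − b vanishes
-- on at most ℓ points then so does 2^(ℓ+1) E_R d(S ∩ R) − d(S) for ℓ + 1 points, with R a
-- uniformly random subset, and its linear part remains positive. Products of families
-- preserve the agreement, so powers of the constant-size pair handle large k with
-- polynomially many sets.

module Submission where

open import Defs
open import Data.Bool.Base as Bool using (Bool; true; false; _∧_; _∨_; not; if_then_else_)
open import Data.Bool.ListAction using (any; all)
open import Data.Bool.Properties using (∧-comm; ∧-zeroʳ; ∨-assoc; ∨-comm; ∨-identityʳ; ∧-identityʳ)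
open import Data.Empty using (⊥)
open import Data.Fin.Base as Fin using (Fin; zero; suc)
import Data.Fin.Properties as Fin
open import Data.Fin.Subset as Subset using (Subset; inside; outside; ∣_∣; ⋃)
open import Data.Fin.Subset.Properties using (_∈?_; x∈p∪q⁻; x∈p∪q⁺; ∉⊥; ∣⊥∣≡0; ∣⊤∣≡n)
open import Data.List.Base as List
  using (List; []; _∷_; _++_; length; map; concatMap; filter; filterᵇ; allFin; tabulate; deduplicate; take; drop)
open import Data.List.Membership.Propositional using (_∈_; _∉_)
open import Data.List.Membership.Propositional.Properties
  using (∈-deduplicate⁺; ∈-deduplicate⁻; ∈-allFin; ∈-++⁺ˡ; ∈-++⁺ʳ; ∈-map⁺; ∈-map⁻; ∈-concatMap⁺; ∈-filter⁺; ∈-filter⁻)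
open import Data.List.Properties
  using (length-deduplicate; length-map; length-tabulate; length-take; take++drop≡id)
open import Data.List.Relation.Unary.All using ([]; _∷_)
open import Data.List.Relation.Unary.All.Properties using (All¬⇒¬Any)
open import Data.List.Relation.Unary.AllPairs using ([]; _∷_)
open import Data.List.Relation.Unary.Any as Any using (here; there)
import Data.List.Relation.Unary.Unique.DecPropositional.Properties as UniqueDec
open import Data.List.Relation.Unary.Unique.Propositional using (Unique)
open import Data.List.Relation.Unary.Unique.Propositional.Properties using (filter⁺)
open import Data.Nat.Base as ℕ hiding (_/_; _%_)
open import Data.Nat.DivMod using (m/n*n≤m; m%n<n; m≡m%n+[m/n]*n; /-monoˡ-≤; m*n/n≡m)
open import Data.Nat.Properties as ℕ
open import Data.Nat.Tactic.RingSolver using (solve-∀)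
open import Data.Product.Base using (_×_; _,_; proj₁; proj₂; ∃-syntax; Σ-syntax)
open import Data.Sum.Base as Sum using (_⊎_; inj₁; inj₂)
open import Data.Vec.Base as Vec using (Vec; []; _∷_; lookup; _[_]≔_; head; tail)
open import Data.Vec.Properties using (lookup∘updateAt′; lookup⇒[]=; []=⇒lookup; lookup∘tabulate)
open import Data.Vec.Relation.Binary.Pointwise.Inductive using ([]; _∷_)
open import Function.Base using (_∘_; id)
open import Relation.Binary.Bundles using (Preorder)
open import Relation.Binary.PropositionalEquality
open import Relation.Nullary.Decidable using (T?; yes; no; does; dec-true)
open import Relation.Nullary.Negation.Core using (¬_; contradiction)
open import Relation.Unary using (Decidable)

-- The distribution is arbitrary, so all randomness sits in the labelling: for each fixed sample
-- set, few labellings are bad. The exponent 1/5 comes from the sizes. Masks must not pay: k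
-- elements hit at most k of the t colours, so t = rk leaves them a 1/r fraction. The b-values of
-- the r copies must not pay either: together they are worth about r points, which has to stay below
-- k/r, whence k = r². A sample of about t elements (up to a factor y) hits all colours. Below that
-- size no copy may be crowded, so a copy must hold less than a 1/t share of all labels; this forces
-- each colour to be repeated w ≈ k times. There are then about tw = r⁵ labels, each point of a copy
-- must really occur, and so n ≈ r⁵ up to lower-order factors. The bound k(n) is fixed before the
-- number of samples and δ, so it cannot depend on ℓ, which grows with the degree of the sample
-- bound. The constants that depend on ℓ are absorbed by letting y grow. Probabilities are counts in
-- ℕ with denominators cleared; reals enter only with the given distribution and the algorithm.

private variable
  A B X Y Z : Set
  n : ℕ

-- Finite sums as counting measures

⟦_⟧ : Bool → ℕ
⟦ true ⟧  = 1
⟦ false ⟧ = 0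

⟦⟧≤1 : ∀ b → ⟦ b ⟧ ≤ 1
⟦⟧≤1 true  = ≤-refl
⟦⟧≤1 false = z≤n

⟦∨⟧≤ : ∀ b c → ⟦ b ∨ c ⟧ ≤ ⟦ b ⟧ + ⟦ c ⟧
⟦∨⟧≤ true  c = s≤s z≤n
⟦∨⟧≤ false c = ≤-refl

sumOf : List A → (A → ℕ) → ℕ
sumOf []       f = 0
sumOf (x ∷ xs) f = f x + sumOf xs f

sum-cong : ∀ (xs : List A) {f g : A → ℕ} → (∀ x → f x ≡ g x) → sumOf xs f ≡ sumOf xs g
sum-cong []       e = refl
sum-cong (x ∷ xs) e = cong₂ _+_ (e x) (sum-cong xs e)

sum-mono : ∀ (xs : List A) {f g : A → ℕ} → (∀ x → f x ≤ g x) → sumOf xs f ≤ sumOf xs g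
sum-mono []       h = z≤n
sum-mono (x ∷ xs) h = +-mono-≤ (h x) (sum-mono xs h)

sum-+ : ∀ (xs : List A) (f g : A → ℕ) → sumOf xs (λ x → f x + g x) ≡ sumOf xs f + sumOf xs g
sum-+ []       f g = refl
sum-+ (x ∷ xs) f g rewrite sum-+ xs f g = lem (f x) (g x) _ _
  where
  lem : ∀ a b c d → a + b + (c + d) ≡ a + c + (b + d)
  lem = solve-∀

sum-* : ∀ (xs : List A) c (f : A → ℕ) → sumOf xs (λ x → c * f x) ≡ c * sumOf xs f
sum-* []       c f = sym (*-zeroʳ c)
sum-* (x ∷ xs) c f rewrite sum-* xs c f = sym (*-distribˡ-+ c (f x) _)

sum-const : ∀ (xs : List A) c → sumOf xs (λ _ → c) ≡ length xs * c
sum-const []       c = refl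
sum-const (x ∷ xs) c = cong (c +_) (sum-const xs c)

sum-zero : ∀ (xs : List A) → sumOf xs (λ _ → 0) ≡ 0
sum-zero xs = trans (sum-const xs 0) (*-zeroʳ (length xs))

sum-swap : ∀ (xs : List A) (ys : List B) (f : A → B → ℕ) →
  sumOf xs (λ x → sumOf ys (f x)) ≡ sumOf ys (λ y → sumOf xs (λ x → f x y))
sum-swap []       ys f = sym (sum-zero ys)
sum-swap (x ∷ xs) ys f = trans (cong (sumOf ys (f x) +_) (sum-swap xs ys f))
  (sym (sum-+ ys (f x) _))

sum-++ : ∀ (xs ys : List A) (f : A → ℕ) → sumOf (xs ++ ys) f ≡ sumOf xs f + sumOf ys f
sum-++ []       ys f = refl
sum-++ (x ∷ xs) ys f rewrite sum-++ xs ys f = sym (+-assoc (f x) _ _)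

sum-map : ∀ (h : A → B) (xs : List A) (f : B → ℕ) → sumOf (map h xs) f ≡ sumOf xs (f ∘ h)
sum-map h []       f = refl
sum-map h (x ∷ xs) f = cong (f (h x) +_) (sum-map h xs f)

sum-concatMap : ∀ (h : A → List B) (xs : List A) (f : B → ℕ) →
  sumOf (concatMap h xs) f ≡ sumOf xs (λ x → sumOf (h x) f)
sum-concatMap h []       f = refl
sum-concatMap h (x ∷ xs) f =
  trans (sum-++ (h x) _ f) (cong (sumOf (h x) f +_) (sum-concatMap h xs f))

length≡sum : ∀ (xs : List A) → length xs ≡ sumOf xs (λ _ → 1)
length≡sum xs = sym (trans (sum-const xs 1) (*-identityʳ _))

length-concatMap : ∀ (h : A → List B) (xs : List A) →
  length (concatMap h xs) ≡ sumOf xs (length ∘ h)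
length-concatMap h xs = trans (length≡sum (concatMap h xs))
  (trans (sum-concatMap h xs _) (sum-cong xs (λ x → sym (length≡sum (h x)))))

-- One enumeration serves three purposes: the subsets of a finite set, the points of a product
-- gadget, and the uniform probability space of labellings.
vectors : List A → ∀ n → List (Vec A n)
vectors xs zero    = [] ∷ []
vectors xs (suc n) = concatMap (λ x → map (x ∷_) (vectors xs n)) xs

sum-vectors : ∀ (xs : List A) n (f : Vec A (suc n) → ℕ) →
  sumOf (vectors xs (suc n)) f ≡ sumOf xs (λ x → sumOf (vectors xs n) (λ v → f (x ∷ v)))
sum-vectors xs n f = trans (sum-concatMap _ xs f)
  (sum-cong xs (λ x → sum-map (x ∷_) (vectors xs n) f))

length-vectors : ∀ (xs : List A) n → length (vectors xs n) ≡ length xs ^ n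
length-vectors xs zero    = refl
length-vectors xs (suc n) = begin
  length (vectors xs (suc n))                 ≡⟨ length≡sum (vectors xs (suc n)) ⟩
  sumOf (vectors xs (suc n)) (λ _ → 1)        ≡⟨ sum-vectors xs n _ ⟩
  sumOf xs (λ _ → sumOf (vectors xs n) (λ _ → 1))
                                              ≡⟨ sum-const xs _ ⟩
  length xs * sumOf (vectors xs n) (λ _ → 1)  ≡⟨ cong (length xs *_) (sym (length≡sum (vectors xs n))) ⟩
  length xs * length (vectors xs n)           ≡⟨ cong (length xs *_) (length-vectors xs n) ⟩
  length xs ^ suc n                           ∎
  where open ≡-Reasoning

-- Weighted set families and the pair of gadgets

-- A pair `(w , A)` is a child of weight w, given by the points whose sets contain it. In this
-- transposed view of a coverage function, thinning, products and copies are operations on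
-- predicates; natural weights keep the combinatorics free of reals.
Family : Set → Set
Family X = List (ℕ × (X → Bool))

val : Family X → List X → ℕ
val W S = sumOf W (λ c → proj₁ c * ⟦ any (proj₂ c) S ⟧)

tot : Family X → ℕ
tot W = sumOf W proj₁

scale : ℕ → Family X → Family X
scale c = map (λ (w , A) → c * w , A)

val-scale : ∀ c (W : Family X) S → val (scale c W) S ≡ c * val W S
val-scale c W S = trans (sum-map _ W _)
  (trans (sum-cong W (λ (w , A) → *-assoc c w _)) (sum-* W c _))

tot-scale : ∀ c (W : Family X) → tot (scale c W) ≡ c * tot W
tot-scale c W = trans (sum-map _ W _) (sum-* W c proj₁)

val≤tot : ∀ (W : Family X) S → val W S ≤ tot W
val≤tot W S = sum-mono W (λ (w , A) →
  ≤-trans (*-monoʳ-≤ w (⟦⟧≤1 (any A S))) (≤-reflexive (*-identityʳ w)))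

val-[] : ∀ (W : Family X) → val W [] ≡ 0
val-[] W = trans (sum-cong W (λ (w , _) → *-zeroʳ w)) (sum-zero W)

any-true : ∀ (A : X → Bool) {x S} → x ∈ S → A x ≡ true → any A S ≡ true
any-true A (here refl) e rewrite e = refl
any-true A (there {x = y} x∈S) e rewrite any-true A x∈S e with A y
... | true  = refl
... | false = refl

any-witness : ∀ (A : X → Bool) S → any A S ≡ true → ∃[ x ] (x ∈ S × A x ≡ true)
any-witness A (x ∷ S) e with A x in eq
... | true  = x , here refl , eq
... | false = let (y , y∈S , h) = any-witness A S e in y , there y∈S , h

bool-ext : ∀ {a b} → (a ≡ true → b ≡ true) → (b ≡ true → a ≡ true) → a ≡ b
bool-ext {true}  {true}  f g = refl
bool-ext {true}  {false} f g = sym (f refl)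
bool-ext {false} {true}  f g = g refl
bool-ext {false} {false} f g = refl

-- Multiplicities do not matter to a coverage value. This is how agreement on lists without
-- repetition passes to all lists.
val-∈ : ∀ (W : Family X) {S S′} → (∀ {x} → x ∈ S → x ∈ S′) → (∀ {x} → x ∈ S′ → x ∈ S) →
  val W S ≡ val W S′
val-∈ W {S} {S′} f g = sum-cong W (λ (w , A) → cong (λ b → w * ⟦ b ⟧) (bool-ext (to A f) (to A g)))
  where
  to : ∀ {S S′} A → (∀ {x} → x ∈ S → x ∈ S′) → any A S ≡ true → any A S′ ≡ true
  to {S} A f e = let (x , x∈S , h) = any-witness A S e in any-true A (f x∈S) h

any-filter : ∀ (A R : X → Bool) S → any (λ x → A x ∧ R x) S ≡ any A (filterᵇ R S)
any-filter A R [] = refl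
any-filter A R (x ∷ S) with R x
... | true  rewrite any-filter A R S = cong (_∨ any A (filterᵇ R S)) (∧-identityʳ (A x))
... | false rewrite any-filter A R S | ∧-zeroʳ (A x) = refl

filter-all : ∀ (R : X → Bool) S → all R S ≡ true → filterᵇ R S ≡ S
filter-all R []      e = refl
filter-all R (x ∷ S) e with R x
... | true = cong (x ∷_) (filter-all R S e)

length-filterᵇ : ∀ (R : X → Bool) S → length (filterᵇ R S) ≤ length S
length-filterᵇ R [] = z≤n
length-filterᵇ R (x ∷ S) with R x
... | true  = s≤s (length-filterᵇ R S)
... | false = m≤n⇒m≤1+n (length-filterᵇ R S)

length-filter-< : ∀ (R : X → Bool) S → all R S ≡ false → length (filterᵇ R S) < length S
length-filter-< R (x ∷ S) e with R x
... | true  = s≤s (length-filter-< R S e)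
... | false = s≤s (length-filterᵇ R S)

-- Uniformly random subsets of a finite set

bools : List Bool
bools = true ∷ false ∷ []

sets : ∀ q → List (Vec Bool q)
sets q = vectors bools q

sum-sets : ∀ q (F : Vec Bool (suc q) → ℕ) → sumOf (sets (suc q)) F ≡
  sumOf (sets q) (λ R → F (true ∷ R)) + sumOf (sets q) (λ R → F (false ∷ R))
sum-sets q F = trans (sum-vectors bools q F) (cong (sumOf (sets q) (F ∘ (true ∷_)) +_) (+-identityʳ _))

∣sets∣ : ∀ q → sumOf (sets q) (λ _ → 1) ≡ 2 ^ q
∣sets∣ q = trans (sym (length≡sum (sets q))) (length-vectors bools q)

-- Subsets come in pairs that differ only at x. The hypothesis says that F does not distinguish the
-- two members of a pair, exactly one of which contains x.
half-contain : ∀ {q} (x : Fin q) (F : Vec Bool q → ℕ) → (∀ R b → F (R [ x ]≔ b) ≡ F R) →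
  2 * sumOf (sets q) (λ R → ⟦ lookup R x ⟧ * F R) ≡ sumOf (sets q) F
half-contain {suc q} zero F inv = begin
  2 * sumOf (sets (suc q)) (λ R → ⟦ lookup R zero ⟧ * F R)
    ≡⟨ cong (2 *_) (sum-sets q _) ⟩
  2 * (sumOf (sets q) (λ R → 1 * F (true ∷ R)) + sumOf (sets q) (λ R → 0))
    ≡⟨ cong₂ (λ a b → 2 * (a + b)) (sum-cong (sets q) (λ R → *-identityˡ (F (true ∷ R))))
         (sum-zero (sets q)) ⟩
  2 * (Σt + 0)   ≡⟨ cong (2 *_) (+-identityʳ Σt) ⟩
  Σt + (Σt + 0)  ≡⟨ cong (Σt +_) (+-identityʳ Σt) ⟩
  Σt + Σt        ≡⟨ cong (Σt +_) (sum-cong (sets q) (λ R → sym (inv (true ∷ R) false))) ⟩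
  Σt + sumOf (sets q) (λ R → F (false ∷ R))
                 ≡⟨ sum-sets q F ⟨
  sumOf (sets (suc q)) F ∎
  where
  open ≡-Reasoning
  Σt = sumOf (sets q) (λ R → F (true ∷ R))
half-contain {suc q} (suc x) F inv = begin
  2 * sumOf (sets (suc q)) (λ R → ⟦ lookup R (suc x) ⟧ * F R)
    ≡⟨ cong (2 *_) (sum-sets q _) ⟩
  2 * (sumOf (sets q) (λ R → ⟦ lookup R x ⟧ * F (true ∷ R)) + sumOf (sets q) (λ R → ⟦ lookup R x ⟧ * F (false ∷ R)))
    ≡⟨ *-distribˡ-+ 2 (sumOf (sets q) (λ R → ⟦ lookup R x ⟧ * F (true ∷ R))) _ ⟩
  _ ≡⟨ cong₂ _+_ (half-contain x (F ∘ (true ∷_)) (λ R → inv (true ∷ R)))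
                 (half-contain x (F ∘ (false ∷_)) (λ R → inv (false ∷ R))) ⟩
  sumOf (sets q) (λ R → F (true ∷ R)) + sumOf (sets q) (λ R → F (false ∷ R))
    ≡⟨ sum-sets q F ⟨
  sumOf (sets (suc q)) F ∎
  where open ≡-Reasoning

all-update : ∀ {q} (x : Fin q) S → x ∉ S → ∀ R b →
  all (lookup (R [ x ]≔ b)) S ≡ all (lookup R) S
all-update x []      x∉ R b = refl
all-update x (y ∷ S) x∉ R b = cong₂ _∧_ (lookup∘updateAt′ y x (λ e → x∉ (here (sym e))) R)
  (all-update x S (x∉ ∘ there) R b)

⟦∧⟧ : ∀ a b → ⟦ a ∧ b ⟧ ≡ ⟦ a ⟧ * ⟦ b ⟧
⟦∧⟧ true  b = sym (*-identityˡ ⟦ b ⟧)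
⟦∧⟧ false b = refl

-- A random subset contains each point of S independently with probability one half. Since S has no
-- repetition, the condition on the remaining points ignores the point peeled off.
sum-all : ∀ {q} (S : List (Fin q)) → Unique S →
  2 ^ length S * sumOf (sets q) (λ R → ⟦ all (lookup R) S ⟧) ≡ 2 ^ q
sum-all {q} [] _ = trans (*-identityˡ _) (∣sets∣ q)
sum-all {q} (x ∷ S) (x≢ ∷ u) = begin
  2 * 2 ^ length S * sumOf (sets q) (λ R → ⟦ lookup R x ∧ all (lookup R) S ⟧)
    ≡⟨ cong (2 * 2 ^ length S *_) (sum-cong (sets q) (λ R → ⟦∧⟧ (lookup R x) _)) ⟩
  2 * 2 ^ length S * s
    ≡⟨ lem (2 ^ length S) s ⟩
  2 ^ length S * (2 * s)
    ≡⟨ cong (2 ^ length S *_) (half-contain x (λ R → ⟦ all (lookup R) S ⟧)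
         (λ R b → cong ⟦_⟧ (all-update x S (All¬⇒¬Any x≢) R b))) ⟩
  2 ^ length S * sumOf (sets q) (λ R → ⟦ all (lookup R) S ⟧)
    ≡⟨ sum-all S u ⟩
  2 ^ q ∎
  where
  open ≡-Reasoning
  s = sumOf (sets q) (λ R → ⟦ lookup R x ⟧ * ⟦ all (lookup R) S ⟧)
  lem : ∀ a b → 2 * a * b ≡ a * (2 * b)
  lem = solve-∀

length-filter≡ : ∀ (R : X → Bool) x S →
  length (filterᵇ R (x ∷ S)) ≡ ⟦ R x ⟧ * 1 + length (filterᵇ R S)
length-filter≡ R x S with R x
... | true  = refl
... | false = refl

-- Thinning halves the linear part of d on average. Against the factor 2^(ℓ+2) of the recursion this
-- still leaves a positive linear part.
sum-length-filter : ∀ {q} (S : List (Fin q)) →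
  2 * sumOf (sets q) (λ R → length (filterᵇ (lookup R) S)) ≡ 2 ^ q * length S
sum-length-filter {q} [] = trans (cong (2 *_) (sum-zero (sets q))) (sym (*-zeroʳ (2 ^ q)))
sum-length-filter {q} (x ∷ S) = begin
  2 * sumOf (sets q) (λ R → length (filterᵇ (lookup R) (x ∷ S)))
    ≡⟨ cong (2 *_) (trans (sum-cong (sets q) (λ R → length-filter≡ (lookup R) x S)) (sum-+ (sets q) _ _)) ⟩
  2 * (s + s′)     ≡⟨ *-distribˡ-+ 2 s s′ ⟩
  2 * s + 2 * s′   ≡⟨ cong₂ _+_ (trans (half-contain x (λ _ → 1) (λ _ _ → refl)) (∣sets∣ q)) (sum-length-filter S) ⟩
  2 ^ q + 2 ^ q * length S ≡⟨ *-suc (2 ^ q) (length S) ⟨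
  2 ^ q * suc (length S) ∎
  where
  open ≡-Reasoning
  s  = sumOf (sets q) (λ R → ⟦ lookup R x ⟧ * 1)
  s′ = sumOf (sets q) (λ R → length (filterᵇ (lookup R) S))

thin : ∀ {q} → Family (Fin q) → Family (Fin q)
thin {q} W = concatMap (λ R → map (λ (w , A) → w , λ x → A x ∧ lookup R x) W) (sets q)

val-thin : ∀ {q} (W : Family (Fin q)) S →
  val (thin W) S ≡ sumOf (sets q) (λ R → val W (filterᵇ (lookup R) S))
val-thin {q} W S = trans (sum-concatMap _ (sets q) _) (sum-cong (sets q) (λ R →
  trans (sum-map _ W _) (sum-cong W (λ (w , A) → cong (λ b → w * ⟦ b ⟧) (any-filter A (lookup R) S)))))

tot-thin : ∀ {q} (W : Family (Fin q)) → tot (thin W) ≡ 2 ^ q * tot W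
tot-thin {q} W = trans (sum-concatMap _ (sets q) _) (trans (sum-cong (sets q) (λ R → sum-map _ W _))
  (trans (sum-const (sets q) (tot W)) (cong (_* tot W) (length-vectors bools q))))

-- The identity agree says that L |S| + g₀ − b vanishes on sets of at most ℓ + 1 points.
record Base (q ℓ : ℕ) : Set where
  field
    L     : ℕ
    L>0   : 0 < L
    g₀ b  : Family (Fin q)
    agree : ∀ S → Unique S → length S ≤ suc ℓ → L * length S + val g₀ S ≡ val b S
    small : tot b + tot g₀ ≤ 5 ^ ℓ * L

-- The recursion is d′(S) = c Σ_R d(S ∩ R) − 2^q d(S), with c = 2^(ℓ+2) and the positive
-- and negative parts of d kept separate.
base : ∀ q ℓ → Base q ℓ
-- Here d(S) = |S| - 1 for nonempty S, which vanishes on single points. The subtracted 1 is one set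
-- containing everything.
base q zero = record
  { L = 1 ; L>0 = s≤s z≤n ; g₀ = [] ; b = (1 , λ _ → true) ∷ []
  ; agree = agree ; small = ≤-refl }
  where
  agree : ∀ S → Unique S → length S ≤ 1 → 1 * length S + 0 ≡ 1 * ⟦ any (λ _ → true) S ⟧ + 0
  agree []          _ _ = refl
  agree (x ∷ [])    _ _ = refl
  agree (x ∷ y ∷ S) _ (s≤s ())
base q (suc ℓ) = record
  { L     = P * (μ * L)
  ; L>0   = *-mono-≤ {1} {P} (m^n>0 2 q) (*-mono-≤ {1} {μ} 0<μ L>0)
  ; g₀    = scale c (thin g₀) ++ scale P b
  ; b     = scale c (thin b) ++ scale P g₀
  ; agree = agree′
  ; small = small′
  }
  where
  open Base (base q ℓ)
  P = 2 ^ q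
  -- The thinned linear part is c · 2^(q-1) |S| = 2^q · 2^(ℓ+1) |S|; subtracting 2^q |S| leaves the
  -- coefficient 2^q μ.
  μ = 2 ^ suc ℓ ∸ 1
  c = 2 ^ suc (suc ℓ)
  eqμ : 2 ^ suc ℓ ≡ 1 + μ
  eqμ = sym (m+[n∸m]≡n (m^n>0 2 (suc ℓ)))
  0<μ : 0 < μ
  0<μ = s≤s⁻¹ (subst (2 ≤_) eqμ (*-monoʳ-≤ 2 (m^n>0 2 ℓ)))
  G H : List (Fin q) → ℕ
  G S = L * length S + val g₀ S
  H S = val b S
  filtered : Vec Bool q → List (Fin q) → List (Fin q)
  filtered R S = filterᵇ (lookup R) S
  -- If R contains S, then S ∩ R = S and both sides are the same sum. Otherwise S ∩ R is strictly
  -- shorter than S, so the induction hypothesis applies to it.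
  restricted : ∀ R S → Unique S → length S ≤ suc (suc ℓ) →
    G (filtered R S) + ⟦ all (lookup R) S ⟧ * H S ≡ H (filtered R S) + ⟦ all (lookup R) S ⟧ * G S
  restricted R S u h with all (lookup R) S in eq
  ... | true rewrite filter-all (lookup R) S eq = lem (G S) (H S)
    where
    lem : ∀ a b → a + 1 * b ≡ b + 1 * a
    lem = solve-∀
  ... | false = cong (_+ 0) (agree (filtered R S) (filter⁺ (T? ∘ lookup R) u)
                  (s≤s⁻¹ (≤-trans (length-filter-< (lookup R) S eq) h)))
  -- On short lists every d(S ∩ R) and d(S) vanish by induction. On a list of exactly ℓ + 2 points
  -- only the R containing S contribute; there are 2^q / 2^(ℓ+2) of them, each contributing d(S),
  -- and c = 2^(ℓ+2) makes their total cancel 2^q d(S).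
  balance : ∀ S → Unique S → length S ≤ suc (suc ℓ) →
    c * sumOf (sets q) (λ R → G (filtered R S)) + P * H S ≡
    c * sumOf (sets q) (λ R → H (filtered R S)) + P * G S
  balance S u h with m≤n⇒m<n∨m≡n h
  ... | inj₁ h′ = cong₂ (λ a b → c * a + P * b)
      (sum-cong (sets q) (λ R → agree (filtered R S) (filter⁺ (T? ∘ lookup R) u)
        (≤-trans (length-filterᵇ (lookup R) S) (s≤s⁻¹ h′))))
      (sym (agree S u (s≤s⁻¹ h′)))
  ... | inj₂ e = begin
      c * ΣG + P * H S                   ≡⟨ cong (λ p → c * ΣG + p * H S) eqP ⟨
      c * ΣG + c * N * H S               ≡⟨ lem c ΣG N (H S) ⟩
      c * (ΣG + N * H S)                 ≡⟨ cong (c *_) (trans (split G (H S)) (trans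
                                              (sum-cong (sets q) (λ R → restricted R S u h))
                                              (sym (split H (G S))))) ⟩
      c * (ΣB + N * G S)                 ≡⟨ lem c ΣB N (G S) ⟨
      c * ΣB + c * N * G S               ≡⟨ cong (λ p → c * ΣB + p * G S) eqP ⟩
      c * ΣB + P * G S                   ∎
    where
    open ≡-Reasoning
    N  = sumOf (sets q) (λ R → ⟦ all (lookup R) S ⟧)
    ΣG = sumOf (sets q) (λ R → G (filtered R S))
    ΣB = sumOf (sets q) (λ R → H (filtered R S))
    eqP : c * N ≡ P
    eqP = trans (cong (λ z → 2 ^ z * N) (sym e)) (sum-all S u)
    lem : ∀ c a n b → c * a + c * n * b ≡ c * (a + n * b)
    lem = solve-∀
    split : ∀ (F : List (Fin q) → ℕ) z → sumOf (sets q) (λ R → F (filtered R S)) + N * z ≡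
      sumOf (sets q) (λ R → F (filtered R S) + ⟦ all (lookup R) S ⟧ * z)
    split F z = trans (cong (_ +_) (trans (*-comm N z) (trans (sym (sum-* (sets q) z _))
      (sum-cong (sets q) (λ R → *-comm z _))))) (sym (sum-+ (sets q) _ _))
  agree′ : ∀ S → Unique S → length S ≤ suc (suc ℓ) →
    P * (μ * L) * length S + val (scale c (thin g₀) ++ scale P b) S ≡
    val (scale c (thin b) ++ scale P g₀) S
  -- Adding 2^q L |S| to both sides replaces μ by 1 + μ = 2^(ℓ+1) and so avoids truncated
  -- subtraction.
  agree′ S u h = +-cancelˡ-≡ (P * (L * len)) _ _ (begin
    P * (L * len) + (P * (μ * L) * len + val (scale c (thin g₀) ++ scale P b) S)
      ≡⟨ cong (λ z → P * (L * len) + (P * (μ * L) * len + z)) (expand g₀ b) ⟩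
    P * (L * len) + (P * (μ * L) * len + (c * Σg + P * H S))
      ≡⟨ lem₁ P L len μ (c * Σg) (P * H S) ⟩
    (1 + μ) * L * (P * len) + c * Σg + P * H S
      ≡⟨ cong₂ (λ a b → a * L * b + c * Σg + P * H S) (sym eqμ) (sym (sum-length-filter S)) ⟩
    2 ^ suc ℓ * L * (2 * Σn) + c * Σg + P * H S
      ≡⟨ lem₂ (2 ^ suc ℓ) L Σn Σg (P * H S) ⟩
    c * (L * Σn + Σg) + P * H S
      ≡⟨ cong (λ z → c * z + P * H S) (sym (trans (sum-+ (sets q) _ _) (cong (_+ Σg) (sum-* (sets q) L _)))) ⟩
    c * sumOf (sets q) (λ R → G (filtered R S)) + P * H S
      ≡⟨ balance S u h ⟩
    c * Σb + P * (L * len + val g₀ S)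
      ≡⟨ lem₃ (c * Σb) P (L * len) (val g₀ S) ⟩
    P * (L * len) + (c * Σb + P * val g₀ S)
      ≡⟨ cong (P * (L * len) +_) (expand b g₀) ⟨
    P * (L * len) + val (scale c (thin b) ++ scale P g₀) S ∎)
    where
    open ≡-Reasoning
    len = length S
    Σn = sumOf (sets q) (λ R → length (filtered R S))
    Σg = sumOf (sets q) (λ R → val g₀ (filtered R S))
    Σb = sumOf (sets q) (λ R → val b (filtered R S))
    expand : ∀ V W → val (scale c (thin V) ++ scale P W) S ≡
      c * sumOf (sets q) (λ R → val V (filtered R S)) + P * val W S
    expand V W = trans (sum-++ (scale c (thin V)) (scale P W) _) (cong₂ _+_
      (trans (val-scale c (thin V) S) (cong (c *_) (val-thin V S))) (val-scale P W S))
    lem₁ : ∀ P L n μ x y → P * (L * n) + (P * (μ * L) * n + (x + y)) ≡ (1 + μ) * L * (P * n) + x + y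
    lem₁ = solve-∀
    lem₂ : ∀ e L s g y → e * L * (2 * s) + (e + (e + 0)) * g + y ≡ (e + (e + 0)) * (L * s + g) + y
    lem₂ = solve-∀
    lem₃ : ∀ x P a b → x + P * (a + b) ≡ P * a + (x + P * b)
    lem₃ = solve-∀
  small′ : tot (scale c (thin b) ++ scale P g₀) + tot (scale c (thin g₀) ++ scale P b) ≤
    5 ^ suc ℓ * (P * (μ * L))
  small′ = begin
    tot (scale c (thin b) ++ scale P g₀) + tot (scale c (thin g₀) ++ scale P b)
      ≡⟨ cong₂ _+_ (expand b g₀) (expand g₀ b) ⟩
    c * (P * tot b) + P * tot g₀ + (c * (P * tot g₀) + P * tot b)
      ≡⟨ lem₁ c P (tot b) (tot g₀) ⟩
    P * ((c + 1) * (tot b + tot g₀))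
      ≤⟨ *-monoʳ-≤ P (*-mono-≤ c+1≤ small) ⟩
    P * (5 * μ * (5 ^ ℓ * L))
      ≡⟨ lem₂ P μ (5 ^ ℓ) L ⟩
    5 ^ suc ℓ * (P * (μ * L)) ∎
    where
    open ≤-Reasoning
    expand : ∀ V W → tot (scale c (thin V) ++ scale P W) ≡ c * (P * tot V) + P * tot W
    expand V W = trans (sum-++ (scale c (thin V)) (scale P W) _) (cong₂ _+_
      (trans (tot-scale c (thin V)) (cong (c *_) (tot-thin V))) (tot-scale P W))
    lem₁ : ∀ c P b g → c * (P * b) + P * g + (c * (P * g) + P * b) ≡ P * ((c + 1) * (b + g))
    lem₁ = solve-∀
    lem₂ : ∀ P μ f L → P * (5 * μ * (f * L)) ≡ 5 * f * (P * (μ * L))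
    lem₂ = solve-∀
    -- c + 1 = 2μ + 3 and μ ≥ 1. Equality holds at ℓ = 0, which is the origin of the base 5 in
    -- `small`.
    c+1≤ : c + 1 ≤ 5 * μ
    c+1≤ = begin
      2 * 2 ^ suc ℓ + 1   ≡⟨ cong (λ z → 2 * z + 1) eqμ ⟩
      2 * (1 + μ) + 1     ≡⟨ lem₃ μ ⟩
      3 * 1 + 2 * μ       ≤⟨ +-monoˡ-≤ (2 * μ) (*-monoʳ-≤ 3 0<μ) ⟩
      3 * μ + 2 * μ       ≡⟨ *-distribʳ-+ μ 3 2 ⟨
      5 * μ               ∎
      where
      lem₃ : ∀ m → 2 * (1 + m) + 1 ≡ 3 * 1 + 2 * m
      lem₃ = solve-∀

infix 5 _==_

_==_ : ∀ {n} → Fin n → Fin n → Bool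
i == j = does (i Fin.≟ j)

sum-tabulate : ∀ {n} (h : Fin n → X) (f : X → ℕ) →
  sumOf (tabulate h) f ≡ sumOf (allFin n) (f ∘ h)
sum-tabulate {n = zero}  h f = refl
sum-tabulate {n = suc n} h f = cong (f (h zero) +_)
  (trans (sum-tabulate (h ∘ suc) f) (sym (sum-tabulate suc (f ∘ h))))

sum-allFin : ∀ n (f : Fin (suc n) → ℕ) → sumOf (allFin (suc n)) f ≡ f zero + sumOf (allFin n) (f ∘ suc)
sum-allFin n f = cong (f zero +_) (sum-tabulate suc f)

sum-replace : ∀ {n} (i : Fin n) (f g : Fin n → ℕ) →
  sumOf (allFin n) (λ j → if i == j then f j else g j) + g i ≡ f i + sumOf (allFin n) g
sum-replace {suc n} zero f g = begin
  sumOf (allFin (suc n)) (λ j → if zero == j then f j else g j) + g zero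
    ≡⟨ cong (_+ g zero) (sum-allFin n _) ⟩
  f zero + sumOf (allFin n) (g ∘ suc) + g zero
    ≡⟨ +-assoc (f zero) _ _ ⟩
  f zero + (sumOf (allFin n) (g ∘ suc) + g zero)
    ≡⟨ cong (f zero +_) (trans (+-comm _ (g zero)) (sym (sum-allFin n g))) ⟩
  f zero + sumOf (allFin (suc n)) g ∎
  where open ≡-Reasoning
sum-replace {suc n} (suc i) f g = begin
  sumOf (allFin (suc n)) (λ j → if suc i == j then f j else g j) + g (suc i)
    ≡⟨ cong (_+ g (suc i)) (sum-allFin n _) ⟩
  g zero + s + g (suc i)       ≡⟨ +-assoc (g zero) s _ ⟩
  g zero + (s + g (suc i))     ≡⟨ cong (g zero +_) (sum-replace i (f ∘ suc) (g ∘ suc)) ⟩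
  g zero + (f (suc i) + s′)    ≡⟨ lem (g zero) (f (suc i)) s′ ⟩
  f (suc i) + (g zero + s′)    ≡⟨ cong (f (suc i) +_) (sum-allFin n g) ⟨
  f (suc i) + sumOf (allFin (suc n)) g ∎
  where
  open ≡-Reasoning
  s  = sumOf (allFin n) (λ j → if i == j then f (suc j) else g (suc j))
  s′ = sumOf (allFin n) (g ∘ suc)
  lem : ∀ a b c → a + (b + c) ≡ b + (a + c)
  lem = solve-∀

sum-single : ∀ {n} (i : Fin n) → sumOf (allFin n) (λ j → ⟦ j == i ⟧) ≡ 1
sum-single {suc n} zero    = trans (sum-allFin n (λ j → ⟦ j == zero ⟧))
  (cong suc (sum-zero (allFin n)))
sum-single {suc n} (suc i) = trans (sum-allFin n (λ j → ⟦ j == suc i ⟧)) (sum-single i)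

any-cong : ∀ {A B : X → Bool} S → (∀ x → A x ≡ B x) → any A S ≡ any B S
any-cong []      e = refl
any-cong (x ∷ S) e = cong₂ _∨_ (e x) (any-cong S e)

any-map : ∀ (A : Y → Bool) (h : X → Y) S → any A (map h S) ≡ any (A ∘ h) S
any-map A h []      = refl
any-map A h (x ∷ S) = cong (A (h x) ∨_) (any-map A h S)

==-refl : ∀ {n} (i : Fin n) → (i == i) ≡ true
==-refl i = dec-true (i Fin.≟ i) refl

==⇒≡ : ∀ {n} (i j : Fin n) → (i == j) ≡ true → i ≡ j
==⇒≡ i j e with i Fin.≟ j
... | yes p = p

-- Singletons of weight one realise the linear part of d as a coverage function, as long as no point
-- is repeated.
sum-points : ∀ {q} (S : List (Fin q)) → Unique S →
  sumOf (allFin q) (λ z → ⟦ any (z ==_) S ⟧) ≡ length S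
sum-points {q} []      _ = sum-zero (allFin q)
sum-points {q} (x ∷ S) (x≢ ∷ u) = begin
  sumOf (allFin q) (λ z → ⟦ (z == x) ∨ any (z ==_) S ⟧)
    ≡⟨ sum-cong (allFin q) disjoint ⟩
  sumOf (allFin q) (λ z → ⟦ z == x ⟧ + ⟦ any (z ==_) S ⟧)
    ≡⟨ sum-+ (allFin q) _ _ ⟩
  sumOf (allFin q) (λ z → ⟦ z == x ⟧) + sumOf (allFin q) (λ z → ⟦ any (z ==_) S ⟧)
    ≡⟨ cong₂ _+_ (sum-single x) (sum-points S u) ⟩
  suc (length S) ∎
  where
  open ≡-Reasoning
  disjoint : ∀ z → ⟦ (z == x) ∨ any (z ==_) S ⟧ ≡ ⟦ z == x ⟧ + ⟦ any (z ==_) S ⟧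
  disjoint z with z == x in e | any (z ==_) S in e′
  ... | false | c     = refl
  ... | true  | false = refl
  ... | true  | true  = let (y , y∈S , h) = any-witness (z ==_) S e′ in
    contradiction (subst (_∈ S) (trans (sym (==⇒≡ z y h)) (==⇒≡ z x e)) y∈S) (All¬⇒¬Any x≢)

-- Products of families and the gadgets built from them

pow : Family X → ∀ d → Family (Vec X d)
pow W zero    = (1 , λ _ → true) ∷ []
pow W (suc d) = concatMap (λ (w , A) →
  map (λ (w′ , A′) → w * w′ , λ z → A (head z) ∧ A′ (tail z)) (pow W d)) W

tot-pow : ∀ (W : Family X) d → tot (pow W d) ≡ tot W ^ d
tot-pow W zero    = refl
tot-pow W (suc d) = trans (sum-concatMap _ W proj₁) (trans (sum-cong W (λ (w , A) →
  trans (sum-map _ (pow W d) proj₁) (trans (sum-* (pow W d) w proj₁) (trans (cong (w *_) (tot-pow W d)) (*-comm w (tot W ^ d))))))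
  (trans (sum-* W (tot W ^ d) proj₁) (*-comm (tot W ^ d) (tot W))))

length-pow : ∀ (W : Family X) d → length (pow W d) ≡ length W ^ d
length-pow W zero    = refl
length-pow W (suc d) = trans (length-concatMap _ W)
  (trans (sum-cong W (λ _ → trans (length-map _ (pow W d)) (length-pow W d))) (sum-const W _))

-- The sets of a product are boxes. A box A × A′ meets S exactly when A′ meets the section of S over
-- A, or A the section of S over A′.
sliceTail : ∀ {d} → (X → Bool) → List (Vec X (suc d)) → List (Vec X d)
sliceTail A S = map tail (filterᵇ (A ∘ head) S)

sliceHead : ∀ {d} → (Vec X d → Bool) → List (Vec X (suc d)) → List X
sliceHead A S = map head (filterᵇ (A ∘ tail) S)

any-sliceHead : ∀ {d} (A : X → Bool) (A′ : Vec X d → Bool) S →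
  any (λ z → A (head z) ∧ A′ (tail z)) S ≡ any A (sliceHead A′ S)
any-sliceHead A A′ S = trans (any-filter (A ∘ head) (A′ ∘ tail) S) (sym (any-map A head (filterᵇ (A′ ∘ tail) S)))

any-sliceTail : ∀ {d} (A : X → Bool) (A′ : Vec X d → Bool) S →
  any (λ z → A (head z) ∧ A′ (tail z)) S ≡ any A′ (sliceTail A S)
any-sliceTail A A′ S = trans (any-cong S (λ z → ∧-comm (A (head z)) _))
  (trans (any-filter (A′ ∘ tail) (A ∘ head) S) (sym (any-map A′ tail (filterᵇ (A ∘ head) S))))

val-pow : ∀ (W : Family X) d S → val (pow W (suc d)) S ≡
  sumOf W (λ (w , A) → sumOf (pow W d) (λ (w′ , A′) → w * w′ * ⟦ any (λ z → A (head z) ∧ A′ (tail z)) S ⟧))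
val-pow W d S = trans (sum-concatMap _ W _) (sum-cong W (λ (w , A) → sum-map _ (pow W d) _))

val-pow-tail : ∀ (W : Family X) d S → val (pow W (suc d)) S ≡
  sumOf W (λ (w , A) → w * val (pow W d) (sliceTail A S))
val-pow-tail W d S = trans (val-pow W d S) (sum-cong W (λ (w , A) →
  trans (sum-cong (pow W d) (λ (w′ , A′) → trans (*-assoc w w′ _)
    (cong (λ b → w * (w′ * ⟦ b ⟧)) (any-sliceTail A A′ S)))) (sum-* (pow W d) w _)))

*-swap′ : ∀ a b c → a * (b * c) ≡ b * (a * c)
*-swap′ = solve-∀

*-swap : ∀ a b c → a * b * c ≡ b * (a * c)
*-swap a b c = trans (*-assoc a b c) (*-swap′ a b c)

val-pow-head : ∀ (W : Family X) d S → val (pow W (suc d)) S ≡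
  sumOf (pow W d) (λ (w′ , A′) → w′ * val W (sliceHead A′ S))
val-pow-head W d S = trans (val-pow W d S) (trans (sum-swap W (pow W d) _) (sum-cong (pow W d) (λ (w′ , A′) →
  trans (sum-cong W (λ (w , A) → trans (*-swap w w′ _)
    (cong (λ b → w′ * (w * ⟦ b ⟧)) (any-sliceHead A A′ S)))) (sum-* W w′ _))))

length-slice : ∀ (h : X → Y) A S → length (map h (filterᵇ A S)) ≤ length S
length-slice h A S = ≤-trans (≤-reflexive (length-map h (filterᵇ A S))) (length-filterᵇ A S)

-- Expanding the product along either factor reduces agreement to the two factors,
-- because slicing does not lengthen a list.
pow-agree : ∀ (W V : Family X) ℓ → (∀ S → length S ≤ ℓ → val W S ≡ val V S) →
  ∀ d S → length S ≤ ℓ → val (pow W d) S ≡ val (pow V d) S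
pow-agree W V ℓ h zero    S _ = refl
pow-agree W V ℓ h (suc d) S l = begin
  val (pow W (suc d)) S
    ≡⟨ val-pow-tail W d S ⟩
  sumOf W (λ (w , A) → w * val (pow W d) (sliceTail A S))
    ≡⟨ sum-cong W (λ (w , A) → trans
         (cong (w *_) (pow-agree W V ℓ h d (sliceTail A S) (≤-trans (length-slice tail _ S) l)))
         (trans (sym (sum-* (pow V d) w _)) (sum-cong (pow V d) (λ (w′ , A′) → trans (*-swap′ w w′ _)
           (cong (λ b → w′ * (w * ⟦ b ⟧)) (trans (sym (any-sliceTail A A′ S)) (any-sliceHead A A′ S))))))) ⟩
  sumOf W (λ (w , A) → sumOf (pow V d) (λ (w′ , A′) → w′ * (w * ⟦ any A (sliceHead A′ S) ⟧)))
    ≡⟨ sum-swap W (pow V d) _ ⟩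
  sumOf (pow V d) (λ (w′ , A′) → sumOf W (λ (w , A) → w′ * (w * ⟦ any A (sliceHead A′ S) ⟧)))
    ≡⟨ sum-cong (pow V d) (λ (w′ , A′) → trans (sum-* W w′ _)
         (cong (w′ *_) (h (sliceHead A′ S) (≤-trans (length-slice head _ S) l)))) ⟩
  sumOf (pow V d) (λ (w′ , A′) → w′ * val V (sliceHead A′ S))
    ≡⟨ val-pow-head V d S ⟨
  val (pow V (suc d)) S ∎
  where open ≡-Reasoning

eqVec : (X → X → Bool) → ∀ {d} → Vec X d → Vec X d → Bool
eqVec eq []      []      = true
eqVec eq (x ∷ u) (y ∷ v) = eq x y ∧ eqVec eq u v

-- A product of d singletons is a singleton of weight L^d. The other boxes can only add to the
-- value, hence an inequality.
pow-points : ∀ (eq : X → X → Bool) zs L (W₀ : Family X) d S →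
  sumOf (vectors zs d) (λ z → L ^ d * ⟦ any (eqVec eq z) S ⟧) ≤
  val (pow (map (λ z → L , eq z) zs ++ W₀) d) S
pow-points eq zs L W₀ zero    S = ≤-reflexive (cong (λ b → 1 * ⟦ b ⟧ + 0) (any-cong S (λ { [] → refl })))
pow-points eq zs L W₀ (suc d) S = begin
  sumOf (vectors zs (suc d)) (λ z → L ^ suc d * ⟦ any (eqVec eq z) S ⟧)
    ≡⟨ sum-vectors zs d _ ⟩
  sumOf zs (λ x → sumOf (vectors zs d) (λ z → L * L ^ d * ⟦ any (eqVec eq (x ∷ z)) S ⟧))
    ≡⟨ sum-cong zs (λ x → trans (sum-cong (vectors zs d) (λ z → trans (*-assoc L (L ^ d) _)
         (cong (λ b → L * (L ^ d * ⟦ b ⟧)) (trans (any-cong S (split x z)) (any-sliceTail (eq x) (eqVec eq z) S)))))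
         (sum-* (vectors zs d) L _)) ⟩
  sumOf zs (λ x → L * sumOf (vectors zs d) (λ z → L ^ d * ⟦ any (eqVec eq z) (sliceTail (eq x) S) ⟧))
    ≤⟨ sum-mono zs (λ x → *-monoʳ-≤ L (pow-points eq zs L W₀ d (sliceTail (eq x) S))) ⟩
  sumOf zs (λ x → L * val (pow W d) (sliceTail (eq x) S))
    ≡⟨ sum-map _ zs _ ⟨
  sumOf (map (λ z → L , eq z) zs) (λ (w , A) → w * val (pow W d) (sliceTail A S))
    ≤⟨ m≤m+n _ _ ⟩
  _ ≡⟨ sum-++ (map (λ z → L , eq z) zs) W₀ _ ⟨
  sumOf W (λ (w , A) → w * val (pow W d) (sliceTail A S))
    ≡⟨ val-pow-tail W d S ⟨
  val (pow W (suc d)) S ∎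
  where
  open ≤-Reasoning
  W = map (λ z → L , eq z) zs ++ W₀
  split : ∀ x z v → eqVec eq (x ∷ z) v ≡ eq x (head v) ∧ eqVec eq z (tail v)
  split x z (y ∷ v) = refl

-- The numerical bounds are indices, so that later estimates never look inside the two families. For
-- `points` a lower bound suffices: it serves only to make the optimum large.
record Gadget (eq : X → X → Bool) (zs : List X) (ℓ L T β s : ℕ) : Set where
  field
    g b    : Family X
    agree  : ∀ S → length S ≤ ℓ → val g S ≡ val b S
    points : ∀ S → sumOf zs (λ z → L * ⟦ any (eq z) S ⟧) ≤ val g S
    tot-g  : tot g ≤ T
    tot-b  : tot b ≤ β
    size-g : length g ≤ s
    size-b : length b ≤ s

module _ (q ℓ : ℕ) where
  open Base (base q ℓ)

  private
    pts G : Family (Fin q)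
    pts = map (λ z → L , (z ==_)) (allFin q)
    G = pts ++ g₀

    val-pts : ∀ S → val pts S ≡ sumOf (allFin q) (λ z → L * ⟦ any (z ==_) S ⟧)
    val-pts S = sum-map _ (allFin q) _

    agree-unique : ∀ S → Unique S → length S ≤ suc ℓ → val G S ≡ val b S
    agree-unique S u h = trans (sum-++ pts g₀ _) (trans
      (cong (_+ val g₀ S) (trans (val-pts S) (trans (sum-* (allFin q) L _) (cong (L *_) (sum-points S u)))))
      (agree S u h))

    agree-all : ∀ S → length S ≤ suc ℓ → val G S ≡ val b S
    agree-all S h = trans (val-∈ G to from) (trans (agree-unique S′ (UniqueDec.deduplicate-! Fin._≟_ S)
        (≤-trans (length-deduplicate Fin._≟_ S) h)) (val-∈ b from to))
      where
      S′ = deduplicate Fin._≟_ S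
      to : ∀ {x} → x ∈ S → x ∈ S′
      to = ∈-deduplicate⁺ Fin._≟_
      from : ∀ {x} → x ∈ S′ → x ∈ S
      from = ∈-deduplicate⁻ Fin._≟_ S

    tot-G : tot G ≤ (q + 5 ^ ℓ) * L
    tot-G = begin
      tot G                 ≡⟨ sum-++ pts g₀ proj₁ ⟩
      tot pts + tot g₀      ≡⟨ cong (_+ tot g₀) (trans (sum-map _ (allFin q) proj₁)
                                 (trans (sum-const (allFin q) L) (cong (_* L) (length-tabulate {n = q} id)))) ⟩
      q * L + tot g₀        ≤⟨ +-monoʳ-≤ (q * L) (≤-trans (m≤n+m (tot g₀) (tot b)) small) ⟩
      q * L + 5 ^ ℓ * L     ≡⟨ *-distribʳ-+ L q (5 ^ ℓ) ⟨
      (q + 5 ^ ℓ) * L       ∎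
      where open ≤-Reasoning

  gadgetWeight gadgetSize : ℕ
  gadgetWeight = L
  gadgetSize = length G ⊔ length b

  gadgetWeight>0 : 0 < gadgetWeight
  gadgetWeight>0 = L>0

  gadget : ∀ d → Gadget (eqVec _==_) (vectors (allFin q) d) (suc ℓ) (gadgetWeight ^ d)
    (((q + 5 ^ ℓ) * gadgetWeight) ^ d) ((5 ^ ℓ * gadgetWeight) ^ d) (gadgetSize ^ d)
  gadget d = record
    { g      = pow G d
    ; b      = pow b d
    ; agree  = pow-agree G b (suc ℓ) agree-all d
    ; points = pow-points _==_ (allFin q) L g₀ d
    ; tot-g  = ≤-trans (≤-reflexive (tot-pow G d)) (^-monoˡ-≤ d tot-G)
    ; tot-b  = ≤-trans (≤-reflexive (tot-pow b d)) (^-monoˡ-≤ d (≤-trans (m≤m+n (tot b) (tot g₀)) small))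
    ; size-g = ≤-trans (≤-reflexive (length-pow G d)) (^-monoˡ-≤ d (m≤m⊔n (length G) (length b)))
    ; size-b = ≤-trans (≤-reflexive (length-pow b d)) (^-monoˡ-≤ d (m≤n⊔m (length G) (length b)))
    }

-- The hard functions

length-allFin : ∀ n → length (allFin n) ≡ n
length-allFin n = length-tabulate {n = n} id

sum-∈ : ∀ {xs : List X} (f : X → ℕ) {x} → x ∈ xs → f x ≤ sumOf xs f
sum-∈ f (here refl)          = m≤m+n _ _
sum-∈ f (there {x = y} x∈xs) = ≤-trans (sum-∈ f x∈xs) (m≤n+m _ (f y))

sum-mono-∈ : ∀ (xs : List X) {f g : X → ℕ} → (∀ {x} → x ∈ xs → f x ≤ g x) → sumOf xs f ≤ sumOf xs g
sum-mono-∈ []       h = z≤n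
sum-mono-∈ (x ∷ xs) h = +-mono-≤ (h (here refl)) (sum-mono-∈ xs (h ∘ there))

any≤sum : ∀ (A : X → Bool) S → ⟦ any A S ⟧ ≤ sumOf S (λ x → ⟦ A x ⟧)
any≤sum A []      = z≤n
any≤sum A (x ∷ S) = ≤-trans (⟦∨⟧≤ (A x) (any A S)) (+-monoʳ-≤ ⟦ A x ⟧ (any≤sum A S))

any-false : ∀ (A : X → Bool) {x S} → any A S ≡ false → x ∈ S → A x ≡ false
any-false A {x} e x∈S with A x in eq
... | false = refl
... | true  = contradiction (trans (sym (any-true A x∈S eq)) e) (λ ())

⟦∧⟧≤ˡ : ∀ a b → ⟦ a ∧ b ⟧ ≤ ⟦ a ⟧
⟦∧⟧≤ˡ true  b = ⟦⟧≤1 b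
⟦∧⟧≤ˡ false b = z≤n

⟦∧⟧≤ʳ : ∀ a b → ⟦ a ∧ b ⟧ ≤ ⟦ b ⟧
⟦∧⟧≤ʳ true  b = ≤-refl
⟦∧⟧≤ʳ false b = z≤n

val-subadditive : ∀ (W : Family X) x S → val W (x ∷ S) ≤ val W (x ∷ []) + val W S
val-subadditive W x S = ≤-trans (sum-mono W (λ (w , A) → ≤-trans
    (*-monoʳ-≤ w (≤-trans (⟦∨⟧≤ (A x) (any A S))
      (≤-reflexive (cong (λ a → ⟦ a ⟧ + ⟦ any A S ⟧) (sym (∨-identityʳ (A x)))))))
    (≤-reflexive (*-distribˡ-+ w _ _)))) (≤-reflexive (sum-+ W _ _))

val≤length : ∀ (W : Family X) β → (∀ x → val W (x ∷ []) ≤ β) → ∀ S → val W S ≤ length S * β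
val≤length W β h []      = ≤-reflexive (val-[] W)
val≤length W β h (x ∷ S) = ≤-trans (val-subadditive W x S) (+-mono-≤ (h x) (val≤length W β h S))

-- A mask of colour c covers the c-th of t copies of the whole universe.
data Label (X : Set) (r t : ℕ) : Set where
  part : Fin r → X → Label X r t
  mask : Fin t → Label X r t

module _ {r t : ℕ} where

  isMask : Fin t → Label X r t → Bool
  isMask c (mask c′)  = c == c′
  isMask c (part _ _) = false

  hit : Fin t → List (Label X r t) → Bool
  hit c = any (isMask c)

  inPart : Fin r → Label X r t → Bool
  inPart j (part j′ x) = j == j′
  inPart j (mask _)    = false

  parts : Fin r → List (Label X r t) → List X
  parts j []               = []
  parts j (part j′ x ∷ S)  = if j == j′ then x ∷ parts j S else parts j S
  parts j (mask _ ∷ S)     = parts j S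

  covers : Fin t → Fin r → (X → Bool) → Label X r t → Bool
  covers c j A (part j′ x) = (j == j′) ∧ A x
  covers c j A (mask c′)   = c == c′

  any-covers : ∀ c j (A : X → Bool) S → any (covers c j A) S ≡ hit c S ∨ any A (parts j S)
  any-covers c j A [] = refl
  any-covers c j A (mask c′ ∷ S) = trans (cong ((c == c′) ∨_) (any-covers c j A S))
    (sym (∨-assoc (c == c′) (hit c S) _))
  any-covers c j A (part j′ x ∷ S) with j == j′
  ... | false = any-covers c j A S
  ... | true  = trans (cong (A x ∨_) (any-covers c j A S)) (trans (sym (∨-assoc (A x) (hit c S) _))
    (trans (cong (_∨ any A (parts j S)) (∨-comm (A x) (hit c S))) (∨-assoc (hit c S) (A x) _)))

  length-parts-∷ : ∀ j s (S : List (Label X r t)) →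
    length (parts j (s ∷ S)) ≡ ⟦ inPart j s ⟧ + length (parts j S)
  length-parts-∷ j (mask _) S = refl
  length-parts-∷ j (part j′ x) S with j == j′
  ... | true  = refl
  ... | false = refl

  parts-∈ : ∀ j (x : X) S → part j x ∈ S → x ∈ parts j S
  parts-∈ j x (part j′ y ∷ S) (here refl) rewrite ==-refl j = here refl
  parts-∈ j x (mask _ ∷ S)    (there h) = parts-∈ j x S h
  parts-∈ j x (part j′ y ∷ S) (there h) with j == j′
  ... | true  = there (parts-∈ j x S h)
  ... | false = parts-∈ j x S h

  sum-length-parts : ∀ (S : List (Label X r t)) → sumOf (allFin r) (λ j → length (parts j S)) ≤ length S
  sum-length-parts []      = ≤-reflexive (sum-zero (allFin r))
  sum-length-parts (s ∷ S) = begin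
    sumOf (allFin r) (λ j → length (parts j (s ∷ S)))
      ≡⟨ trans (sum-cong (allFin r) (λ j → length-parts-∷ j s S)) (sum-+ (allFin r) _ _) ⟩
    sumOf (allFin r) (λ j → ⟦ inPart j s ⟧) + sumOf (allFin r) (λ j → length (parts j S))
      ≤⟨ +-mono-≤ (one s) (sum-length-parts S) ⟩
    suc (length S) ∎
    where
    open ≤-Reasoning
    one : ∀ s → sumOf (allFin r) (λ j → ⟦ inPart j s ⟧) ≤ 1
    one (mask _)   = ≤-trans (≤-reflexive (sum-zero (allFin r))) z≤n
    one (part j′ _) = ≤-reflexive (sum-single j′)

  sum-hit : ∀ (S : List (Label X r t)) → sumOf (allFin t) (λ c → ⟦ hit c S ⟧) ≤ length S
  sum-hit S = begin
    sumOf (allFin t) (λ c → ⟦ hit c S ⟧)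
      ≤⟨ sum-mono (allFin t) (λ c → any≤sum (isMask c) S) ⟩
    sumOf (allFin t) (λ c → sumOf S (λ s → ⟦ isMask c s ⟧))
      ≡⟨ sum-swap (allFin t) S _ ⟩
    sumOf S (λ s → sumOf (allFin t) (λ c → ⟦ isMask c s ⟧))
      ≤⟨ sum-mono S one ⟩
    sumOf S (λ _ → 1)  ≡⟨ length≡sum S ⟨
    length S ∎
    where
    open ≤-Reasoning
    one : ∀ s → sumOf (allFin t) (λ c → ⟦ isMask c s ⟧) ≤ 1
    one (mask c)   = ≤-reflexive (sum-single c)
    one (part _ _) = ≤-trans (≤-reflexive (sum-zero (allFin t))) z≤n

module Hard (r t : ℕ) {eq : X → X → Bool} (eq-refl : ∀ x → eq x x ≡ true)
            {zs : List X} {ℓ L τ β s : ℕ} (G : Gadget eq zs (suc ℓ) L τ β s) where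
  open Gadget G

  choose : Fin r → Fin r → Family X
  choose i j = if i == j then g else b

  hard : Fin r → Family (Label X r t)
  hard i = concatMap (λ c → concatMap (λ j → map (λ (w , A) → w , covers c j A) (choose i j)) (allFin r)) (allFin t)

  totalWeight : Fin r → ℕ
  totalWeight i = sumOf (allFin r) (λ j → tot (choose i j))

  unmasked : Fin r → List (Label X r t) → ℕ
  unmasked i S = sumOf (allFin r) (λ j → val (choose i j) (parts j S))

  val-hard : ∀ i S → val (hard i) S ≡
    sumOf (allFin t) (λ c → if hit c S then totalWeight i else unmasked i S)
  val-hard i S = trans (sum-concatMap _ (allFin t) _) (sum-cong (allFin t) (λ c →
    trans (sum-concatMap _ (allFin r) _) (trans (sum-cong (allFin r) (λ j → trans (sum-map _ (choose i j) _)
      (sum-cong (choose i j) (λ (w , A) → cong (λ e → w * ⟦ e ⟧) (any-covers c j A S))))) (split c))))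
    where
    split : ∀ c → sumOf (allFin r) (λ j → sumOf (choose i j) (λ (w , A) → w * ⟦ hit c S ∨ any A (parts j S) ⟧)) ≡
      (if hit c S then totalWeight i else unmasked i S)
    split c with hit c S
    ... | true  = sum-cong (allFin r) (λ j → sum-cong (choose i j) (λ (w , A) → *-identityʳ w))
    ... | false = refl

  private
    if-push : ∀ {A B : Set} (f : A → B) c {x y} → f (if c then x else y) ≡ (if c then f x else f y)
    if-push f true  = refl
    if-push f false = refl

  -- The right-hand side does not mention i, so neither does the total weight: a copy of the
  -- universe whose colour is hit reveals nothing about i. Adding `tot b` replaces a subtraction.
  totalWeight-eq : ∀ i → totalWeight i + tot b ≡ tot g + r * tot b
  totalWeight-eq i = trans (cong (_+ tot b) (sum-cong (allFin r) (λ j → if-push tot (i == j))))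
    (trans (sum-replace i (λ _ → tot g) (λ _ → tot b))
      (cong (tot g +_) (trans (sum-const (allFin r) (tot b)) (cong (_* tot b) (length-allFin r)))))

  -- Once g and b agree on the i-th copy, the two extra terms cancel and the remaining sum is free
  -- of i.
  unmasked-eq : ∀ i S → unmasked i S + val b (parts i S) ≡
    val g (parts i S) + sumOf (allFin r) (λ j → val b (parts j S))
  unmasked-eq i S = trans (cong (_+ val b (parts i S)) (sum-cong (allFin r) (λ j →
      if-push (λ W → val W (parts j S)) (i == j))))
    (sum-replace i (λ j → val g (parts j S)) (λ j → val b (parts j S)))

  bad : List (Label X r t) → Bool
  bad S = any (λ c → not (hit c S)) (allFin t) ∧ any (λ j → suc ℓ <ᵇ length (parts j S)) (allFin r)

  -- A sample is bad only if it misses a colour and crowds a copy. Either half bounds the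
  -- probability; large samples use this one, small samples the next.
  bad≤unhit : ∀ S → ⟦ bad S ⟧ ≤ sumOf (allFin t) (λ c → ⟦ not (hit c S) ⟧)
  bad≤unhit S = ≤-trans (⟦∧⟧≤ˡ (any (λ c → not (hit c S)) (allFin t)) _) (any≤sum _ (allFin t))

  bad≤crowded : ∀ S → ⟦ bad S ⟧ ≤ sumOf (allFin r) (λ j → ⟦ suc ℓ <ᵇ length (parts j S) ⟧)
  bad≤crowded S = ≤-trans (⟦∧⟧≤ʳ (any (λ c → not (hit c S)) (allFin t)) _) (any≤sum _ (allFin r))

  not-bad : ∀ S → bad S ≡ false → (∀ c → hit c S ≡ true) ⊎ (∀ j → length (parts j S) ≤ suc ℓ)
  not-bad S e with any (λ c → not (hit c S)) (allFin t) in eq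
  ... | false = inj₁ λ c → flip (any-false (λ c → not (hit c S)) eq (∈-allFin c))
    where
    flip : ∀ {a} → not a ≡ false → a ≡ true
    flip {true} _ = refl
  ... | true  = inj₂ λ j → ≮⇒≥ λ lt → lem (<⇒<ᵇ lt)
      (any-false (λ j → suc ℓ <ᵇ length (parts j S)) e (∈-allFin j))
    where
    lem : ∀ {a} {Z : Set} → Bool.T a → a ≡ false → Z
    lem {true} _ ()

  indistinguishable : ∀ S → bad S ≡ false → ∀ i i′ → val (hard i) S ≡ val (hard i′) S
  indistinguishable S e i i′ with not-bad S e
  ... | inj₁ allHit = trans (masked i) (trans (cong (λ z → sumOf (allFin t) (λ _ → z))
          (+-cancelʳ-≡ (tot b) (totalWeight i) (totalWeight i′) (trans (totalWeight-eq i) (sym (totalWeight-eq i′))))) (sym (masked i′)))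
    where
    masked : ∀ i → val (hard i) S ≡ sumOf (allFin t) (λ _ → totalWeight i)
    masked i = trans (val-hard i S) (sum-cong (allFin t) (λ c →
      cong (λ h → if h then totalWeight i else unmasked i S) (allHit c)))
  ... | inj₂ sparse = trans (val-hard i S) (trans (sum-cong (allFin t) step) (sym (val-hard i′ S)))
    where
    unmasked≡ : ∀ i → unmasked i S ≡ sumOf (allFin r) (λ j → val b (parts j S))
    unmasked≡ i = +-cancelʳ-≡ (val b (parts i S)) _ _ (trans (unmasked-eq i S)
      (trans (cong (_+ _) (agree (parts i S) (sparse i))) (+-comm (val b (parts i S)) _)))
    step : ∀ c → (if hit c S then totalWeight i else unmasked i S) ≡ (if hit c S then totalWeight i′ else unmasked i′ S)
    step c = cong₂ (λ x y → if hit c S then x else y)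
      (+-cancelʳ-≡ (tot b) (totalWeight i) (totalWeight i′) (trans (totalWeight-eq i) (sym (totalWeight-eq i′))))
      (trans (unmasked≡ i) (sym (unmasked≡ i′)))

  private
    choose-refl : ∀ i → choose i i ≡ g
    choose-refl i = cong (λ c → if c then g else b) (==-refl i)

  -- Each of the t copies of the universe counts at least what g gives on copy i, masked or not, and
  -- g contains every covered point with weight L.
  hard-large : ∀ i (xs rest : List X) → zs ≡ xs ++ rest → ∀ S → (∀ {x} → x ∈ xs → part i x ∈ S) →
    t * (length xs * L) ≤ val (hard i) S
  hard-large i xs rest refl S cov = begin
    t * (length xs * L)
      ≡⟨ trans (cong (_* (length xs * L)) (sym (length-allFin t))) (sym (sum-const (allFin t) _)) ⟩
    sumOf (allFin t) (λ _ → length xs * L)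
      ≤⟨ sum-mono (allFin t) each ⟩
    sumOf (allFin t) (λ c → if hit c S then totalWeight i else unmasked i S)
      ≡⟨ val-hard i S ⟨
    val (hard i) S ∎
    where
    open ≤-Reasoning
    P = parts i S
    k≤g : length xs * L ≤ val g P
    k≤g = begin
      length xs * L                                     ≡⟨ sum-const xs L ⟨
      sumOf xs (λ _ → L)                                ≤⟨ sum-mono-∈ xs (λ {x} x∈ → ≤-reflexive (sym
                                                             (trans (cong (λ c → L * ⟦ c ⟧) (any-true (eq x) (parts-∈ i x S (cov x∈)) (eq-refl x))) (*-identityʳ L)))) ⟩
      sumOf xs (λ z → L * ⟦ any (eq z) P ⟧)             ≤⟨ m≤m+n _ _ ⟩
      _                                                 ≡⟨ sum-++ xs rest _ ⟨
      sumOf (xs ++ rest) (λ z → L * ⟦ any (eq z) P ⟧)   ≤⟨ points P ⟩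
      val g P                                           ∎
    each : ∀ c → length xs * L ≤ (if hit c S then totalWeight i else unmasked i S)
    each c with hit c S
    ... | true  = ≤-trans k≤g (≤-trans (val≤tot g P)
      (subst (λ W → tot W ≤ totalWeight i) (choose-refl i) (sum-∈ (λ j → tot (choose i j)) (∈-allFin i))))
    ... | false = ≤-trans k≤g (subst (λ W → val W P ≤ unmasked i S) (choose-refl i)
      (sum-∈ (λ j → val (choose i j) (parts j S)) (∈-allFin i)))

  -- At most |S| colours are hit, and each yields at most a total weight τ + rβ for every i. In the
  -- remaining copies of the universe g is subadditive and agrees with b on single points, so it
  -- earns at most β per element of copy i; the r copies share the |S| elements. The b-values
  -- contribute at most rβ for each i.
  sum-hard≤ : ∀ S → sumOf (allFin r) (λ i → val (hard i) S) ≤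
    r * (length S * (τ + r * β)) + t * (length S * β + r * (r * β))
  sum-hard≤ S = begin
    sumOf (allFin r) (λ i → val (hard i) S)
      ≤⟨ sum-mono (allFin r) val≤ ⟩
    sumOf (allFin r) (λ i → length S * (τ + r * β) + t * (length (parts i S) * β + r * β))
      ≡⟨ sum-+ (allFin r) _ _ ⟩
    sumOf (allFin r) (λ i → length S * (τ + r * β)) + sumOf (allFin r) (λ i → t * (length (parts i S) * β + r * β))
      ≡⟨ cong₂ _+_ (over-r _) (trans (sum-* (allFin r) t _) (cong (t *_)
           (trans (sum-+ (allFin r) _ _) (cong₂ _+_ (trans (sum-cong (allFin r) (λ i → *-comm _ β)) (sum-* (allFin r) β _)) (over-r _))))) ⟩
    r * (length S * (τ + r * β)) + t * (β * sumOf (allFin r) (λ i → length (parts i S)) + r * (r * β))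
      ≤⟨ +-monoʳ-≤ (r * (length S * (τ + r * β))) (*-monoʳ-≤ t (+-monoˡ-≤ (r * (r * β))
           (≤-trans (*-monoʳ-≤ β (sum-length-parts S)) (≤-reflexive (*-comm β (length S)))))) ⟩
    r * (length S * (τ + r * β)) + t * (length S * β + r * (r * β)) ∎
    where
    open ≤-Reasoning
    over-r : ∀ c → sumOf (allFin r) (λ _ → c) ≡ r * c
    over-r c = trans (sum-const (allFin r) c) (cong (_* c) (length-allFin r))
    totalWeight≤ : ∀ i → totalWeight i ≤ τ + r * β
    totalWeight≤ i = ≤-trans (m≤m+n (totalWeight i) (tot b)) (≤-trans (≤-reflexive (totalWeight-eq i))
      (+-mono-≤ tot-g (*-monoʳ-≤ r tot-b)))
    unmasked≤ : ∀ i → unmasked i S ≤ length (parts i S) * β + r * β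
    unmasked≤ i = begin
      unmasked i S  ≤⟨ m≤m+n _ (val b (parts i S)) ⟩
      _             ≡⟨ unmasked-eq i S ⟩
      val g (parts i S) + sumOf (allFin r) (λ j → val b (parts j S))
        ≤⟨ +-mono-≤ (val≤length g β (λ x → ≤-trans (≤-reflexive (agree (x ∷ []) (s≤s z≤n))) (≤-trans (val≤tot b (x ∷ [])) tot-b)) (parts i S))
             (sum-mono (allFin r) (λ j → ≤-trans (val≤tot b (parts j S)) tot-b)) ⟩
      length (parts i S) * β + sumOf (allFin r) (λ _ → β)
        ≡⟨ cong (length (parts i S) * β +_) (over-r β) ⟩
      length (parts i S) * β + r * β ∎
    val≤ : ∀ i → val (hard i) S ≤ length S * (τ + r * β) + t * (length (parts i S) * β + r * β)
    val≤ i = begin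
      val (hard i) S   ≡⟨ val-hard i S ⟩
      sumOf (allFin t) (λ c → if hit c S then totalWeight i else unmasked i S)
        ≤⟨ sum-mono (allFin t) split ⟩
      sumOf (allFin t) (λ c → totalWeight i * ⟦ hit c S ⟧ + unmasked i S)
        ≡⟨ sum-+ (allFin t) _ _ ⟩
      sumOf (allFin t) (λ c → totalWeight i * ⟦ hit c S ⟧) + sumOf (allFin t) (λ _ → unmasked i S)
        ≡⟨ cong₂ _+_ (sum-* (allFin t) (totalWeight i) _)
             (trans (sum-const (allFin t) _) (cong (_* unmasked i S) (length-allFin t))) ⟩
      totalWeight i * sumOf (allFin t) (λ c → ⟦ hit c S ⟧) + t * unmasked i S
        ≤⟨ +-mono-≤ (≤-trans (*-mono-≤ (totalWeight≤ i) (sum-hit S)) (≤-reflexive (*-comm (τ + r * β) (length S))))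
             (*-monoʳ-≤ t (unmasked≤ i)) ⟩
      length S * (τ + r * β) + t * (length (parts i S) * β + r * β) ∎
      where
      split : ∀ c → (if hit c S then totalWeight i else unmasked i S) ≤ totalWeight i * ⟦ hit c S ⟧ + unmasked i S
      split c with hit c S
      ... | true  = ≤-trans (≤-reflexive (sym (*-identityʳ (totalWeight i)))) (m≤m+n _ _)
      ... | false = m≤n+m _ (totalWeight i * 0)

  length-hard : ∀ i → length (hard i) ≤ t * (r * s)
  length-hard i = begin
    length (hard i) ≡⟨ trans (length-concatMap _ (allFin t)) (sum-cong (allFin t) (λ c →
                        trans (length-concatMap _ (allFin r)) (sum-cong (allFin r) (λ j → length-map _ (choose i j))))) ⟩
    sumOf (allFin t) (λ _ → sumOf (allFin r) (λ j → length (choose i j)))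
      ≤⟨ sum-mono (allFin t) (λ _ → sum-mono (allFin r) size) ⟩
    sumOf (allFin t) (λ _ → sumOf (allFin r) (λ j → s))
      ≡⟨ trans (sum-const (allFin t) _) (cong₂ _*_ (length-allFin t)
           (trans (sum-const (allFin r) s) (cong (_* s) (length-allFin r)))) ⟩
    t * (r * s) ∎
    where
    open ≤-Reasoning
    size : ∀ j → length (choose i j) ≤ s
    size j with i == j
    ... | true  = size-g
    ... | false = size-b

-- Random labellings

image : ∀ {n} → Vec A n → Subset n → List A
image []      []            = []
image (l ∷ φ) (inside ∷ S)  = l ∷ image φ S
image (l ∷ φ) (outside ∷ S) = image φ S

length-image : ∀ {n} (φ : Vec A n) S → length (image φ S) ≡ ∣ S ∣
length-image []      []            = refl
length-image (l ∷ φ) (inside ∷ S)  = cong suc (length-image φ S)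
length-image (l ∷ φ) (outside ∷ S) = length-image φ S

∈-image : ∀ {n} (φ : Vec A n) S e → lookup S e ≡ inside → lookup φ e ∈ image φ S
∈-image (l ∷ φ) (inside ∷ S)  zero    h = here refl
∈-image (l ∷ φ) (inside ∷ S)  (suc e) h = there (∈-image φ S e h)
∈-image (l ∷ φ) (outside ∷ S) (suc e) h = ∈-image φ S e h

image-witness : ∀ {n} (φ : Vec A n) S {l} → l ∈ image φ S → ∃[ e ] (lookup S e ≡ inside × lookup φ e ≡ l)
image-witness []      []            ()
image-witness (l ∷ φ) (inside ∷ S)  (here refl) = zero , refl , refl
image-witness (l ∷ φ) (inside ∷ S)  (there h) = let (e , p , q) = image-witness φ S h in suc e , p , q
image-witness (l ∷ φ) (outside ∷ S) h = let (e , p , q) = image-witness φ S h in suc e , p , q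

∣insert∣≤ : ∀ {n} (S : Subset n) e → ∣ S [ e ]≔ inside ∣ ≤ suc ∣ S ∣
∣insert∣≤ (inside ∷ S)  zero    = n≤1+n _
∣insert∣≤ (outside ∷ S) zero    = ≤-refl
∣insert∣≤ (inside ∷ S)  (suc e) = s≤s (∣insert∣≤ S e)
∣insert∣≤ (outside ∷ S) (suc e) = ∣insert∣≤ S e

insert-here : ∀ {n} (S : Subset n) e → lookup (S [ e ]≔ inside) e ≡ inside
insert-here (x ∷ S) zero    = refl
insert-here (x ∷ S) (suc e) = insert-here S e

insert-mono : ∀ {n} (S : Subset n) e e′ → lookup S e′ ≡ inside → lookup (S [ e ]≔ inside) e′ ≡ inside
insert-mono (x ∷ S) zero    zero     h = refl
insert-mono (x ∷ S) zero    (suc e′) h = h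
insert-mono (x ∷ S) (suc e) zero     h = h
insert-mono (x ∷ S) (suc e) (suc e′) h = insert-mono S e e′ h

preimage : ∀ {n} (φ : Vec A n) (ls : List A) → (∀ {l} → l ∈ ls → ∃[ e ] lookup φ e ≡ l) →
  ∃[ S ] (∣ S ∣ ≤ length ls × (∀ {l} → l ∈ ls → l ∈ image φ S))
preimage {n = n} φ [] h = Subset.⊥ , ≤-reflexive (∣⊥∣≡0 n) , λ ()
preimage φ (l ∷ ls) h =
  let (S , ∣S∣≤ , cov) = preimage φ ls (h ∘ there)
      (e , φe≡l)       = h (here refl)
      S′               = S [ e ]≔ inside
      cov′ : ∀ {l′} → l′ ∈ l ∷ ls → l′ ∈ image φ S′
      cov′ = λ where
        (here refl) → subst (_∈ image φ S′) φe≡l (∈-image φ S′ e (insert-here S e))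
        (there l∈)  → let (e′ , S∋e′ , φe′≡) = image-witness φ S (cov l∈) in
          subst (_∈ image φ S′) φe′≡ (∈-image φ S′ e′ (insert-mono S e e′ S∋e′))
  in S′ , ≤-trans (∣insert∣≤ S e) (s≤s ∣S∣≤) , cov′

-- Tail estimates with cleared denominators

bernoulli : ∀ N h m → N ^ m * (N + m * h) ≤ N * (N + h) ^ m
bernoulli N h zero    = ≤-reflexive (lem N)
  where
  lem : ∀ N → 1 * (N + 0) ≡ N * 1
  lem = solve-∀
bernoulli N h (suc m) = begin
  N * N ^ m * (N + (h + m * h))                   ≤⟨ m≤m+n _ (N ^ m * (m * h * h)) ⟩
  N * N ^ m * (N + (h + m * h)) + N ^ m * (m * h * h)
                                                  ≡⟨ lem₁ N (N ^ m) h (m * h) ⟩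
  (N + h) * (N ^ m * (N + m * h))                 ≤⟨ *-monoʳ-≤ (N + h) (bernoulli N h m) ⟩
  (N + h) * (N * (N + h) ^ m)                     ≡⟨ lem₂ (N + h) N ((N + h) ^ m) ⟩
  N * (N + h) ^ suc m                             ∎
  where
  open ≤-Reasoning
  lem₁ : ∀ N P h x → N * P * (N + (h + x)) + P * (x * h) ≡ (N + h) * (P * (N + x))
  lem₁ = solve-∀
  lem₂ : ∀ M N P → M * (N * P) ≡ N * (M * P)
  lem₂ = solve-∀

-- With h favourable and N unfavourable outcomes, N + h ≤ mh says that a draw succeeds with
-- probability at least 1/m; by Bernoulli, m independent draws all fail with probability at most one
-- half.
2*^≤^ : ∀ N h m → N + h ≤ m * h → 0 < m → 2 * N ^ m ≤ (N + h) ^ m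
2*^≤^ zero h (suc m) _ _ = z≤n
2*^≤^ N@(suc _) h m le _ = *-cancelˡ-≤ N (begin
  N * (2 * N ^ m)      ≡⟨ lem N (N ^ m) ⟩
  N ^ m * (N + N)      ≤⟨ *-monoʳ-≤ (N ^ m) (+-monoʳ-≤ N (≤-trans (m≤m+n N h) le)) ⟩
  N ^ m * (N + m * h)  ≤⟨ bernoulli N h m ⟩
  N * (N + h) ^ m      ∎)
  where
  open ≤-Reasoning
  lem : ∀ N P → N * (2 * P) ≡ P * (N + N)
  lem = solve-∀

^-distribʳ-* : ∀ a b m → (a * b) ^ m ≡ a ^ m * b ^ m
^-distribʳ-* a b zero    = refl
^-distribʳ-* a b (suc m) rewrite ^-distribʳ-* a b m = lem a b (a ^ m) (b ^ m)
  where
  lem : ∀ a b x y → a * b * (x * y) ≡ a * x * (b * y)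
  lem = solve-∀

⟦∨⟧+not : ∀ b → ⟦ b ⟧ + ⟦ not b ⟧ ≡ 1
⟦∨⟧+not true  = refl
⟦∨⟧+not false = refl

module Counting (Λ : List A) where

  λ# : ℕ
  λ# = length Λ

  private
    N : (A → Bool) → ℕ
    N P = sumOf Λ (λ l → ⟦ not (P l) ⟧)

    shuffle : ∀ a b c d → a * b * (c * d) ≡ c * a * (b * d)
    shuffle = solve-∀

    swapˡ : ∀ a b c → a * (b * c) ≡ b * (a * c)
    swapˡ = solve-∀

  count : (A → Bool) → ℕ
  count P = sumOf Λ (λ l → ⟦ P l ⟧)

  sum-Ω-const : ∀ n → sumOf (vectors Λ n) (λ _ → 1) ≡ λ# ^ n
  sum-Ω-const n = trans (sym (length≡sum (vectors Λ n))) (length-vectors Λ n)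

  -- The coordinates of a random labelling are independent: those in S must avoid P and the others
  -- are free. The factor `λ# ^ ∣ S ∣` stands in for a division.
  miss : ∀ (P : A → Bool) {n} (S : Subset n) →
    λ# ^ ∣ S ∣ * sumOf (vectors Λ n) (λ φ → ⟦ not (any P (image φ S)) ⟧) ≡ N P ^ ∣ S ∣ * λ# ^ n
  miss P [] = refl
  miss P {suc n} (inside ∷ S) = begin
    λ# * λ# ^ ∣ S ∣ * sumOf (vectors Λ (suc n)) (λ φ → ⟦ not (any P (image φ (inside ∷ S))) ⟧)
      ≡⟨ cong (λ# * λ# ^ ∣ S ∣ *_) (trans (sum-vectors Λ n _) (trans (sum-cong Λ step)
           (trans (sum-* Λ M _) (*-comm M (N P))))) ⟩
    λ# * λ# ^ ∣ S ∣ * (N P * M)       ≡⟨ shuffle λ# (λ# ^ ∣ S ∣) (N P) M ⟩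
    N P * λ# * (λ# ^ ∣ S ∣ * M)       ≡⟨ cong (N P * λ# *_) (miss P S) ⟩
    N P * λ# * (N P ^ ∣ S ∣ * λ# ^ n) ≡⟨ lem (N P) λ# (N P ^ ∣ S ∣) (λ# ^ n) ⟩
    N P * N P ^ ∣ S ∣ * (λ# * λ# ^ n) ∎
    where
    open ≡-Reasoning
    M = sumOf (vectors Λ n) (λ φ → ⟦ not (any P (image φ S)) ⟧)
    lem : ∀ a b c d → a * b * (c * d) ≡ a * c * (b * d)
    lem = solve-∀
    step : ∀ l → sumOf (vectors Λ n) (λ φ → ⟦ not (P l ∨ any P (image φ S)) ⟧) ≡ M * ⟦ not (P l) ⟧
    step l with P l
    ... | true  = trans (sum-const (vectors Λ n) 0) (trans (*-zeroʳ (length (vectors Λ n))) (sym (*-zeroʳ M)))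
    ... | false = sym (*-identityʳ M)
  miss P {suc n} (outside ∷ S) = begin
    λ# ^ ∣ S ∣ * sumOf (vectors Λ (suc n)) (λ φ → ⟦ not (any P (image φ (outside ∷ S))) ⟧)
      ≡⟨ cong (λ# ^ ∣ S ∣ *_) (trans (sum-vectors Λ n _) (sum-const Λ M)) ⟩
    λ# ^ ∣ S ∣ * (λ# * M)       ≡⟨ swapˡ (λ# ^ ∣ S ∣) λ# M ⟩
    λ# * (λ# ^ ∣ S ∣ * M)       ≡⟨ cong (λ# *_) (miss P S) ⟩
    λ# * (N P ^ ∣ S ∣ * λ# ^ n) ≡⟨ swapˡ λ# (N P ^ ∣ S ∣) (λ# ^ n) ⟩
    N P ^ ∣ S ∣ * (λ# * λ# ^ n) ∎
    where
    open ≡-Reasoning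
    M = sumOf (vectors Λ n) (λ φ → ⟦ not (any P (image φ S)) ⟧)

  -- Every block of m draws halves the probability of missing P, and S contains y disjoint blocks.
  -- The left-over draws are bounded trivially.
  miss-rare : ∀ (P : A → Bool) m y → 0 < λ# → 0 < m → λ# ≤ m * count P →
    ∀ {n} (S : Subset n) → m * y ≤ ∣ S ∣ →
    2 ^ y * sumOf (vectors Λ n) (λ φ → ⟦ not (any P (image φ S)) ⟧) ≤ λ# ^ n
  miss-rare P m y λ>0 m>0 h {n} S my≤ = *-cancelˡ-≤ (λ# ^ s) {{m^n≢0 λ# s {{>-nonZero λ>0}}}} (begin
    λ# ^ s * (2 ^ y * M)       ≡⟨ swapˡ (λ# ^ s) (2 ^ y) M ⟩
    2 ^ y * (λ# ^ s * M)       ≡⟨ cong (2 ^ y *_) (miss P S) ⟩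
    2 ^ y * (N P ^ s * λ# ^ n) ≡⟨ *-assoc (2 ^ y) _ _ ⟨
    2 ^ y * N P ^ s * λ# ^ n   ≤⟨ *-monoˡ-≤ (λ# ^ n) 2^yN^s≤ ⟩
    λ# ^ s * λ# ^ n            ∎)
    where
    open ≤-Reasoning
    s = ∣ S ∣
    M = sumOf (vectors Λ n) (λ φ → ⟦ not (any P (image φ S)) ⟧)
    N+c : N P + count P ≡ λ#
    N+c = trans (+-comm (N P) (count P)) (trans (sym (sum-+ Λ _ _)) (trans (sum-cong Λ (λ l → ⟦∨⟧+not (P l))) (sym (length≡sum Λ))))
    twice : 2 * N P ^ m ≤ λ# ^ m
    twice = subst (λ z → 2 * N P ^ m ≤ z ^ m) N+c (2*^≤^ (N P) (count P) m (≤-trans (≤-reflexive N+c) h) m>0)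
    d = s ∸ m * y
    2^yN^s≤ : 2 ^ y * N P ^ s ≤ λ# ^ s
    2^yN^s≤ = begin
      2 ^ y * N P ^ s                   ≡⟨ cong (λ z → 2 ^ y * N P ^ z) (m+[n∸m]≡n my≤) ⟨
      2 ^ y * N P ^ (m * y + d)         ≡⟨ cong (2 ^ y *_) (^-distribˡ-+-* (N P) (m * y) d) ⟩
      2 ^ y * (N P ^ (m * y) * N P ^ d) ≡⟨ *-assoc (2 ^ y) _ _ ⟨
      2 ^ y * N P ^ (m * y) * N P ^ d   ≡⟨ cong (λ z → 2 ^ y * z * N P ^ d) (^-*-assoc (N P) m y) ⟨
      2 ^ y * (N P ^ m) ^ y * N P ^ d   ≡⟨ cong (_* N P ^ d) (^-distribʳ-* 2 (N P ^ m) y) ⟨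
      (2 * N P ^ m) ^ y * N P ^ d       ≤⟨ *-mono-≤ (^-monoˡ-≤ y twice) (^-monoˡ-≤ d (≤-trans (m≤m+n (N P) (count P)) (≤-reflexive N+c))) ⟩
      (λ# ^ m) ^ y * λ# ^ d             ≡⟨ cong (_* λ# ^ d) (^-*-assoc λ# m y) ⟩
      λ# ^ (m * y) * λ# ^ d             ≡⟨ ^-distribˡ-+-* λ# (m * y) d ⟨
      λ# ^ (m * y + d)                  ≡⟨ cong (λ# ^_) (m+[n∸m]≡n my≤) ⟩
      λ# ^ s                            ∎

  hits : (A → Bool) → List A → ℕ
  hits P S = sumOf S (λ l → ⟦ P l ⟧)

  private
    ≤ᵇ-suc : ∀ e c → (suc e ≤ᵇ suc c) ≡ (e ≤ᵇ c)
    ≤ᵇ-suc zero    c = refl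
    ≤ᵇ-suc (suc e) c = refl

  -- This is the bound (p |S|)^e for at least e hits of probability p. A new element either hits,
  -- leaving e hits to find, or does not; the induction closes because (hs)^e h + (hs)^(e+1) = h
  -- (s+1) (hs)^e ≤ (h (s+1))^(e+1).
  crowd : ∀ (P : A → Bool) e {n} (S : Subset n) →
    λ# ^ e * sumOf (vectors Λ n) (λ φ → ⟦ e ≤ᵇ hits P (image φ S) ⟧) ≤ (count P * ∣ S ∣) ^ e * λ# ^ n
  crowd P zero    {n} S = ≤-reflexive (cong (1 *_) (sum-Ω-const n))
  crowd P (suc e) []    = ≤-trans (≤-reflexive (*-zeroʳ (λ# ^ suc e))) z≤n
  crowd P (suc e) {suc n} (outside ∷ S) = begin
    λ# ^ suc e * sumOf (vectors Λ (suc n)) (λ φ → ⟦ suc e ≤ᵇ hits P (image φ (outside ∷ S)) ⟧)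
      ≡⟨ cong (λ# ^ suc e *_) (trans (sum-vectors Λ n _) (sum-const Λ M)) ⟩
    λ# ^ suc e * (λ# * M)      ≡⟨ swapˡ (λ# ^ suc e) λ# M ⟩
    λ# * (λ# ^ suc e * M)      ≤⟨ *-monoʳ-≤ λ# (crowd P (suc e) S) ⟩
    λ# * (c * λ# ^ n)          ≡⟨ swapˡ λ# c (λ# ^ n) ⟩
    c * (λ# * λ# ^ n)          ∎
    where
    open ≤-Reasoning
    M = sumOf (vectors Λ n) (λ φ → ⟦ suc e ≤ᵇ hits P (image φ S) ⟧)
    c = (count P * ∣ S ∣) ^ suc e
  crowd P (suc e) {suc n} (inside ∷ S) = begin
    λ# ^ suc e * sumOf (vectors Λ (suc n)) (λ φ → ⟦ suc e ≤ᵇ hits P (image φ (inside ∷ S)) ⟧)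
      ≡⟨ cong (λ# ^ suc e *_) (sum-vectors Λ n _) ⟩
    λ# ^ suc e * sumOf Λ (λ l → sumOf (vectors Λ n) (λ φ → ⟦ suc e ≤ᵇ ⟦ P l ⟧ + hits P (image φ S) ⟧))
      ≤⟨ *-monoʳ-≤ (λ# ^ suc e) (≤-trans (sum-mono Λ step) (≤-reflexive
           (trans (sum-+ Λ _ _) (cong₂ _+_ (trans (sum-* Λ M₀ _) (*-comm M₀ h)) (sum-const Λ M₁))))) ⟩
    λ# ^ suc e * (h * M₀ + λ# * M₁)
      ≡⟨ lem₁ λ# (λ# ^ e) h M₀ M₁ ⟩
    λ# * (h * (λ# ^ e * M₀) + λ# ^ suc e * M₁)
      ≤⟨ *-monoʳ-≤ λ# (+-mono-≤ (*-monoʳ-≤ h (crowd P e S)) (crowd P (suc e) S)) ⟩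
    λ# * (h * ((h * s) ^ e * λ# ^ n) + h * s * (h * s) ^ e * λ# ^ n)
      ≡⟨ lem₂ λ# (λ# ^ n) h s ((h * s) ^ e) ⟩
    h * suc s * (h * s) ^ e * λ# ^ suc n
      ≤⟨ *-monoˡ-≤ (λ# ^ suc n) (*-monoʳ-≤ (h * suc s) (^-monoˡ-≤ e (*-monoʳ-≤ h (n≤1+n s)))) ⟩
    (h * suc s) ^ suc e * λ# ^ suc n ∎
    where
    open ≤-Reasoning
    h = count P
    s = ∣ S ∣
    M₀ = sumOf (vectors Λ n) (λ φ → ⟦ e ≤ᵇ hits P (image φ S) ⟧)
    M₁ = sumOf (vectors Λ n) (λ φ → ⟦ suc e ≤ᵇ hits P (image φ S) ⟧)
    lem₁ : ∀ L E h a b → L * E * (h * a + L * b) ≡ L * (h * (E * a) + L * E * b)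
    lem₁ = solve-∀
    lem₂ : ∀ L Q h s E → L * (h * (E * Q) + h * s * E * Q) ≡ h * (1 + s) * E * (L * Q)
    lem₂ = solve-∀
    step : ∀ l → sumOf (vectors Λ n) (λ φ → ⟦ suc e ≤ᵇ ⟦ P l ⟧ + hits P (image φ S) ⟧) ≤ M₀ * ⟦ P l ⟧ + M₁
    step l with P l
    ... | true  = ≤-trans (≤-reflexive (trans (sum-cong (vectors Λ n) (λ φ → cong ⟦_⟧ (≤ᵇ-suc e (hits P (image φ S)))))
                    (sym (*-identityʳ M₀)))) (m≤m+n _ M₁)
    ... | false = m≤n+m M₁ (M₀ * 0)

==-sym : ∀ {n} (i j : Fin n) → (i == j) ≡ (j == i)
==-sym i j = bool-ext (λ e → subst (λ z → (z == i) ≡ true) (==⇒≡ i j e) (==-refl i))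
                      (λ e → subst (λ z → (z == j) ≡ true) (==⇒≡ j i e) (==-refl j))

hits-parts : ∀ {r t} (j : Fin r) (S : List (Label X r t)) →
  length (parts j S) ≡ sumOf S (λ l → ⟦ inPart j l ⟧)
hits-parts j []      = refl
hits-parts j (s ∷ S) = trans (length-parts-∷ j s S) (cong (_ +_) (hits-parts j S))

module Random (r w : ℕ) {eq : X → X → Bool} (eq-refl : ∀ x → eq x x ≡ true)
              (eq-sound : ∀ x y → eq x y ≡ true → x ≡ y)
              (xs rest : List X) {ℓ L τ β s : ℕ}
              (G : Gadget eq (xs ++ rest) (suc ℓ) L τ β s) where

  k t : ℕ
  k = length xs
  t = r * k

  open Hard r t eq-refl G public

  -- Each colour occurs w times, so a random label lies in a given part with probability
  -- 1 / (r (w + 1)).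
  Λ partLabels maskLabels : List (Label X r t)
  partLabels = concatMap (λ j → map (part j) xs) (allFin r)
  maskLabels = concatMap (λ _ → map mask (allFin t)) (allFin w)
  Λ = partLabels ++ maskLabels

  open Counting Λ

  sum-Λ : ∀ (f : Label X r t → ℕ) → sumOf Λ f ≡
    sumOf (allFin r) (λ j → sumOf xs (λ x → f (part j x))) + w * sumOf (allFin t) (λ c → f (mask c))
  sum-Λ f = trans (sum-++ partLabels maskLabels f) (cong₂ _+_
    (trans (sum-concatMap _ (allFin r) f) (sum-cong (allFin r) (λ j → sum-map (part j) xs f)))
    (trans (sum-concatMap _ (allFin w) f) (trans (sum-cong (allFin w) (λ _ → sum-map mask (allFin t) f))
      (trans (sum-const (allFin w) _) (cong (_* sumOf (allFin t) (f ∘ mask)) (length-allFin w))))))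

  λ≡ : λ# ≡ t * suc w
  λ≡ = trans (length≡sum Λ) (trans (sum-Λ (λ _ → 1)) (trans (cong₂ (λ a b → a + w * b)
      (trans (sum-cong (allFin r) (λ _ → sym (length≡sum xs)))
        (trans (sum-const (allFin r) k) (cong (_* k) (length-allFin r))))
      (trans (sym (length≡sum (allFin t))) (length-allFin t)))
    (lem t w)))
    where
    lem : ∀ t w → t + w * t ≡ t * suc w
    lem = solve-∀

  count-mask : ∀ c → count (isMask c) ≡ w
  count-mask c = trans (sum-Λ _) (trans (cong₂ (λ a b → a + w * b)
      (trans (sum-cong (allFin r) (λ _ → trans (sum-const xs 0) (*-zeroʳ k)))
        (sum-zero (allFin r)))
      (trans (sum-cong (allFin t) (λ c′ → cong ⟦_⟧ (==-sym c c′))) (sum-single c)))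
    (*-identityʳ w))

  count-part : ∀ j → count (inPart j) ≡ k
  count-part j = trans (sum-Λ _) (trans (cong₂ (λ a b → a + w * b)
      (trans (sum-cong (allFin r) (λ j′ → trans (sum-const xs ⟦ j == j′ ⟧)
        (cong (λ b → k * ⟦ b ⟧) (==-sym j j′))))
        (trans (sum-* (allFin r) k _) (trans (cong (k *_) (sum-single j)) (*-identityʳ k))))
      (sum-zero (allFin t)))
    (trans (cong (k +_) (*-zeroʳ w)) (+-identityʳ k)))

  isPart : Fin r → X → Label X r t → Bool
  isPart i x (part j y) = (i == j) ∧ eq x y
  isPart i x (mask _)   = false

  isPart-sound : ∀ i x l → isPart i x l ≡ true → l ≡ part i x
  isPart-sound i x (part j y) e with i == j in e₁
  ... | true = cong₂ part (sym (==⇒≡ i j e₁)) (sym (eq-sound x y e))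

  part-∈ : ∀ i {x} → x ∈ xs → part i x ∈ Λ
  part-∈ i x∈ = ∈-++⁺ˡ (∈-concatMap⁺ (λ j → map (part j) xs)
    (Any.map (λ { refl → ∈-map⁺ (part i) x∈ }) (∈-allFin i)))

  count-isPart : ∀ i {x} → x ∈ xs → 1 ≤ count (isPart i x)
  count-isPart i {x} x∈ = ≤-trans
    (≤-reflexive (sym (cong ⟦_⟧ (trans (cong (_∧ eq x x) (==-refl i)) (eq-refl x)))))
    (sum-∈ (λ l → ⟦ isPart i x l ⟧) (part-∈ i x∈))

  -- If some point of copy i labels no element at all, no choice of k elements need realise the
  -- intended optimum. These labellings are discarded as degenerate.
  unsurjective : ∀ {n} → Vec (Label X r t) n → Bool
  unsurjective φ = any (λ i → any (λ x → not (any (isPart i x) (image φ Subset.⊤))) xs) (allFin r)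

  surjective⇒ : ∀ {n} (φ : Vec (Label X r t) n) → unsurjective φ ≡ false → ∀ i →
    ∃[ S ] (∣ S ∣ ≤ k × (∀ {x} → x ∈ xs → part i x ∈ image φ S))
  surjective⇒ φ e i =
    let (S , ∣S∣≤ , cov) = preimage φ (map (part i) xs) hitAll
    in S , ≤-trans ∣S∣≤ (≤-reflexive (length-map (part i) xs)) , λ x∈ → cov (∈-map⁺ (part i) x∈)
    where
    not-false : ∀ {a} → not a ≡ false → a ≡ true
    not-false {true} _ = refl
    hitAll : ∀ {l} → l ∈ map (part i) xs → ∃[ e ] lookup φ e ≡ l
    hitAll l∈ =
      let (x , x∈ , l≡)    = ∈-map⁻ (part i) l∈
          e₁               = any-false (λ i → any (λ x → not (any (isPart i x) (image φ Subset.⊤))) xs) e (∈-allFin i)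
          e₂               = not-false (any-false (λ x → not (any (isPart i x) (image φ Subset.⊤))) e₁ x∈)
          (l′ , l′∈ , e₃)  = any-witness (isPart i x) (image φ Subset.⊤) e₂
          (e , _ , φe≡)    = image-witness φ Subset.⊤ l′∈
      in e , trans φe≡ (trans (isPart-sound i x l′ e₃) (sym l≡))

  -- 1/κ is the admissible error probability. `dense` is a union bound over the r copies: a sample
  -- of at most 2ty elements hits a given copy at most 2ky/w times on average. `exponential` is a
  -- union bound over t events of probability at most 2^(-y), which are the missed colours or, as t
  -- = rk, the missed points of the copies.
  module Rare (y κ e : ℕ) (e≡ : e ≡ suc (suc ℓ)) (r>0 : 0 < r) (k>0 : 0 < k) (w>0 : 0 < w)
              (dense : κ * (r * (2 * k * y) ^ e) ≤ w ^ e)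
              (exponential : κ * t ≤ 2 ^ y) where
    private
      t>0 : 0 < t
      t>0 = *-mono-≤ r>0 k>0
      λ>0 : 0 < λ#
      λ>0 = ≤-trans (*-mono-≤ t>0 (s≤s z≤n)) (≤-reflexive (sym λ≡))

      cancel : ∀ {Q M Z N} → 0 < Q → Q * M ≤ Z * N → κ * Z ≤ Q → κ * M ≤ N
      cancel {Q} {M} {Z} {N} Q>0 h′ h = *-cancelˡ-≤ Q {{>-nonZero Q>0}} (begin
        Q * (κ * M)  ≡⟨ lem Q κ M ⟩
        κ * (Q * M)  ≤⟨ *-monoʳ-≤ κ h′ ⟩
        κ * (Z * N)  ≡⟨ *-assoc κ Z N ⟨
        κ * Z * N    ≤⟨ *-monoˡ-≤ N h ⟩
        Q * N        ∎)
        where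
        open ≤-Reasoning
        lem : ∀ a b c → a * (b * c) ≡ b * (a * c)
        lem = solve-∀

    sum-rare : ∀ {Z : Set} (zs : List Z) n (f : Z → Vec (Label X r t) n → ℕ) B →
      (∀ z → z ∈ zs → B * sumOf (vectors Λ n) (f z) ≤ λ# ^ n) →
      B * sumOf (vectors Λ n) (λ φ → sumOf zs (λ z → f z φ)) ≤ length zs * λ# ^ n
    sum-rare zs n f B h = begin
      B * sumOf (vectors Λ n) (λ φ → sumOf zs (λ z → f z φ))
        ≡⟨ cong (B *_) (sum-swap (vectors Λ n) zs _) ⟩
      B * sumOf zs (λ z → sumOf (vectors Λ n) (f z))
        ≡⟨ sum-* zs B _ ⟨
      sumOf zs (λ z → B * sumOf (vectors Λ n) (f z))
        ≤⟨ sum-mono-∈ zs (λ {z} → h z) ⟩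
      sumOf zs (λ _ → λ# ^ n)
        ≡⟨ sum-const zs _ ⟩
      length zs * λ# ^ n ∎
      where open ≤-Reasoning

    bad-rare : ∀ {n} (S : Subset n) → κ * sumOf (vectors Λ n) (λ φ → ⟦ bad (image φ S) ⟧) ≤ λ# ^ n
    -- A colour has frequency w / (t (w + 1)) ≥ 1 / (2t), so 2ty elements are y blocks of 2t draws.
    bad-rare {n} S with ≤-total (2 * t * y) ∣ S ∣
    ... | inj₁ large = cancel (m^n>0 2 y) (begin
        2 ^ y * sumOf (vectors Λ n) (λ φ → ⟦ bad (image φ S) ⟧)
          ≤⟨ *-monoʳ-≤ (2 ^ y) (sum-mono (vectors Λ n) (λ φ → bad≤unhit (image φ S))) ⟩
        2 ^ y * sumOf (vectors Λ n) (λ φ → sumOf (allFin t) (λ c → ⟦ not (hit c (image φ S)) ⟧))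
          ≤⟨ sum-rare (allFin t) n _ (2 ^ y) (λ c _ → miss-rare (isMask c) (2 * t) y λ>0 (*-mono-≤ {1} {2} (s≤s z≤n) t>0) (λ≤ c) S large) ⟩
        length (allFin t) * λ# ^ n
          ≡⟨ cong (_* λ# ^ n) (length-allFin t) ⟩
        t * λ# ^ n ∎) exponential
      where
      open ≤-Reasoning
      λ≤ : ∀ c → λ# ≤ 2 * t * count (isMask c)
      λ≤ c = begin
        λ#                         ≡⟨ λ≡ ⟩
        t * suc w                  ≤⟨ *-monoʳ-≤ t (+-monoˡ-≤ w w>0) ⟩
        t * (w + w)                ≡⟨ lem t w ⟩
        2 * t * w                  ≡⟨ cong (2 * t *_) (count-mask c) ⟨
        2 * t * count (isMask c)   ∎
        where
        lem : ∀ t w → t * (w + w) ≡ 2 * t * w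
        lem = solve-∀
    ... | inj₂ small = cancel (m^n>0 w {{>-nonZero w>0}} e) (*-cancelˡ-≤ (t ^ e) {{m^n≢0 t e {{>-nonZero t>0}}}} (begin
        t ^ e * (w ^ e * M)                          ≡⟨ *-assoc (t ^ e) (w ^ e) M ⟨
        t ^ e * w ^ e * M                            ≡⟨ cong (_* M) (^-distribʳ-* t w e) ⟨
        (t * w) ^ e * M                              ≤⟨ *-monoˡ-≤ M (^-monoˡ-≤ e (≤-trans (*-monoʳ-≤ t (n≤1+n w)) (≤-reflexive (sym λ≡)))) ⟩
        λ# ^ e * M                                   ≤⟨ *-monoʳ-≤ (λ# ^ e) (sum-mono (vectors Λ n) (λ φ → ≤-trans (bad≤crowded (image φ S))
                                                          (≤-reflexive (sum-cong (allFin r) (λ j → cong₂ (λ z c → ⟦ z ≤ᵇ c ⟧) (sym e≡) (hits-parts j (image φ S))))))) ⟩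
        λ# ^ e * sumOf (vectors Λ n) (λ φ → sumOf (allFin r) (λ j → ⟦ e ≤ᵇ hits (inPart j) (image φ S) ⟧))
                                                     ≡⟨ cong (λ# ^ e *_) (sum-swap (vectors Λ n) (allFin r) _) ⟩
        λ# ^ e * sumOf (allFin r) (λ j → sumOf (vectors Λ n) (λ φ → ⟦ e ≤ᵇ hits (inPart j) (image φ S) ⟧))
                                                     ≡⟨ sum-* (allFin r) (λ# ^ e) _ ⟨
        sumOf (allFin r) (λ j → λ# ^ e * sumOf (vectors Λ n) (λ φ → ⟦ e ≤ᵇ hits (inPart j) (image φ S) ⟧))
                                                     ≤⟨ sum-mono (allFin r) each ⟩
        sumOf (allFin r) (λ j → t ^ e * ((2 * k * y) ^ e * λ# ^ n))
                                                     ≡⟨ trans (sum-const (allFin r) _) (cong (_* (t ^ e * ((2 * k * y) ^ e * λ# ^ n))) (length-allFin r)) ⟩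
        r * (t ^ e * ((2 * k * y) ^ e * λ# ^ n))     ≡⟨ lem r (t ^ e) ((2 * k * y) ^ e) (λ# ^ n) ⟩
        t ^ e * (r * (2 * k * y) ^ e * λ# ^ n)       ∎)) dense
      where
      open ≤-Reasoning
      M = sumOf (vectors Λ n) (λ φ → ⟦ bad (image φ S) ⟧)
      lem : ∀ r T K N → r * (T * (K * N)) ≡ T * (r * K * N)
      lem = solve-∀
      each : ∀ j → λ# ^ e * sumOf (vectors Λ n) (λ φ → ⟦ e ≤ᵇ hits (inPart j) (image φ S) ⟧) ≤
        t ^ e * ((2 * k * y) ^ e * λ# ^ n)
      each j = begin
        λ# ^ e * sumOf (vectors Λ n) (λ φ → ⟦ e ≤ᵇ hits (inPart j) (image φ S) ⟧)
                                               ≤⟨ crowd (inPart j) e S ⟩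
        (count (inPart j) * ∣ S ∣) ^ e * λ# ^ n  ≤⟨ *-monoˡ-≤ (λ# ^ n) (^-monoˡ-≤ e (*-mono-≤ (≤-reflexive (count-part j)) small)) ⟩
        (k * (2 * t * y)) ^ e * λ# ^ n         ≡⟨ cong (λ z → z ^ e * λ# ^ n) (lem₂ k t y) ⟩
        (t * (2 * k * y)) ^ e * λ# ^ n         ≡⟨ cong (_* λ# ^ n) (^-distribʳ-* t (2 * k * y) e) ⟩
        t ^ e * (2 * k * y) ^ e * λ# ^ n       ≡⟨ *-assoc (t ^ e) _ _ ⟩
        t ^ e * ((2 * k * y) ^ e * λ# ^ n)     ∎
        where
        lem₂ : ∀ k t y → k * (2 * t * y) ≡ t * (2 * k * y)
        lem₂ = solve-∀

    -- One particular label is only guaranteed frequency 1/`λ#`, so y blocks of `λ#` draws are used.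
    -- This is what makes n at least `λ# * y`.
    unsurjective-rare : ∀ {n} → λ# * y ≤ n →
      κ * sumOf (vectors Λ n) (λ φ → ⟦ unsurjective φ ⟧) ≤ λ# ^ n
    unsurjective-rare {n} λy≤n = cancel (m^n>0 2 y) (begin
      2 ^ y * sumOf (vectors Λ n) (λ φ → ⟦ unsurjective φ ⟧)
        ≤⟨ *-monoʳ-≤ (2 ^ y) (sum-mono (vectors Λ n) (λ φ → ≤-trans (any≤sum _ (allFin r))
             (sum-mono (allFin r) (λ i → any≤sum _ xs)))) ⟩
      2 ^ y * sumOf (vectors Λ n) (λ φ → sumOf (allFin r) (λ i → sumOf xs (λ x → missed i x φ)))
        ≡⟨ cong (2 ^ y *_) (sum-swap (vectors Λ n) (allFin r) _) ⟩
      2 ^ y * sumOf (allFin r) (λ i → sumOf (vectors Λ n) (λ φ → sumOf xs (λ x → missed i x φ)))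
        ≡⟨ sum-* (allFin r) (2 ^ y) _ ⟨
      sumOf (allFin r) (λ i → 2 ^ y * sumOf (vectors Λ n) (λ φ → sumOf xs (λ x → missed i x φ)))
        ≤⟨ sum-mono (allFin r) (λ i → sum-rare xs n (missed i) (2 ^ y) (λ x x∈ →
             miss-rare (isPart i x) λ# y λ>0 λ>0 (≤-trans (≤-reflexive (sym (*-identityʳ λ#))) (*-monoʳ-≤ λ# (count-isPart i x∈)))
               (Subset.⊤ {n}) (≤-trans λy≤n (≤-reflexive (sym (∣⊤∣≡n n)))))) ⟩
      sumOf (allFin r) (λ _ → k * λ# ^ n)
        ≡⟨ trans (sum-const (allFin r) _) (cong (_* (k * λ# ^ n)) (length-allFin r)) ⟩
      r * (k * λ# ^ n)
        ≡⟨ *-assoc r k _ ⟨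
      t * λ# ^ n ∎) exponential
      where
      open ≤-Reasoning
      missed : Fin r → X → Vec (Label X r t) n → ℕ
      missed i x φ = ⟦ not (any (isPart i x) (image φ Subset.⊤)) ⟧

-- Real numbers

open import Data.Integer.Base as ℤ using (+_; +[1+_])
import Data.Integer.Properties as ℤ
open import Data.Rational.Base as ℚ using (ℚ; 0ℚ; 1ℚ; ½; _/_)
import Data.Rational.Properties as ℚ
open import Data.Rational.Solver using (module +-*-Solver)
import Data.Rational.Unnormalised.Base as ℚᵘ
import Data.Rational.Unnormalised.Properties as ℚᵘ

open +-*-Solver using (solve; _:=_; _:+_; _:-_; _:*_; :-_; con)

private variable
  x y z u v : ℝ

-- Wrapping the relations in records lets Agda infer the reals they relate.
infix 4 _≼_ _≋_

record _≼_ (x y : ℝ) : Set where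
  constructor mk≼
  field un≼ : x ≤ᵣ y
open _≼_

-- Termwise equality of the representing sequences, finer than `_≈ᵣ_`. The ring identities needed
-- already hold termwise, so they are inherited from ℚ without any ε.
record _≋_ (x y : ℝ) : Set where
  constructor mk≋
  field un≋ : ∀ n → seq x n ≡ seq y n
open _≋_

ℚ-slack : ∀ {p q ε} → p ℚ.≤ q → 0ℚ ℚ.< ε → p ℚ.≤ q ℚ.+ ε
ℚ-slack {p} {q} {ε} p≤q 0<ε = ℚ.≤-trans p≤q
  (subst (ℚ._≤ q ℚ.+ ε) (ℚ.+-identityʳ q) (ℚ.+-monoʳ-≤ q (ℚ.<⇒≤ 0<ε)))

≋⇒≼ : x ≋ y → x ≼ y
≋⇒≼ (mk≋ e) = mk≼ λ ε 0<ε → 0 , λ n _ → ℚ-slack (ℚ.≤-reflexive (e n)) 0<ε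

≋-refl : x ≋ x
≋-refl = mk≋ λ _ → refl

≋-sym : x ≋ y → y ≋ x
≋-sym (mk≋ e) = mk≋ λ n → sym (e n)

≋-trans : x ≋ y → y ≋ z → x ≋ z
≋-trans (mk≋ e) (mk≋ f) = mk≋ λ n → trans (e n) (f n)

halve : ∀ ε → ½ ℚ.* ε ℚ.+ ½ ℚ.* ε ≡ ε
halve ε = trans (sym (ℚ.*-distribʳ-+ ε ½ ½)) (ℚ.*-identityˡ ε)

0<½* : ∀ {ε} → 0ℚ ℚ.< ε → 0ℚ ℚ.< ½ ℚ.* ε
0<½* 0<ε = ℚ.*-monoʳ-<-pos ½ 0<ε

≼-trans : x ≼ y → y ≼ z → x ≼ z
≼-trans {x} {y} {z} (mk≼ p) (mk≼ q) = mk≼ λ ε 0<ε →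
  let (M , h) = p (½ ℚ.* ε) (0<½* 0<ε)
      (N , k) = q (½ ℚ.* ε) (0<½* 0<ε)
  in M ℕ.⊔ N , λ n ≤n → ℚ.≤-trans (h n (ℕ.m⊔n≤o⇒m≤o M N ≤n))
       (ℚ.≤-trans (ℚ.+-monoˡ-≤ (½ ℚ.* ε) (k n (ℕ.m⊔n≤o⇒n≤o M N ≤n)))
         (ℚ.≤-reflexive (trans (ℚ.+-assoc (seq z n) _ _) (cong (seq z n ℚ.+_) (halve ε)))))

≼-preorder : Preorder _ _ _
≼-preorder = record
  { Carrier = ℝ ; _≈_ = _≋_ ; _≲_ = _≼_
  ; isPreorder = record
    { isEquivalence = record { refl = ≋-refl ; sym = ≋-sym ; trans = ≋-trans }
    ; reflexive = ≋⇒≼ ; trans = ≼-trans } }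

≼-refl : x ≼ x
≼-refl = ≋⇒≼ ≋-refl

≈⇒≼ : x ≈ᵣ y → x ≼ y
≈⇒≼ e = mk≼ (proj₁ e)

≈⇒≽ : x ≈ᵣ y → y ≼ x
≈⇒≽ e = mk≼ (proj₂ e)

+ᵣ-cong : x ≋ y → u ≋ v → x +ᵣ u ≋ y +ᵣ v
+ᵣ-cong (mk≋ e) (mk≋ f) = mk≋ λ n → cong₂ ℚ._+_ (e n) (f n)

*ᵣ-cong : x ≋ y → u ≋ v → x *ᵣ u ≋ y *ᵣ v
*ᵣ-cong (mk≋ e) (mk≋ f) = mk≋ λ n → cong₂ ℚ._*_ (e n) (f n)

+ᵣ-mono : x ≼ y → u ≼ v → x +ᵣ u ≼ y +ᵣ v
+ᵣ-mono {x} {y} {u} {v} (mk≼ p) (mk≼ q) = mk≼ λ ε 0<ε →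
  let (M , h) = p (½ ℚ.* ε) (0<½* 0<ε)
      (N , k) = q (½ ℚ.* ε) (0<½* 0<ε)
  in M ℕ.⊔ N , λ n ≤n → ℚ.≤-trans (ℚ.+-mono-≤ (h n (ℕ.m⊔n≤o⇒m≤o M N ≤n)) (k n (ℕ.m⊔n≤o⇒n≤o M N ≤n)))
       (ℚ.≤-reflexive (trans (solve 4 (λ a b c d → (a :+ b) :+ (c :+ d) := (a :+ c) :+ (b :+ d)) refl
          (seq y n) (½ ℚ.* ε) (seq v n) (½ ℚ.* ε)) (cong (seq y n ℚ.+ seq v n ℚ.+_) (halve ε))))

+ᵣ-assoc : ∀ x y z → (x +ᵣ y) +ᵣ z ≋ x +ᵣ (y +ᵣ z)
+ᵣ-assoc x y z = mk≋ λ n → ℚ.+-assoc (seq x n) _ _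

+ᵣ-comm : ∀ x y → x +ᵣ y ≋ y +ᵣ x
+ᵣ-comm x y = mk≋ λ n → ℚ.+-comm (seq x n) _

+ᵣ-identityʳ : ∀ x → x +ᵣ 0ᵣ ≋ x
+ᵣ-identityʳ x = mk≋ λ n → ℚ.+-identityʳ (seq x n)

+ᵣ-identityˡ : ∀ x → 0ᵣ +ᵣ x ≋ x
+ᵣ-identityˡ x = mk≋ λ n → ℚ.+-identityˡ (seq x n)

+ᵣ-inverseʳ : ∀ x → x +ᵣ (-ᵣ x) ≋ 0ᵣ
+ᵣ-inverseʳ x = mk≋ λ n → ℚ.+-inverseʳ (seq x n)

+ᵣ-interchange : ∀ x y z w → (x +ᵣ y) +ᵣ (z +ᵣ w) ≋ (x +ᵣ z) +ᵣ (y +ᵣ w)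
+ᵣ-interchange x y z w = mk≋ λ n →
  solve 4 (λ a b c d → (a :+ b) :+ (c :+ d) := (a :+ c) :+ (b :+ d)) refl (seq x n) (seq y n) (seq z n) (seq w n)

*ᵣ-assoc : ∀ x y z → (x *ᵣ y) *ᵣ z ≋ x *ᵣ (y *ᵣ z)
*ᵣ-assoc x y z = mk≋ λ n → ℚ.*-assoc (seq x n) _ _

*ᵣ-comm : ∀ x y → x *ᵣ y ≋ y *ᵣ x
*ᵣ-comm x y = mk≋ λ n → ℚ.*-comm (seq x n) _

*ᵣ-identityʳ : ∀ x → x *ᵣ 1ᵣ ≋ x
*ᵣ-identityʳ x = mk≋ λ n → ℚ.*-identityʳ (seq x n)

*ᵣ-identityˡ : ∀ x → 1ᵣ *ᵣ x ≋ x
*ᵣ-identityˡ x = mk≋ λ n → ℚ.*-identityˡ (seq x n)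

*ᵣ-zeroʳ : ∀ x → x *ᵣ 0ᵣ ≋ 0ᵣ
*ᵣ-zeroʳ x = mk≋ λ n → ℚ.*-zeroʳ (seq x n)

*ᵣ-zeroˡ : ∀ x → 0ᵣ *ᵣ x ≋ 0ᵣ
*ᵣ-zeroˡ x = mk≋ λ n → ℚ.*-zeroˡ (seq x n)

*ᵣ-distribˡ-+ : ∀ x y z → x *ᵣ (y +ᵣ z) ≋ x *ᵣ y +ᵣ x *ᵣ z
*ᵣ-distribˡ-+ x y z = mk≋ λ n → ℚ.*-distribˡ-+ (seq x n) _ _

*ᵣ-interchange : ∀ x y z w → (x *ᵣ y) *ᵣ (z *ᵣ w) ≋ (x *ᵣ z) *ᵣ (y *ᵣ w)
*ᵣ-interchange x y z w = mk≋ λ n →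
  solve 4 (λ a b c d → (a :* b) :* (c :* d) := (a :* c) :* (b :* d)) refl (seq x n) (seq y n) (seq z n) (seq w n)

*ᵣ-swapˡ : ∀ x y z → x *ᵣ (y *ᵣ z) ≋ y *ᵣ (x *ᵣ z)
*ᵣ-swapˡ x y z = mk≋ λ n →
  solve 3 (λ a b c → a :* (b :* c) := b :* (a :* c)) refl (seq x n) (seq y n) (seq z n)

p≤∣p∣ : ∀ p → p ℚ.≤ ℚ.∣ p ∣
p≤∣p∣ p with ℚ.≤-total 0ℚ p
... | inj₁ 0≤p = ℚ.≤-reflexive (sym (ℚ.0≤p⇒∣p∣≡p 0≤p))
... | inj₂ p≤0 = ℚ.≤-trans p≤0 (ℚ.0≤∣p∣ p)

eventually-bounded : ∀ x → ∃[ B ] ∃[ N ] (0ℚ ℚ.< B × (∀ n → N ℕ.≤ n → seq x n ℚ.≤ B))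
eventually-bounded x with cauchy x 1ℚ (ℚ.positive⁻¹ 1ℚ)
... | N , h = ℚ.∣ c ∣ ℚ.+ 1ℚ , N ,
    ℚ.<-≤-trans (ℚ.positive⁻¹ 1ℚ) (subst (ℚ._≤ ℚ.∣ c ∣ ℚ.+ 1ℚ) (ℚ.+-identityˡ 1ℚ) (ℚ.+-monoˡ-≤ 1ℚ (ℚ.0≤∣p∣ c))) ,
    λ n N≤n → begin
      seq x n                  ≡⟨ solve 2 (λ a c → a := c :+ (a :- c)) refl (seq x n) c ⟩
      c ℚ.+ (seq x n ℚ.- c)    ≤⟨ ℚ.+-mono-≤ (p≤∣p∣ c) (ℚ.≤-trans (p≤∣p∣ (seq x n ℚ.- c)) (h n N N≤n ℕ.≤-refl)) ⟩
      ℚ.∣ c ∣ ℚ.+ 1ℚ           ∎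
  where
  open ℚ.≤-Reasoning
  c = seq x N

divide : ∀ C ε → 0ℚ ℚ.< C → 0ℚ ℚ.< ε → ∃[ δ ] (0ℚ ℚ.< δ × C ℚ.* δ ≡ ε)
divide C ε C>0 ε>0 = r ℚ.* ε ,
  subst (ℚ._< r ℚ.* ε) (ℚ.*-zeroʳ r) (ℚ.*-monoʳ-<-pos r {{ℚ.1/pos⇒pos C}} ε>0) ,
  trans (sym (ℚ.*-assoc C r ε)) (trans (cong (ℚ._* ε) (ℚ.*-inverseʳ C)) (ℚ.*-identityˡ ε))
  where
  instance
    posC : ℚ.Positive C
    posC = ℚ.positive C>0
    nzC : ℚ.NonZero C
    nzC = ℚ.pos⇒nonZero C
  r = ℚ.1/ C

0≤*ℚ : ∀ {p q} → 0ℚ ℚ.≤ p → 0ℚ ℚ.≤ q → 0ℚ ℚ.≤ p ℚ.* q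
0≤*ℚ {p} {q} 0≤p 0≤q =
  ℚ.nonNegative⁻¹ (p ℚ.* q) {{ℚ.nonNeg*nonNeg⇒nonNeg p {{ℚ.nonNegative 0≤p}} q {{ℚ.nonNegative 0≤q}}}}

0≤-ℚ : ∀ {p q} → p ℚ.≤ q → 0ℚ ℚ.≤ q ℚ.- p
0≤-ℚ {p} {q} p≤q = subst (ℚ._≤ q ℚ.- p) (ℚ.+-inverseʳ p) (ℚ.+-monoˡ-≤ (ℚ.- p) p≤q)

0≤+ℚ : ∀ {p q} → 0ℚ ℚ.≤ p → 0ℚ ℚ.≤ q → 0ℚ ℚ.≤ p ℚ.+ q
0≤+ℚ {p} {q} 0≤p 0≤q = subst (ℚ._≤ p ℚ.+ q) (ℚ.+-identityˡ 0ℚ) (ℚ.+-mono-≤ 0≤p 0≤q)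

-- With a + δ ≥ 0, b + γ ≥ 0, a ≤ A and b ≤ B, the right-hand side of
-- ab + Bδ + (A + δ)γ = (a + δ)(b + γ) + δ(B − b) + γ(A − a) is nonnegative.
0≼* : 0ᵣ ≼ x → 0ᵣ ≼ y → 0ᵣ ≼ x *ᵣ y
0≼* {x} {y} (mk≼ p) (mk≼ q) = mk≼ λ ε 0<ε →
  let (A , M , A>0 , a≤)  = eventually-bounded x
      (B , N , B>0 , b≤)  = eventually-bounded y
      (δ , δ>0 , Bδ≡)     = divide B (½ ℚ.* ε) B>0 (0<½* 0<ε)
      A+δ>0               = subst (ℚ._< A ℚ.+ δ) (ℚ.+-identityˡ 0ℚ) (ℚ.+-mono-< A>0 δ>0)
      (γ , γ>0 , Aγ≡)     = divide (A ℚ.+ δ) (½ ℚ.* ε) A+δ>0 (0<½* 0<ε)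
      (P , h)             = p δ δ>0
      (Q , k)             = q γ γ>0
      K                   = (M ℕ.⊔ N) ℕ.⊔ (P ℕ.⊔ Q)
      inMN : ∀ {m} → K ℕ.≤ m → M ℕ.⊔ N ℕ.≤ m
      inMN                = ℕ.m⊔n≤o⇒m≤o (M ℕ.⊔ N) (P ℕ.⊔ Q)
      inPQ : ∀ {m} → K ℕ.≤ m → P ℕ.⊔ Q ℕ.≤ m
      inPQ                = ℕ.m⊔n≤o⇒n≤o (M ℕ.⊔ N) (P ℕ.⊔ Q)
  in K , λ n ≤n →
    let a = seq x n ; b = seq y n in
    subst (0ℚ ℚ.≤_)
      (trans (solve 6 (λ a b A B δ γ → (a :+ δ) :* (b :+ γ) :+ δ :* (B :- b) :+ γ :* (A :- a) :=
                 a :* b :+ (B :* δ :+ (A :+ δ) :* γ)) refl a b A B δ γ)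
             (cong (a ℚ.* b ℚ.+_) (trans (cong₂ ℚ._+_ Bδ≡ Aγ≡) (halve ε))))
      (0≤+ℚ (0≤+ℚ (0≤*ℚ (h n (ℕ.m⊔n≤o⇒m≤o P Q (inPQ ≤n))) (k n (ℕ.m⊔n≤o⇒n≤o P Q (inPQ ≤n))))
                  (0≤*ℚ (ℚ.<⇒≤ δ>0) (0≤-ℚ (b≤ n (ℕ.m⊔n≤o⇒n≤o M N (inMN ≤n))))))
            (0≤*ℚ (ℚ.<⇒≤ γ>0) (0≤-ℚ (a≤ n (ℕ.m⊔n≤o⇒m≤o M N (inMN ≤n))))))

*ᵣ-monoʳ : 0ᵣ ≼ z → x ≼ y → z *ᵣ x ≼ z *ᵣ y
*ᵣ-monoʳ {z} {x} {y} 0≼z x≼y = begin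
  z *ᵣ x                             ≈⟨ ≋-sym (+ᵣ-identityʳ (z *ᵣ x)) ⟩
  z *ᵣ x +ᵣ 0ᵣ                       ≲⟨ +ᵣ-mono ≼-refl (0≼* 0≼z 0≼y-x) ⟩
  z *ᵣ x +ᵣ z *ᵣ (y -ᵣ x)            ≈⟨ mk≋ (λ n → solve 3 (λ z x y → z :* x :+ z :* (y :- x) := z :* y) refl (seq z n) (seq x n) (seq y n)) ⟩
  z *ᵣ y                             ∎
  where
  open import Relation.Binary.Reasoning.Preorder ≼-preorder
  0≼y-x : 0ᵣ ≼ y -ᵣ x
  0≼y-x = ≼-trans (≋⇒≼ (≋-sym (+ᵣ-inverseʳ x))) (+ᵣ-mono x≼y ≼-refl)

*ᵣ-monoˡ : 0ᵣ ≼ z → x ≼ y → x *ᵣ z ≼ y *ᵣ z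
*ᵣ-monoˡ {z} {x} {y} 0≼z x≼y = ≼-trans (≋⇒≼ (*ᵣ-comm x z)) (≼-trans (*ᵣ-monoʳ 0≼z x≼y) (≋⇒≼ (*ᵣ-comm z y)))

*ᵣ-mono : 0ᵣ ≼ x → 0ᵣ ≼ v → x ≼ y → u ≼ v → x *ᵣ u ≼ y *ᵣ v
*ᵣ-mono 0≼x 0≼v x≼y u≼v = ≼-trans (*ᵣ-monoʳ 0≼x u≼v) (*ᵣ-monoˡ 0≼v x≼y)

fromℚ-mono : ∀ {p q} → p ℚ.≤ q → fromℚ p ≼ fromℚ q
fromℚ-mono p≤q = mk≼ λ ε 0<ε → 0 , λ _ _ → ℚ-slack p≤q 0<ε

private
  toℚᵘ-ℕ : ∀ n → ℚ.toℚᵘ (+ n ℚ./ 1) ℚᵘ.≃ ℚᵘ.mkℚᵘ (+ n) 0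
  toℚᵘ-ℕ n = ℚ.toℚᵘ-fromℚᵘ (ℚᵘ.mkℚᵘ (+ n) 0)

/1-mono : ∀ {a b} → a ℕ.≤ b → + a ℚ./ 1 ℚ.≤ + b ℚ./ 1
/1-mono {a} {b} a≤b = ℚ.toℚᵘ-cancel-≤ (ℚᵘ.≤-respˡ-≃ (ℚᵘ.≃-sym (toℚᵘ-ℕ a))
  (ℚᵘ.≤-respʳ-≃ (ℚᵘ.≃-sym (toℚᵘ-ℕ b)) (ℚᵘ.*≤* (ℤ.*-monoʳ-≤-nonNeg (+ 1) (ℤ.+≤+ a≤b)))))

/1-+ : ∀ a b → + (a ℕ.+ b) ℚ./ 1 ≡ + a ℚ./ 1 ℚ.+ + b ℚ./ 1
/1-+ a b = ℚ.toℚᵘ-injective (begin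
  ℚ.toℚᵘ (+ (a ℕ.+ b) ℚ./ 1)                      ≈⟨ toℚᵘ-ℕ (a ℕ.+ b) ⟩
  ℚᵘ.mkℚᵘ (+ (a ℕ.+ b)) 0                         ≈⟨ ℚᵘ.*≡* (cong (ℤ._* + 1) (cong₂ ℤ._+_ (sym (ℤ.*-identityʳ (+ a))) (sym (ℤ.*-identityʳ (+ b))))) ⟩
  ℚᵘ.mkℚᵘ (+ a) 0 ℚᵘ.+ ℚᵘ.mkℚᵘ (+ b) 0            ≈⟨ ℚᵘ.+-cong (ℚᵘ.≃-sym (toℚᵘ-ℕ a)) (ℚᵘ.≃-sym (toℚᵘ-ℕ b)) ⟩
  ℚ.toℚᵘ (+ a ℚ./ 1) ℚᵘ.+ ℚ.toℚᵘ (+ b ℚ./ 1)      ≈⟨ ℚᵘ.≃-sym (ℚ.toℚᵘ-homo-+ (+ a ℚ./ 1) (+ b ℚ./ 1)) ⟩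
  ℚ.toℚᵘ (+ a ℚ./ 1 ℚ.+ + b ℚ./ 1)                ∎)
  where open import Relation.Binary.Reasoning.Setoid ℚᵘ.≃-setoid

/1-* : ∀ a b → + (a ℕ.* b) ℚ./ 1 ≡ + a ℚ./ 1 ℚ.* (+ b ℚ./ 1)
/1-* a b = ℚ.toℚᵘ-injective (begin
  ℚ.toℚᵘ (+ (a ℕ.* b) ℚ./ 1)                      ≈⟨ toℚᵘ-ℕ (a ℕ.* b) ⟩
  ℚᵘ.mkℚᵘ (+ (a ℕ.* b)) 0                         ≈⟨ ℚᵘ.*≡* (cong (ℤ._* + 1) (ℤ.pos-* a b)) ⟩
  ℚᵘ.mkℚᵘ (+ a) 0 ℚᵘ.* ℚᵘ.mkℚᵘ (+ b) 0            ≈⟨ ℚᵘ.*-cong (ℚᵘ.≃-sym (toℚᵘ-ℕ a)) (ℚᵘ.≃-sym (toℚᵘ-ℕ b)) ⟩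
  ℚ.toℚᵘ (+ a ℚ./ 1) ℚᵘ.* ℚ.toℚᵘ (+ b ℚ./ 1)      ≈⟨ ℚᵘ.≃-sym (ℚ.toℚᵘ-homo-* (+ a ℚ./ 1) (+ b ℚ./ 1)) ⟩
  ℚ.toℚᵘ (+ a ℚ./ 1 ℚ.* (+ b ℚ./ 1))                ∎)
  where open import Relation.Binary.Reasoning.Setoid ℚᵘ.≃-setoid

fromℕ-+ : ∀ a b → fromℕ (a ℕ.+ b) ≋ fromℕ a +ᵣ fromℕ b
fromℕ-+ a b = mk≋ λ _ → /1-+ a b

fromℕ-* : ∀ a b → fromℕ (a ℕ.* b) ≋ fromℕ a *ᵣ fromℕ b
fromℕ-* a b = mk≋ λ _ → /1-* a b

fromℕ-mono : ∀ {a b} → a ℕ.≤ b → fromℕ a ≼ fromℕ b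
fromℕ-mono a≤b = fromℚ-mono (/1-mono a≤b)

0≼fromℕ : ∀ a → 0ᵣ ≼ fromℕ a
0≼fromℕ a = fromℕ-mono {0} {a} z≤n

fromℕ-cong : ∀ {a b} → a ≡ b → fromℕ a ≋ fromℕ b
fromℕ-cong refl = ≋-refl

fromℕ-cancel : ∀ {a b} → fromℕ a ≼ fromℕ b → a ℕ.≤ b
fromℕ-cancel {a} {b} (mk≼ p) with a ℕ.≤? b
... | yes a≤b = a≤b
-- Slack ½ already suffices: otherwise b + 1 ≤ a ≤ b + ½.
... | no  a≰b = contradiction
    (ℚ.≤-trans (subst (ℚ._≤ _) (/1-+ b 1) (/1-mono (subst (ℕ._≤ a) (ℕ.+-comm 1 b) (ℕ.≰⇒> a≰b))))
               (proj₂ (p ½ (ℚ.positive⁻¹ ½)) _ ℕ.≤-refl))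
    (λ le → ℚ.<-irrefl refl (ℚ.<-≤-trans {½} {1ℚ} (ℚ.*<* (ℤ.+<+ (s≤s (s≤s z≤n)))) (cancel le)))
  where
  c = + b ℚ./ 1
  cancel : c ℚ.+ + 1 ℚ./ 1 ℚ.≤ c ℚ.+ ½ → 1ℚ ℚ.≤ ½
  cancel le = subst₂ ℚ._≤_ (solve 2 (λ c e → :- c :+ (c :+ e) := e) refl c 1ℚ)
    (solve 2 (λ c e → :- c :+ (c :+ e) := e) refl c ½) (ℚ.+-monoʳ-≤ (ℚ.- c) le)

archimedean-ℚ : ∀ e → 0ℚ ℚ.< e → ∃[ N ] (0 ℕ.< N × 1ℚ ℚ.≤ + N ℚ./ 1 ℚ.* e)
archimedean-ℚ e@(ℚ.mkℚ (+ zero) d c) 0<e = contradiction (ℚ.<-≤-trans 0<e (ℚ.*≤* {e} {0ℚ} ℤ.≤-refl)) (ℚ.<-irrefl refl)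
archimedean-ℚ e@(ℚ.mkℚ ℤ.-[1+ _ ] d c) (ℚ.*<* ())
-- The denominator of e is large enough, since the numerator is at least 1.
archimedean-ℚ e@(ℚ.mkℚ +[1+ p ] d c) 0<e = suc d , s≤s z≤n ,
  ℚ.toℚᵘ-cancel-≤ (ℚᵘ.≤-respʳ-≃
    (ℚᵘ.≃-trans (ℚᵘ.*-congʳ (ℚᵘ.≃-sym (toℚᵘ-ℕ (suc d)))) (ℚᵘ.≃-sym (ℚ.toℚᵘ-homo-* (+ suc d ℚ./ 1) e)))
    (ℚᵘ.*≤* (ℤ.+≤+ (subst₂ ℕ._≤_ (lem₁ d) (sym (ℕ.*-identityʳ (suc d ℕ.* suc p))) (ℕ.*-monoʳ-≤ (suc d) (s≤s (z≤n {p})))))))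
  where
  lem₁ : ∀ d → suc d ℕ.* 1 ≡ 1 ℕ.* (1 ℕ.* suc d)
  lem₁ d = trans (ℕ.*-identityʳ (suc d)) (sym (trans (ℕ.*-identityˡ _) (ℕ.*-identityˡ _)))

archimedean : x <ᵣ y → ∃[ N ] (0 ℕ.< N × 1ᵣ ≼ fromℕ N *ᵣ (y -ᵣ x))
archimedean {x} {y} (e , 0<e , M , h) =
  let (N , N>0 , le) = archimedean-ℚ e 0<e
  in N , N>0 , ≼-trans (≼-trans (fromℚ-mono le) (≋⇒≼ {y = fromℕ N *ᵣ fromℚ e} (mk≋ λ _ → refl))) (*ᵣ-monoʳ (0≼fromℕ N)
      (mk≼ λ ε 0<ε → M , λ n M≤n → ℚ-slack (subst₂ ℚ._≤_
        (solve 2 (λ x e → x :+ e :- x := e) refl (seq x n) e) refl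
        (ℚ.+-monoˡ-≤ (ℚ.- seq x n) (h n M≤n))) 0<ε))

0≼^ : ∀ q → 0ᵣ ≼ x → 0ᵣ ≼ x ^ᵣ q
0≼^ zero    h = 0≼fromℕ 1
0≼^ (suc q) h = 0≼* h (0≼^ q h)

^ᵣ-mono : ∀ q → 0ᵣ ≼ x → x ≼ y → x ^ᵣ q ≼ y ^ᵣ q
^ᵣ-mono zero    0≼x x≼y = ≼-refl
^ᵣ-mono (suc q) 0≼x x≼y = *ᵣ-mono 0≼x (0≼^ q (≼-trans 0≼x x≼y)) x≼y (^ᵣ-mono q 0≼x x≼y)

fromℕ-^ : ∀ b q → fromℕ (b ℕ.^ q) ≋ fromℕ b ^ᵣ q
fromℕ-^ b zero    = ≋-refl
fromℕ-^ b (suc q) = ≋-trans (fromℕ-* b (b ℕ.^ q)) (*ᵣ-cong ≋-refl (fromℕ-^ b q))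

*ᵣ-^ : ∀ x y q → (x *ᵣ y) ^ᵣ q ≋ x ^ᵣ q *ᵣ y ^ᵣ q
*ᵣ-^ x y zero    = ≋-sym (*ᵣ-identityʳ 1ᵣ)
*ᵣ-^ x y (suc q) = ≋-trans (*ᵣ-cong ≋-refl (*ᵣ-^ x y q)) (*ᵣ-interchange x y (x ^ᵣ q) (y ^ᵣ q))

∑-cong : ∀ (xs : List A) {f g : A → ℝ} → (∀ a → f a ≋ g a) → ∑ xs f ≋ ∑ xs g
∑-cong []       e = ≋-refl
∑-cong (a ∷ xs) e = +ᵣ-cong (e a) (∑-cong xs e)

∑-mono : ∀ (xs : List A) {f g : A → ℝ} → (∀ a → f a ≼ g a) → ∑ xs f ≼ ∑ xs g
∑-mono []       h = ≼-refl
∑-mono (a ∷ xs) h = +ᵣ-mono (h a) (∑-mono xs h)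

∑-+ : ∀ (xs : List A) (f g : A → ℝ) → ∑ xs (λ a → f a +ᵣ g a) ≋ ∑ xs f +ᵣ ∑ xs g
∑-+ []       f g = ≋-sym (+ᵣ-identityʳ 0ᵣ)
∑-+ (a ∷ xs) f g = ≋-trans (+ᵣ-cong ≋-refl (∑-+ xs f g)) (+ᵣ-interchange (f a) (g a) (∑ xs f) (∑ xs g))

∑-*ˡ : ∀ (xs : List A) c (f : A → ℝ) → ∑ xs (λ a → c *ᵣ f a) ≋ c *ᵣ ∑ xs f
∑-*ˡ []       c f = ≋-sym (*ᵣ-zeroʳ c)
∑-*ˡ (a ∷ xs) c f = ≋-trans (+ᵣ-cong ≋-refl (∑-*ˡ xs c f)) (≋-sym (*ᵣ-distribˡ-+ c (f a) (∑ xs f)))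

∑-zero : ∀ (xs : List A) → ∑ xs (λ _ → 0ᵣ) ≋ 0ᵣ
∑-zero []       = ≋-refl
∑-zero (a ∷ xs) = ≋-trans (+ᵣ-cong ≋-refl (∑-zero xs)) (+ᵣ-identityʳ 0ᵣ)

∑-swap : ∀ (xs : List A) (ys : List B) (f : A → B → ℝ) →
  ∑ xs (λ a → ∑ ys (f a)) ≋ ∑ ys (λ b → ∑ xs (λ a → f a b))
∑-swap []       ys f = ≋-sym (∑-zero ys)
∑-swap (a ∷ xs) ys f = ≋-trans (+ᵣ-cong ≋-refl (∑-swap xs ys f)) (≋-sym (∑-+ ys (f a) _))

∑-fromℕ : ∀ (xs : List A) (f : A → ℕ) → ∑ xs (λ a → fromℕ (f a)) ≋ fromℕ (sumOf xs f)
∑-fromℕ []       f = ≋-refl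
∑-fromℕ (a ∷ xs) f = ≋-trans (+ᵣ-cong ≋-refl (∑-fromℕ xs f)) (≋-sym (fromℕ-+ (f a) _))

∑-const : ∀ (xs : List A) c → ∑ xs (λ _ → c) ≋ fromℕ (List.length xs) *ᵣ c
∑-const xs c = ≋-trans (∑-cong xs (λ _ → ≋-sym (*ᵣ-identityʳ c))) (≋-trans (∑-*ˡ xs c (λ _ → fromℕ 1))
  (≋-trans (*ᵣ-cong ≋-refl (≋-trans (∑-fromℕ xs (λ _ → 1)) (fromℕ-cong (sym (length≡sum xs))))) (*ᵣ-comm c _)))

-- Coverage functions and expectations

sum-filter : ∀ {P : X → Set} (P? : Decidable P) (xs : List X) (h : X → ℕ) →
  sumOf (filter P? xs) h ≡ sumOf xs (λ x → h x ℕ.* ⟦ does (P? x) ⟧)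
sum-filter P? []       h = refl
sum-filter P? (x ∷ xs) h with does (P? x)
... | true  = cong₂ ℕ._+_ (sym (ℕ.*-identityʳ (h x))) (sum-filter P? xs h)
... | false = trans (sum-filter P? xs h)
  (cong (ℕ._+ sumOf xs (λ x → h x ℕ.* ⟦ does (P? x) ⟧)) (sym (ℕ.*-zeroʳ (h x))))

sum-lookup : ∀ (xs : List X) (f : X → ℕ) → sumOf xs f ≡ sumOf (allFin (length xs)) (f ∘ List.lookup xs)
sum-lookup []       f = refl
sum-lookup (x ∷ xs) f = trans (cong (f x ℕ.+_) (sum-lookup xs f)) (sym (sum-allFin (length xs) (f ∘ List.lookup (x ∷ xs))))

∈⋃⁻ : ∀ {a} (ps : List (Subset n)) → a Subset.∈ ⋃ ps → ∃[ p ] (p ∈ ps × a Subset.∈ p)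
∈⋃⁻ []       h = contradiction h ∉⊥
∈⋃⁻ (p ∷ ps) h with x∈p∪q⁻ p (⋃ ps) h
... | inj₁ a∈p = p , here refl , a∈p
... | inj₂ a∈  = let (p′ , p′∈ , a∈p′) = ∈⋃⁻ ps a∈ in p′ , there p′∈ , a∈p′

∈⋃⁺ : ∀ {a p} (ps : List (Subset n)) → p ∈ ps → a Subset.∈ p → a Subset.∈ ⋃ ps
∈⋃⁺ (p ∷ ps) (here refl) h = x∈p∪q⁺ (inj₁ h)
∈⋃⁺ (p ∷ ps) (there p∈)  h = x∈p∪q⁺ (inj₂ (∈⋃⁺ ps p∈ h))

pullback : Family X → Vec X n → SetFunction n
pullback W φ S = fromℕ (val W (image φ S))

-- Transposing back: children are positions in W, and an element receives the children whose
-- predicate holds of its label.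
pullback-coverage : ∀ (W : Family X) (φ : Vec X n) → IsCoverageOver (length W) (pullback W φ)
pullback-coverage {n = n} W φ = weight , T , (λ a → _≼_.un≼ (0≼fromℕ (proj₁ (List.lookup W a)))) , λ S →
  let eq = ≋-sym (≋-trans (∑-fromℕ (toList (covered T S)) (proj₁ ∘ List.lookup W)) (fromℕ-cong (sym (value S))))
  in _≼_.un≼ (≋⇒≼ eq) , _≼_.un≼ (≋⇒≼ (≋-sym eq))
  where
  weight : Fin (length W) → ℝ
  weight a = fromℕ (proj₁ (List.lookup W a))
  set : Fin (length W) → _ → Bool
  set a = proj₂ (List.lookup W a)
  T : Fin n → Subset (length W)
  T e = Vec.tabulate (λ a → set a (lookup φ e))
  T∋⁻ : ∀ {a e} → a Subset.∈ T e → set a (lookup φ e) ≡ true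
  T∋⁻ {a} {e} h = trans (sym (lookup∘tabulate (λ a → set a (lookup φ e)) a)) ([]=⇒lookup h)
  T∋⁺ : ∀ {a e} → set a (lookup φ e) ≡ true → a Subset.∈ T e
  T∋⁺ {a} {e} h = lookup⇒[]= a (T e) (trans (lookup∘tabulate (λ a → set a (lookup φ e)) a) h)
  covered≡ : ∀ S a → does (a ∈? covered T S) ≡ any (set a) (image φ S)
  covered≡ S a = bool-ext to from
    where
    to : does (a ∈? covered T S) ≡ true → any (set a) (image φ S) ≡ true
    to h with a ∈? covered T S
    ... | yes a∈ with ∈⋃⁻ (map T (toList S)) a∈
    ...   | p , p∈ , a∈p with ∈-map⁻ T p∈
    ...     | e , e∈ , refl = any-true (set a)
              (∈-image φ S e ([]=⇒lookup (proj₂ (∈-filter⁻ (_∈? S) {xs = allFin n} e∈)))) (T∋⁻ a∈p)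
    from : any (set a) (image φ S) ≡ true → does (a ∈? covered T S) ≡ true
    from h with any-witness (set a) (image φ S) h
    ... | l , l∈ , ha with image-witness φ S l∈
    ...   | e , e∈S , refl = dec-true (a ∈? covered T S) (∈⋃⁺ (map T (toList S))
              (∈-map⁺ T (∈-filter⁺ (_∈? S) (∈-allFin e) (lookup⇒[]= e S e∈S))) (T∋⁺ ha))
  value : ∀ S → val W (image φ S) ≡ sumOf (toList (covered T S)) (proj₁ ∘ List.lookup W)
  value S = trans (sum-lookup W _) (trans
    (sum-cong (allFin (length W)) (λ a → cong (λ b → proj₁ (List.lookup W a) ℕ.* ⟦ b ⟧) (sym (covered≡ S a))))
    (sym (sum-filter (_∈? covered T S) (allFin (length W)) _)))

∈-subsets : ∀ {n} (S : Subset n) → S ∈ subsets n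
∈-subsets []            = here refl
∈-subsets {suc n} (outside ∷ S) = ∈-++⁺ˡ (∈-map⁺ (outside ∷_) (∈-subsets S))
∈-subsets {suc n} (inside ∷ S)  = ∈-++⁺ʳ (map (outside ∷_) (subsets n)) (∈-map⁺ (inside ∷_) (∈-subsets S))

max-≽ : ∀ {n} k (f : SetFunction n) S → ∣ S ∣ ℕ.≤ k → f S ≼ maxUpTo k f
max-≽ {n} k f S h = go (∈-filter⁺ (λ T → ∣ T ∣ ℕ.≤? k) (∈-subsets S) h)
  where
  go : ∀ {Ts} → S ∈ Ts → f S ≼ List.foldr (λ T r → f T ⊔ᵣ r) (f Subset.⊥) Ts
  go {T ∷ Ts} (here refl) = mk≼ λ ε 0<ε → 0 , λ m _ → ℚ-slack (ℚ.p≤p⊔q (seq (f T) m) _) 0<ε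
  go {T ∷ Ts} (there h)   = ≼-trans (go h) (mk≼ λ ε 0<ε → 0 , λ m _ → ℚ-slack (ℚ.p≤q⊔p (seq (f T) m) _) 0<ε)

sampleSum : ∀ {m} → (Subset n → ℕ) → Vec (Subset n) m → ℕ
sampleSum h []       = 0
sampleSum h (S ∷ Ss) = h S ℕ.+ sampleSum h Ss

module _ (D : Distribution n) where

  0≼mass : ∀ S → 0ᵣ ≼ mass D S
  0≼mass S = mk≼ (nonneg D S)

  𝔼-mono : ∀ {f g : SetFunction n} → (∀ S → f S ≼ g S) → 𝔼 D f ≼ 𝔼 D g
  𝔼-mono h = ∑-mono (subsets n) (λ S → *ᵣ-monoʳ (0≼mass S) (h S))

  𝔼-cong : ∀ {f g : SetFunction n} → (∀ S → f S ≋ g S) → 𝔼 D f ≋ 𝔼 D g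
  𝔼-cong h = ∑-cong (subsets n) (λ S → *ᵣ-cong ≋-refl (h S))

  𝔼-+ : ∀ (f g : SetFunction n) → 𝔼 D (λ S → f S +ᵣ g S) ≋ 𝔼 D f +ᵣ 𝔼 D g
  𝔼-+ f g = ≋-trans (∑-cong (subsets n) (λ S → *ᵣ-distribˡ-+ (mass D S) (f S) (g S))) (∑-+ (subsets n) _ _)

  𝔼-*ˡ : ∀ c (f : SetFunction n) → 𝔼 D (λ S → c *ᵣ f S) ≋ c *ᵣ 𝔼 D f
  𝔼-*ˡ c f = ≋-trans (∑-cong (subsets n) (λ S → *ᵣ-swapˡ (mass D S) c (f S))) (∑-*ˡ (subsets n) c _)

  𝔼-const≼ : ∀ c → 0ᵣ ≼ c → 𝔼 D (λ _ → c) ≼ c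
  𝔼-const≼ c 0≼c = begin
    ∑ (subsets n) (λ S → mass D S *ᵣ c)   ≈⟨ ∑-cong (subsets n) (λ S → *ᵣ-comm (mass D S) c) ⟩
    ∑ (subsets n) (λ S → c *ᵣ mass D S)   ≈⟨ ∑-*ˡ (subsets n) c (mass D) ⟩
    c *ᵣ ∑ (subsets n) (mass D)           ≲⟨ *ᵣ-monoʳ 0≼c (≈⇒≼ (total D)) ⟩
    c *ᵣ 1ᵣ                               ≈⟨ *ᵣ-identityʳ c ⟩
    c                                     ∎
    where open import Relation.Binary.Reasoning.Preorder ≼-preorder

  𝔼-∑ : ∀ (xs : List Z) (f : Z → SetFunction n) → ∑ xs (λ z → 𝔼 D (f z)) ≋ 𝔼 D (λ S → ∑ xs (λ z → f z S))
  𝔼-∑ xs f = ≋-trans (∑-swap xs (subsets n) (λ z S → mass D S *ᵣ f z S))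
    (∑-cong (subsets n) (λ S → ∑-*ˡ xs (mass D S) (λ z → f z S)))

  𝔼ⁿ-mono : ∀ m {f g : Vec (Subset n) m → ℝ} → (∀ Ss → f Ss ≼ g Ss) → 𝔼ⁿ D m f ≼ 𝔼ⁿ D m g
  𝔼ⁿ-mono zero    h = h []
  𝔼ⁿ-mono (suc m) h = 𝔼-mono (λ S → 𝔼ⁿ-mono m (λ Ss → h (S ∷ Ss)))

  𝔼ⁿ-∑ : ∀ m (xs : List Z) (f : Z → Vec (Subset n) m → ℝ) →
    ∑ xs (λ z → 𝔼ⁿ D m (f z)) ≋ 𝔼ⁿ D m (λ Ss → ∑ xs (λ z → f z Ss))
  𝔼ⁿ-∑ zero    xs f = ≋-refl
  𝔼ⁿ-∑ (suc m) xs f = ≋-trans (𝔼-∑ xs _) (𝔼-cong (λ S → 𝔼ⁿ-∑ m xs (λ z Ss → f z (S ∷ Ss))))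

  𝔼ⁿ-*ˡ : ∀ m c (f : Vec (Subset n) m → ℝ) → 𝔼ⁿ D m (λ Ss → c *ᵣ f Ss) ≋ c *ᵣ 𝔼ⁿ D m f
  𝔼ⁿ-*ˡ zero    c f = ≋-refl
  𝔼ⁿ-*ˡ (suc m) c f = ≋-trans (𝔼-cong (λ S → 𝔼ⁿ-*ˡ m c (λ Ss → f (S ∷ Ss)))) (𝔼-*ˡ c _)

  -- The affine form a + c · sampleSum is preserved when one draw is integrated out.
  𝔼ⁿ-sampleSum : ∀ (h : Subset n → ℕ) c m a →
    𝔼ⁿ D m (λ Ss → fromℕ (a ℕ.+ c ℕ.* sampleSum h Ss)) ≼ fromℕ a +ᵣ fromℕ (c ℕ.* m) *ᵣ 𝔼 D (λ S → fromℕ (h S))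
  𝔼ⁿ-sampleSum h c zero    a = ≼-trans
    (fromℕ-mono (ℕ.≤-reflexive (trans (cong (a ℕ.+_) (ℕ.*-zeroʳ c)) (ℕ.+-identityʳ a))))
    (≋⇒≼ (≋-trans (≋-sym (+ᵣ-identityʳ (fromℕ a))) (+ᵣ-cong ≋-refl
      (≋-sym (≋-trans (*ᵣ-cong (fromℕ-cong (ℕ.*-zeroʳ c)) ≋-refl) (*ᵣ-zeroˡ _))))))
  𝔼ⁿ-sampleSum h c (suc m) a = begin
    𝔼 D (λ S → 𝔼ⁿ D m (λ Ss → fromℕ (a ℕ.+ c ℕ.* (h S ℕ.+ sampleSum h Ss))))
      ≲⟨ 𝔼-mono (λ S → ≼-trans (𝔼ⁿ-mono m (λ Ss → fromℕ-mono (ℕ.≤-reflexive (shift (h S) (sampleSum h Ss)))))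
           (𝔼ⁿ-sampleSum h c m (a ℕ.+ c ℕ.* h S))) ⟩
    𝔼 D (λ S → fromℕ (a ℕ.+ c ℕ.* h S) +ᵣ fromℕ (c ℕ.* m) *ᵣ H)
      ≈⟨ 𝔼-cong (λ S → +ᵣ-cong (≋-trans (fromℕ-+ a (c ℕ.* h S)) (+ᵣ-cong ≋-refl (fromℕ-* c (h S)))) ≋-refl) ⟩
    𝔼 D (λ S → fromℕ a +ᵣ fromℕ c *ᵣ fromℕ (h S) +ᵣ fromℕ (c ℕ.* m) *ᵣ H)
      ≈⟨ ≋-trans (𝔼-+ _ _) (+ᵣ-cong (≋-trans (𝔼-+ _ _) (+ᵣ-cong ≋-refl (𝔼-*ˡ (fromℕ c) (fromℕ ∘ h)))) ≋-refl) ⟩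
    𝔼 D (λ _ → fromℕ a) +ᵣ fromℕ c *ᵣ H +ᵣ 𝔼 D (λ _ → fromℕ (c ℕ.* m) *ᵣ H)
      ≲⟨ +ᵣ-mono (+ᵣ-mono (𝔼-const≼ (fromℕ a) (0≼fromℕ a)) ≼-refl)
           (𝔼-const≼ _ (0≼* (0≼fromℕ (c ℕ.* m)) 0≼H)) ⟩
    fromℕ a +ᵣ fromℕ c *ᵣ H +ᵣ fromℕ (c ℕ.* m) *ᵣ H
      ≈⟨ ≋-trans (+ᵣ-assoc _ _ _) (+ᵣ-cong ≋-refl collect) ⟩
    fromℕ a +ᵣ fromℕ (c ℕ.* suc m) *ᵣ H ∎
    where
    open import Relation.Binary.Reasoning.Preorder ≼-preorder
    H : ℝ
    H = 𝔼 D (λ S → fromℕ (h S))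
    0≼H : 0ᵣ ≼ H
    0≼H = ≼-trans (≋⇒≼ (≋-sym (∑-zero (subsets n)))) (∑-mono (subsets n) (λ S → 0≼* (0≼mass S) (0≼fromℕ (h S))))
    shift : ∀ x y → a ℕ.+ c ℕ.* (x ℕ.+ y) ≡ a ℕ.+ c ℕ.* x ℕ.+ c ℕ.* y
    shift x y = trans (cong (a ℕ.+_) (ℕ.*-distribˡ-+ c x y)) (sym (ℕ.+-assoc a _ _))
    collect : fromℕ c *ᵣ H +ᵣ fromℕ (c ℕ.* m) *ᵣ H ≋ fromℕ (c ℕ.* suc m) *ᵣ H
    collect = ≋-trans (+ᵣ-cong (*ᵣ-comm _ _) (*ᵣ-comm _ _)) (≋-trans (≋-sym (*ᵣ-distribˡ-+ H _ _))
      (≋-trans (*ᵣ-comm H _) (*ᵣ-cong (≋-trans (≋-sym (fromℕ-+ c (c ℕ.* m))) (fromℕ-cong (sym (ℕ.*-suc c m)))) ≋-refl)))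

-- Averaging over labellings and hard indices

module Averaging {n r : ℕ} {Φ : Set} (Ω : List Φ) (F : Φ → Fin r → Subset n → ℕ)
  (bad : Φ → Subset n → Bool) (degenerate : Φ → Bool) (k OPT bound : ℕ)
  (r>0 : 0 ℕ.< r) (∣Ω∣>0 : 0 ℕ.< length Ω)
  (same  : ∀ φ S → bad φ S ≡ false → ∀ i i′ → F φ i S ≡ F φ i′ S)
  (large : ∀ φ → degenerate φ ≡ false → ∀ i → ∃[ S ] (∣ S ∣ ℕ.≤ k × OPT ℕ.≤ F φ i S))
  (small : ∀ φ S → ∣ S ∣ ℕ.≤ k → sumOf (allFin r) (λ i → F φ i S) ℕ.≤ bound)
  where

  open import Relation.Binary.Reasoning.Preorder ≼-preorder

  f : Φ → Fin r → SetFunction n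
  f φ i S = fromℕ (F φ i S)

  -- An algorithm succeeds with probability at least 4/K for every labelling and every i. On average
  -- over both, at most 1/K is accounted for by each of: a bad draw among the m samples, a
  -- degenerate labelling, and the indices that one common answer can serve. The last is where `gap`
  -- enters.
  module Failure (𝓕 : Class) (f∈𝓕 : ∀ φ i → 𝓕 (f φ i)) (D : Distribution n) (m K : ℕ) (α δ : ℝ)
    (0≼α : 0ᵣ ≼ α) (0≼δ : 0ᵣ ≼ δ) (4≼ : fromℕ 4 ≼ fromℕ K *ᵣ (1ᵣ -ᵣ δ))
    (bad-rare : ∀ S → K ℕ.* suc m ℕ.* sumOf Ω (λ φ → ⟦ bad φ S ⟧) ℕ.≤ length Ω)
    (degenerate-rare : K ℕ.* suc m ℕ.* sumOf Ω (λ φ → ⟦ degenerate φ ⟧) ℕ.≤ length Ω)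
    (gap : ¬ (α *ᵣ fromℕ (r ℕ.* OPT) ≼ fromℕ (K ℕ.* bound)))
    (optimizable : OptimizableAt 𝓕 D k m α δ) where

    private
      𝒜 : Algorithm n k m
      𝒜 = proj₁ optimizable

      E : Φ → Fin r → Vec (Subset n) m → Bool
      E φ i = proj₁ (proj₂ optimizable (f φ i) (f∈𝓕 φ i))

      success : ∀ φ i Ss → E φ i Ss ≡ true →
        α *ᵣ maxUpTo k (f φ i) ≼ 𝔼 (output 𝒜 (labelled (f φ i) Ss)) (f φ i)
      success φ i Ss e = mk≼ (proj₁ (proj₂ (proj₂ optimizable (f φ i) (f∈𝓕 φ i))) Ss e)

      likely : ∀ φ i → 1ᵣ -ᵣ δ ≼ 𝔼ⁿ D m (λ Ss → if E φ i Ss then 1ᵣ else 0ᵣ)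
      likely φ i = mk≼ (proj₂ (proj₂ (proj₂ optimizable (f φ i) (f∈𝓕 φ i))))

      i₀ : Fin r
      i₀ = Fin.fromℕ< r>0

      h : Φ → Subset n → ℕ
      h φ S = ⟦ bad φ S ⟧

      ⟦⟧≡0 : ∀ b {c} → ⟦ b ⟧ ℕ.+ c ≡ 0 → b ≡ false × c ≡ 0
      ⟦⟧≡0 false e = refl , e

      samples≈ : ∀ {m} φ (Ss : Vec (Subset n) m) → sampleSum (h φ) Ss ≡ 0 → ∀ i →
        labelled (f φ i₀) Ss ≈ˢ labelled (f φ i) Ss
      samples≈ φ []       e i = []
      samples≈ φ (S ∷ Ss) e i =
        let (good , e′) = ⟦⟧≡0 (bad φ S) e
            eq          = fromℕ-cong (same φ S good i₀ i)
        in (refl , (_≼_.un≼ (≋⇒≼ eq) , _≼_.un≼ (≋⇒≼ (≋-sym eq)))) ∷ samples≈ φ Ss e′ i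

      0≼f : ∀ φ i S → 0ᵣ ≼ f φ i S
      0≼f φ i S = 0≼fromℕ (F φ i S)

      wins : Φ → Vec (Subset n) m → ℕ
      wins φ Ss = sumOf (allFin r) (λ i → ⟦ E φ i Ss ⟧)

      -- If all samples are good, the algorithm answers every i with the same random set.
      wins≤ : ∀ φ Ss → degenerate φ ≡ false → sampleSum (h φ) Ss ≡ 0 →
        α *ᵣ fromℕ (wins φ Ss ℕ.* OPT) ≼ fromℕ bound
      wins≤ φ Ss ok good = begin
        α *ᵣ fromℕ (wins φ Ss ℕ.* OPT)
          ≈⟨ *ᵣ-cong ≋-refl (≋-trans (fromℕ-cong (trans (ℕ.*-comm (wins φ Ss) OPT) (sym (sum-* (allFin r) OPT _))))
               (≋-sym (∑-fromℕ (allFin r) _))) ⟩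
        α *ᵣ ∑ (allFin r) (λ i → fromℕ (OPT ℕ.* ⟦ E φ i Ss ⟧))
          ≈⟨ ≋-sym (∑-*ˡ (allFin r) α _) ⟩
        ∑ (allFin r) (λ i → α *ᵣ fromℕ (OPT ℕ.* ⟦ E φ i Ss ⟧))
          ≲⟨ ∑-mono (allFin r) each ⟩
        ∑ (allFin r) (λ i → 𝔼 Q (f φ i))
          ≈⟨ 𝔼-∑ Q (allFin r) (f φ) ⟩
        𝔼 Q (λ S → ∑ (allFin r) (λ i → f φ i S))
          ≈⟨ 𝔼-cong Q (λ S → ∑-fromℕ (allFin r) (λ i → F φ i S)) ⟩
        𝔼 Q (λ S → fromℕ (sumOf (allFin r) (λ i → F φ i S)))
          ≲⟨ ∑-mono (subsets n) bounded ⟩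
        𝔼 Q (λ _ → fromℕ bound)
          ≲⟨ 𝔼-const≼ Q (fromℕ bound) (0≼fromℕ bound) ⟩
        fromℕ bound ∎
        where
        Q : Distribution n
        Q = output 𝒜 (labelled (f φ i₀) Ss)
        answer : ∀ i b → E φ i Ss ≡ b → α *ᵣ fromℕ (OPT ℕ.* ⟦ b ⟧) ≼ 𝔼 Q (f φ i)
        answer i true e =
          let (S , ∣S∣≤k , OPT≤) = large φ ok i in begin
          α *ᵣ fromℕ (OPT ℕ.* 1)    ≲⟨ *ᵣ-monoʳ 0≼α (fromℕ-mono (ℕ.≤-trans (ℕ.≤-reflexive (ℕ.*-identityʳ OPT)) OPT≤)) ⟩
          α *ᵣ f φ i S              ≲⟨ *ᵣ-monoʳ 0≼α (max-≽ k (f φ i) S ∣S∣≤k) ⟩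
          α *ᵣ maxUpTo k (f φ i)    ≲⟨ success φ i Ss e ⟩
          𝔼 (output 𝒜 (labelled (f φ i) Ss)) (f φ i)
                                    -- The labels for i and for the reference index are equal only
                                    -- as reals, so extensionality is what identifies the two output
                                    -- distributions.
                                    ≲⟨ ∑-mono (subsets n) (λ S → *ᵣ-monoˡ (0≼f φ i S)
                                         (≈⇒≽ (extensional 𝒜 (samples≈ φ Ss good i) S))) ⟩
          𝔼 Q (f φ i)               ∎
        answer i false e = begin
          α *ᵣ fromℕ (OPT ℕ.* 0)    ≈⟨ *ᵣ-cong ≋-refl (fromℕ-cong (ℕ.*-zeroʳ OPT)) ⟩
          α *ᵣ 0ᵣ                   ≈⟨ *ᵣ-zeroʳ α ⟩
          0ᵣ                        ≈⟨ ≋-sym (∑-zero (subsets n)) ⟩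
          ∑ (subsets n) (λ _ → 0ᵣ)  ≲⟨ ∑-mono (subsets n) (λ S → 0≼* (0≼mass Q S) (0≼f φ i S)) ⟩
          𝔼 Q (f φ i)               ∎
        each : ∀ i → α *ᵣ fromℕ (OPT ℕ.* ⟦ E φ i Ss ⟧) ≼ 𝔼 Q (f φ i)
        each i = answer i (E φ i Ss) refl
        bounded : ∀ S → mass Q S *ᵣ fromℕ (sumOf (allFin r) (λ i → F φ i S)) ≼ mass Q S *ᵣ fromℕ bound
        bounded S = Sum.[ feasible-set , infeasible-set ]′ (ℕ.≤-<-connex ∣ S ∣ k)
          where
          total-value : ℝ
          total-value = fromℕ (sumOf (allFin r) (λ i → F φ i S))
          feasible-set : ∣ S ∣ ℕ.≤ k → mass Q S *ᵣ total-value ≼ mass Q S *ᵣ fromℕ bound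
          feasible-set ∣S∣≤k = *ᵣ-monoʳ (0≼mass Q S) (fromℕ-mono (small φ S ∣S∣≤k))
          infeasible-set : k ℕ.< ∣ S ∣ → mass Q S *ᵣ total-value ≼ mass Q S *ᵣ fromℕ bound
          infeasible-set k<∣S∣ = begin
            mass Q S *ᵣ total-value         ≲⟨ *ᵣ-monoˡ (0≼fromℕ (sumOf (allFin r) (λ i → F φ i S))) (≈⇒≼ (feasible 𝒜 _ S k<∣S∣)) ⟩
            0ᵣ *ᵣ total-value               ≈⟨ *ᵣ-zeroˡ total-value ⟩
            0ᵣ                    ≲⟨ 0≼* (0≼mass Q S) (0≼fromℕ bound) ⟩
            mass Q S *ᵣ fromℕ bound ∎

      -- A single bad sample makes the last term at least Kr, which pays for the trivial bound.
      -- Without bad samples, more than r/K wins would let `wins≤` contradict `gap`.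
      few-wins : ∀ φ Ss → degenerate φ ≡ false →
        K ℕ.* wins φ Ss ℕ.≤ r ℕ.+ K ℕ.* r ℕ.* sampleSum (h φ) Ss
      few-wins φ Ss ok with sampleSum (h φ) Ss in e
      ... | suc c = ℕ.≤-trans (ℕ.≤-trans (ℕ.*-monoʳ-≤ K wins≤r) (ℕ.≤-trans (ℕ.m≤m*n (K ℕ.* r) (suc c)) ℕ.≤-refl))
                      (ℕ.m≤n+m _ r)
        where
        wins≤r : wins φ Ss ℕ.≤ r
        wins≤r = ℕ.≤-trans (sum-mono (allFin r) (λ i → ⟦⟧≤1 (E φ i Ss)))
          (ℕ.≤-reflexive (trans (sym (length≡sum (allFin r))) (length-allFin r)))
      ... | zero with K ℕ.* wins φ Ss ℕ.≤? r
      ...   | yes le = ℕ.≤-trans le (ℕ.m≤m+n r _)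
      ...   | no  gt = contradiction (begin
        α *ᵣ fromℕ (r ℕ.* OPT)
          ≲⟨ *ᵣ-monoʳ 0≼α (fromℕ-mono (ℕ.≤-trans (ℕ.*-monoˡ-≤ OPT (ℕ.<⇒≤ (ℕ.≰⇒> gt))) (ℕ.≤-reflexive (ℕ.*-assoc K (wins φ Ss) OPT)))) ⟩
        α *ᵣ fromℕ (K ℕ.* (wins φ Ss ℕ.* OPT))
          ≈⟨ ≋-trans (*ᵣ-cong ≋-refl (fromℕ-* K _)) (*ᵣ-swapˡ α (fromℕ K) _) ⟩
        fromℕ K *ᵣ (α *ᵣ fromℕ (wins φ Ss ℕ.* OPT))
          ≲⟨ *ᵣ-monoʳ (0≼fromℕ K) (wins≤ φ Ss ok e) ⟩
        fromℕ K *ᵣ fromℕ bound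
          ≈⟨ ≋-sym (fromℕ-* K bound) ⟩
        fromℕ (K ℕ.* bound) ∎) gap

      𝔼bad : Φ → ℝ
      𝔼bad φ = 𝔼 D (λ S → fromℕ (h φ S))

      0≼𝔼bad : ∀ φ → 0ᵣ ≼ 𝔼bad φ
      0≼𝔼bad φ = ≼-trans (≋⇒≼ (≋-sym (∑-zero (subsets n))))
        (∑-mono (subsets n) (λ S → 0≼* (0≼mass D S) (0≼fromℕ (h φ S))))

      if≋ : ∀ b → (if b then 1ᵣ else 0ᵣ) ≋ fromℕ ⟦ b ⟧
      if≋ true  = ≋-refl
      if≋ false = ≋-refl

      Kr : ℝ
      Kr = fromℕ (K ℕ.* r) *ᵣ (1ᵣ -ᵣ δ)

      typical : ∀ φ → degenerate φ ≡ false → Kr ≼ fromℕ r +ᵣ fromℕ (K ℕ.* r ℕ.* m) *ᵣ 𝔼bad φ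
      typical φ ok = begin
        fromℕ (K ℕ.* r) *ᵣ (1ᵣ -ᵣ δ)
          ≈⟨ ≋-trans (*ᵣ-cong (fromℕ-* K r) ≋-refl) (*ᵣ-assoc (fromℕ K) (fromℕ r) _) ⟩
        fromℕ K *ᵣ (fromℕ r *ᵣ (1ᵣ -ᵣ δ))
          ≈⟨ *ᵣ-cong ≋-refl (*ᵣ-cong (fromℕ-cong (sym (length-allFin r))) ≋-refl) ⟩
        fromℕ K *ᵣ (fromℕ (length (allFin r)) *ᵣ (1ᵣ -ᵣ δ))
          ≈⟨ *ᵣ-cong ≋-refl (≋-sym (∑-const (allFin r) _)) ⟩
        fromℕ K *ᵣ ∑ (allFin r) (λ i → 1ᵣ -ᵣ δ)
          ≲⟨ *ᵣ-monoʳ (0≼fromℕ K) (∑-mono (allFin r) (λ i → ≼-trans (likely φ i) (𝔼ⁿ-mono D m (λ Ss → ≋⇒≼ (if≋ (E φ i Ss)))))) ⟩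
        fromℕ K *ᵣ ∑ (allFin r) (λ i → 𝔼ⁿ D m (λ Ss → fromℕ ⟦ E φ i Ss ⟧))
          ≈⟨ *ᵣ-cong ≋-refl (𝔼ⁿ-∑ D m (allFin r) _) ⟩
        fromℕ K *ᵣ 𝔼ⁿ D m (λ Ss → ∑ (allFin r) (λ i → fromℕ ⟦ E φ i Ss ⟧))
          ≈⟨ ≋-sym (𝔼ⁿ-*ˡ D m (fromℕ K) _) ⟩
        𝔼ⁿ D m (λ Ss → fromℕ K *ᵣ ∑ (allFin r) (λ i → fromℕ ⟦ E φ i Ss ⟧))
          ≲⟨ 𝔼ⁿ-mono D m (λ Ss → ≼-trans (≋⇒≼ (≋-trans (*ᵣ-cong ≋-refl (∑-fromℕ (allFin r) _)) (≋-sym (fromℕ-* K (wins φ Ss)))))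
               (fromℕ-mono (few-wins φ Ss ok))) ⟩
        𝔼ⁿ D m (λ Ss → fromℕ (r ℕ.+ K ℕ.* r ℕ.* sampleSum (h φ) Ss))
          ≲⟨ 𝔼ⁿ-sampleSum D (h φ) (K ℕ.* r) m r ⟩
        fromℕ r +ᵣ fromℕ (K ℕ.* r ℕ.* m) *ᵣ 𝔼bad φ ∎

      1-δ≼1 : 1ᵣ -ᵣ δ ≼ 1ᵣ
      1-δ≼1 = begin
        1ᵣ -ᵣ δ           ≈⟨ ≋-sym (+ᵣ-identityʳ _) ⟩
        1ᵣ -ᵣ δ +ᵣ 0ᵣ     ≲⟨ +ᵣ-mono ≼-refl 0≼δ ⟩
        1ᵣ -ᵣ δ +ᵣ δ      ≈⟨ ≋-trans (+ᵣ-assoc 1ᵣ (-ᵣ δ) δ) (+ᵣ-cong ≋-refl (≋-trans (+ᵣ-comm (-ᵣ δ) δ) (+ᵣ-inverseʳ δ))) ⟩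
        1ᵣ +ᵣ 0ᵣ          ≈⟨ +ᵣ-identityʳ 1ᵣ ⟩
        1ᵣ                ∎

      -- Nothing is known for a degenerate labelling, so there the trivial bound 1 - δ ≤ 1 is
      -- charged to the last summand.
      every : ∀ φ → Kr ≼ fromℕ r +ᵣ fromℕ (K ℕ.* r ℕ.* m) *ᵣ 𝔼bad φ +ᵣ fromℕ (K ℕ.* r ℕ.* ⟦ degenerate φ ⟧)
      every φ = either (degenerate φ) refl
        where
        either : ∀ b → degenerate φ ≡ b → Kr ≼ fromℕ r +ᵣ fromℕ (K ℕ.* r ℕ.* m) *ᵣ 𝔼bad φ +ᵣ fromℕ (K ℕ.* r ℕ.* ⟦ b ⟧)
        either false e = ≼-trans (typical φ e) (≼-trans (≋⇒≼ (≋-sym (+ᵣ-identityʳ _)))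
                      (+ᵣ-mono ≼-refl (0≼fromℕ (K ℕ.* r ℕ.* 0))))
        either true  e = begin
          Kr                          ≲⟨ *ᵣ-monoʳ (0≼fromℕ (K ℕ.* r)) 1-δ≼1 ⟩
          fromℕ (K ℕ.* r) *ᵣ 1ᵣ       ≈⟨ ≋-sym (fromℕ-* (K ℕ.* r) 1) ⟩
          fromℕ (K ℕ.* r ℕ.* 1)       ≈⟨ ≋-sym (+ᵣ-identityˡ _) ⟩
          0ᵣ +ᵣ fromℕ (K ℕ.* r ℕ.* 1) ≲⟨ +ᵣ-mono (≼-trans (≋⇒≼ (≋-sym (+ᵣ-identityˡ 0ᵣ)))
                                         (+ᵣ-mono (0≼fromℕ r) (0≼* (0≼fromℕ (K ℕ.* r ℕ.* m)) (0≼𝔼bad φ)))) ≼-refl ⟩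
          _                           ∎

      R#Ω = r ℕ.* length Ω

      rare : ∀ j x → j ℕ.≤ suc m → K ℕ.* suc m ℕ.* x ℕ.≤ length Ω → K ℕ.* r ℕ.* j ℕ.* x ℕ.≤ R#Ω
      rare j x j≤ le = ℕ.≤-trans (ℕ.≤-trans (ℕ.*-monoˡ-≤ x (ℕ.*-monoʳ-≤ (K ℕ.* r) j≤)) (ℕ.≤-reflexive (lem K r (suc m) x)))
        (ℕ.*-monoʳ-≤ r le)
        where
        lem : ∀ K r s x → K ℕ.* r ℕ.* s ℕ.* x ≡ r ℕ.* (K ℕ.* s ℕ.* x)
        lem = solve-∀

      bad-total : ∑ Ω (λ φ → fromℕ (K ℕ.* r ℕ.* m) *ᵣ 𝔼bad φ) ≼ fromℕ R#Ω
      bad-total = begin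
        ∑ Ω (λ φ → fromℕ (K ℕ.* r ℕ.* m) *ᵣ 𝔼bad φ)
          ≈⟨ ≋-trans (∑-*ˡ Ω _ 𝔼bad) (*ᵣ-cong ≋-refl (𝔼-∑ D Ω _)) ⟩
        fromℕ (K ℕ.* r ℕ.* m) *ᵣ 𝔼 D (λ S → ∑ Ω (λ φ → fromℕ (h φ S)))
          ≈⟨ ≋-trans (≋-sym (𝔼-*ˡ D _ _)) (𝔼-cong D (λ S → ≋-trans (*ᵣ-cong ≋-refl (∑-fromℕ Ω (λ φ → h φ S)))
               (≋-sym (fromℕ-* (K ℕ.* r ℕ.* m) _)))) ⟩
        𝔼 D (λ S → fromℕ (K ℕ.* r ℕ.* m ℕ.* sumOf Ω (λ φ → h φ S)))
          ≲⟨ 𝔼-mono D (λ S → fromℕ-mono (rare m _ (ℕ.n≤1+n m) (bad-rare S))) ⟩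
        𝔼 D (λ S → fromℕ R#Ω)
          ≲⟨ 𝔼-const≼ D _ (0≼fromℕ R#Ω) ⟩
        fromℕ R#Ω ∎

      degenerate-total : ∑ Ω (λ φ → fromℕ (K ℕ.* r ℕ.* ⟦ degenerate φ ⟧)) ≼ fromℕ R#Ω
      degenerate-total = ≼-trans (≋⇒≼ (∑-fromℕ Ω _)) (fromℕ-mono (ℕ.≤-trans
        (ℕ.≤-reflexive (trans (sum-* Ω (K ℕ.* r) _) (cong (ℕ._* sumOf Ω (λ φ → ⟦ degenerate φ ⟧)) (sym (ℕ.*-identityʳ (K ℕ.* r))))))
        (rare 1 _ (s≤s z≤n) degenerate-rare)))

      -- Summing over all labellings lets the expectation over D be exchanged with the count, so
      -- that rarity of bad labellings for each fixed set is enough for any D.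
      overall : fromℕ (R#Ω ℕ.* 4) ≼ fromℕ (R#Ω ℕ.+ R#Ω ℕ.+ R#Ω)
      overall = begin
        fromℕ (R#Ω ℕ.* 4)
          ≈⟨ fromℕ-* R#Ω 4 ⟩
        fromℕ R#Ω *ᵣ fromℕ 4
          ≲⟨ *ᵣ-monoʳ (0≼fromℕ R#Ω) 4≼ ⟩
        fromℕ R#Ω *ᵣ (fromℕ K *ᵣ (1ᵣ -ᵣ δ))
          ≈⟨ ≋-trans (≋-sym (*ᵣ-assoc _ _ _)) (*ᵣ-cong (≋-trans (≋-sym (fromℕ-* R#Ω K))
               (≋-trans (fromℕ-cong (lem r (length Ω) K)) (fromℕ-* (length Ω) (K ℕ.* r)))) ≋-refl) ⟩
        fromℕ (length Ω) *ᵣ fromℕ (K ℕ.* r) *ᵣ (1ᵣ -ᵣ δ)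
          ≈⟨ ≋-trans (*ᵣ-assoc _ _ _) (≋-sym (∑-const Ω Kr)) ⟩
        ∑ Ω (λ _ → Kr)
          ≲⟨ ∑-mono Ω every ⟩
        ∑ Ω (λ φ → fromℕ r +ᵣ fromℕ (K ℕ.* r ℕ.* m) *ᵣ 𝔼bad φ +ᵣ fromℕ (K ℕ.* r ℕ.* ⟦ degenerate φ ⟧))
          ≈⟨ ≋-trans (∑-+ Ω _ _) (+ᵣ-cong (∑-+ Ω _ _) ≋-refl) ⟩
        ∑ Ω (λ _ → fromℕ r) +ᵣ ∑ Ω (λ φ → fromℕ (K ℕ.* r ℕ.* m) *ᵣ 𝔼bad φ) +ᵣ ∑ Ω (λ φ → fromℕ (K ℕ.* r ℕ.* ⟦ degenerate φ ⟧))
          ≲⟨ +ᵣ-mono (+ᵣ-mono (≋⇒≼ (≋-trans (∑-const Ω (fromℕ r)) (≋-trans (≋-sym (fromℕ-* (length Ω) r)) (fromℕ-cong (ℕ.*-comm (length Ω) r)))))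
               bad-total) degenerate-total ⟩
        fromℕ R#Ω +ᵣ fromℕ R#Ω +ᵣ fromℕ R#Ω
          ≈⟨ ≋-sym (≋-trans (fromℕ-+ (R#Ω ℕ.+ R#Ω) R#Ω) (+ᵣ-cong (fromℕ-+ R#Ω R#Ω) ≋-refl)) ⟩
        fromℕ (R#Ω ℕ.+ R#Ω ℕ.+ R#Ω) ∎
        where
        lem : ∀ r N K → r ℕ.* N ℕ.* K ≡ N ℕ.* (K ℕ.* r)
        lem = solve-∀

    impossible : ⊥
    impossible = ℕ.<⇒≱ (ℕ.m<m+n (R#Ω ℕ.+ R#Ω ℕ.+ R#Ω) (ℕ.*-mono-≤ r>0 ∣Ω∣>0))
      (subst (ℕ._≤ R#Ω ℕ.+ R#Ω ℕ.+ R#Ω) (lem R#Ω) (fromℕ-cancel overall))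
      where
      lem : ∀ x → x ℕ.* 4 ≡ x ℕ.+ x ℕ.+ x ℕ.+ x
      lem = solve-∀

-- Assembling the hard instance on one ground set

eqVec-refl : ∀ {q d} (v : Vec (Fin q) d) → eqVec _==_ v v ≡ true
eqVec-refl []      = refl
eqVec-refl (x ∷ v) = cong₂ _∧_ (==-refl x) (eqVec-refl v)

eqVec-sound : ∀ {q d} (u v : Vec (Fin q) d) → eqVec _==_ u v ≡ true → u ≡ v
eqVec-sound []      []      e = refl
eqVec-sound (x ∷ u) (y ∷ v) e with x == y in e₁
... | true = cong₂ _∷_ (==⇒≡ x y e₁) (eqVec-sound u v e)

^-cancel-≤ : ∀ m n o → 0 < o → m ^ o ≤ n ^ o → m ≤ n
^-cancel-≤ m n o o>0 h = ≮⇒≥ λ n<m → <⇒≱ (^-monoˡ-< o {{>-nonZero o>0}} n<m) h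

-- A product gadget has exactly q^d points, so the required number of points is rounded up to a
-- power of q at the cost of a factor q.
power-near : ∀ q → 2 ≤ q → ∀ k → ∃[ d ] (suc k ≤ q ^ d × q ^ d ≤ q * suc k)
power-near q 2≤q zero    = 0 , ≤-refl , ≤-trans (≤-trans (s≤s z≤n) 2≤q) (≤-reflexive (sym (*-identityʳ q)))
power-near q 2≤q (suc k) with power-near q 2≤q k
... | d , lo , hi with suc (suc k) ≤? q ^ d
...   | yes lo′ = d , lo′ , ≤-trans hi (*-monoʳ-≤ q (n≤1+n (suc k)))
...   | no  gt  = suc d
  , ≤-trans (s≤s (s≤s (m≤m+n k k))) (≤-trans (≤-reflexive (lem k)) (*-mono-≤ 2≤q lo))
  , *-monoʳ-≤ q (≤-trans (s≤s⁻¹ (≰⇒> gt)) (n≤1+n (suc k)))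
  where
  lem : ∀ k → 2 + (k + k) ≡ 2 * suc k
  lem = solve-∀

n≤2^n : ∀ n → n ≤ 2 ^ n
n≤2^n zero    = z≤n
n≤2^n (suc n) = ≤-trans (+-mono-≤ (m^n>0 2 n) (n≤2^n n)) (≤-reflexive (cong (λ z → 2 ^ n + z) (sym (+-identityʳ (2 ^ n)))))

module Core (a ℓ : ℕ) (a>0 : 0 < a) where

  -- C^d bounds the loss of the d-fold product gadget; since q = C^(2a), it is at
  -- most C y as soon as q^d ≤ q y^(2a).
  C q s c : ℕ
  C = 2 * 5 ^ ℓ
  q = C ^ (2 * a)
  s = gadgetSize q ℓ
  c = C * (q + 3)

  2≤C : 2 ≤ C
  2≤C = *-monoʳ-≤ 2 (m^n>0 5 ℓ)

  2≤q : 2 ≤ q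
  2≤q = ≤-trans 2≤C (≤-trans (≤-reflexive (sym (*-identityʳ C)))
    (^-monoʳ-≤ C {{>-nonZero (≤-trans (s≤s z≤n) 2≤C)}} (≤-trans a>0 (m≤m+n a (a + 0)))))

  -- Here r = y^a and k = r². `gap` quantifies over P because the optimum contains a power of the
  -- gadget weight, a quantity that the choice of parameters should not see.
  module _ {n y w m K : ℕ} (𝓕 : Class) (D : Distribution n) (α δ : ℝ)
    (y>0 : 0 < y) (w>0 : 0 < w)
    (dense : K * suc m * (y ^ a * (2 * (y ^ a * y ^ a) * y) ^ suc (suc ℓ)) ≤ w ^ suc (suc ℓ))
    (exponential : K * suc m * (y ^ a * (y ^ a * y ^ a)) ≤ 2 ^ y)
    (fits : y ^ a * (y ^ a * y ^ a) * suc w * y ≤ n)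
    (inClass : ∀ (f : SetFunction n) u →
      u ≤ y ^ a * (y ^ a * y ^ a) * (y ^ a * (q * (y ^ a * y ^ a)) ^ s) → IsCoverageOver u f → 𝓕 f)
    (0≼α : 0ᵣ ≼ α) (0≼δ : 0ᵣ ≼ δ) (4≼ : fromℕ 4 ≼ fromℕ K *ᵣ (1ᵣ -ᵣ δ))
    (gap : ∀ P → 0 < P → ¬ (α *ᵣ fromℕ (y ^ a * P) ≼ fromℕ (K * (c * y) * P)))
    where

    private
      r k : ℕ
      r = y ^ a
      k = r * r
      r>0 : 0 < r
      r>0 = m^n>0 y {{>-nonZero y>0}} a
      k>0 : 0 < k
      k>0 = *-mono-≤ r>0 r>0
      near : ∃[ d ] (k ≤ q ^ d × q ^ d ≤ q * k)
      near = subst (λ k → ∃[ d ] (k ≤ q ^ d × q ^ d ≤ q * k)) (suc-pred k {{>-nonZero k>0}}) (power-near q 2≤q (pred k))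
      d = proj₁ near
      zs xs rest : List (Vec (Fin q) d)
      zs   = vectors (allFin q) d
      -- Only k of the q^d points become labels, so that k elements can carry all labels of one
      -- copy.
      xs   = take k zs
      rest = drop k zs
      length-xs : length xs ≡ k
      length-xs = trans (length-take k zs) (m≤n⇒m⊓n≡m (≤-trans (proj₁ (proj₂ near))
        (≤-reflexive (sym (trans (length-vectors (allFin q) d) (cong (_^ d) (length-allFin q)))))))
      L = gadgetWeight q ℓ
      τ = ((q + 5 ^ ℓ) * L) ^ d
      β = (5 ^ ℓ * L) ^ d
      G : Gadget (eqVec _==_) (xs ++ rest) (suc ℓ) (L ^ d) τ β (s ^ d)
      G = subst (λ zs → Gadget (eqVec _==_) zs (suc ℓ) (L ^ d) τ β (s ^ d)) (sym (take++drop≡id k zs)) (gadget q ℓ d)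

      module 𝓡 = Random r w eqVec-refl eqVec-sound xs rest G

      t = r * k
      OPT = t * (k * L ^ d)
      bound = r * (k * (τ + r * β)) + t * (k * β + r * (r * β))

      OPT>0 : 0 < OPT
      OPT>0 = *-mono-≤ (*-mono-≤ r>0 k>0) (*-mono-≤ k>0 (m^n>0 L {{>-nonZero (gadgetWeight>0 q ℓ)}} d))

      C^d≤ : C ^ d ≤ C * y
      C^d≤ = ^-cancel-≤ (C ^ d) (C * y) (2 * a) (≤-trans a>0 (m≤m+n a (a + 0))) (begin
        (C ^ d) ^ (2 * a)              ≡⟨ trans (^-*-assoc C d (2 * a)) (trans (cong (C ^_) (*-comm d (2 * a))) (sym (^-*-assoc C (2 * a) d))) ⟩
        q ^ d                          ≤⟨ proj₂ (proj₂ near) ⟩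
        q * (y ^ a * y ^ a)            ≡⟨ cong (q *_) (trans (sym (^-distribˡ-+-* y a a)) (cong (λ z → y ^ (a + z)) (sym (+-identityʳ a)))) ⟩
        C ^ (2 * a) * y ^ (2 * a)      ≡⟨ ^-distribʳ-* C y (2 * a) ⟨
        (C * y) ^ (2 * a)              ∎)
        where open ≤-Reasoning

      β≤ : β ≤ C ^ d * L ^ d
      β≤ = ≤-trans (^-monoˡ-≤ d (*-monoˡ-≤ L (m≤m+n (5 ^ ℓ) _))) (≤-reflexive (^-distribʳ-* C L d))

      τ≤ : τ ≤ C ^ d * (q * k) * L ^ d
      τ≤ = begin
        ((q + 5 ^ ℓ) * L) ^ d        ≤⟨ ^-monoˡ-≤ d (*-monoˡ-≤ L sum≤) ⟩
        (C * q * L) ^ d              ≡⟨ trans (^-distribʳ-* (C * q) L d) (cong (_* L ^ d) (^-distribʳ-* C q d)) ⟩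
        C ^ d * q ^ d * L ^ d        ≤⟨ *-monoˡ-≤ (L ^ d) (*-monoʳ-≤ (C ^ d) (proj₂ (proj₂ near))) ⟩
        C ^ d * (q * k) * L ^ d      ∎
        where
        open ≤-Reasoning
        lem : ∀ p q → p * q + q * p ≡ 2 * p * q
        lem = solve-∀
        sum≤ : q + 5 ^ ℓ ≤ C * q
        sum≤ = begin
          q + 5 ^ ℓ                  ≤⟨ +-mono-≤ (m≤n*m q (5 ^ ℓ) {{>-nonZero (m^n>0 5 ℓ)}}) (m≤n*m (5 ^ ℓ) q {{>-nonZero (≤-trans (s≤s z≤n) 2≤q)}}) ⟩
          5 ^ ℓ * q + q * 5 ^ ℓ      ≡⟨ lem (5 ^ ℓ) q ⟩
          C * q                      ∎

      -- The choices t = rk and k = r² pay off here: after extracting rk, the masks cost τ + rβ with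
      -- rβ ≤ kβ, and the unmasked part costs 2kβ. This gives q + 1 + 2 = q + 3 times C^d, against a
      -- sum of r optima.
      bound≤ : bound ≤ c * y * OPT
      bound≤ = begin
        r * (k * (τ + r * β)) + t * (k * β + r * (r * β))
          ≡⟨ lem₁ r τ β ⟩
        r * k * (τ + r * β + 2 * k * β)
          ≤⟨ *-monoʳ-≤ (r * k) (+-mono-≤ (+-mono-≤ τ≤ (*-mono-≤ (m≤m*n r r {{>-nonZero r>0}}) β≤)) (*-monoʳ-≤ (2 * k) β≤)) ⟩
        r * k * (C ^ d * (q * k) * L ^ d + k * (C ^ d * L ^ d) + 2 * k * (C ^ d * L ^ d))
          ≡⟨ lem₂ r k (C ^ d) q (L ^ d) ⟩
        C ^ d * (q + 3) * OPT
          ≤⟨ *-monoˡ-≤ OPT (≤-trans (*-monoˡ-≤ (q + 3) C^d≤) (≤-reflexive (lem₃ C y (q + 3)))) ⟩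
        c * y * OPT ∎
        where
        open ≤-Reasoning
        lem₁ : ∀ r τ β → r * (r * r * (τ + r * β)) + r * (r * r) * (r * r * β + r * (r * β)) ≡
          r * (r * r) * (τ + r * β + 2 * (r * r) * β)
        lem₁ = solve-∀
        lem₂ : ∀ r k C q L → r * k * (C * (q * k) * L + k * (C * L) + 2 * k * (C * L)) ≡ C * (q + 3) * (r * k * (k * L))
        lem₂ = solve-∀
        lem₃ : ∀ C y z → C * y * z ≡ C * z * y
        lem₃ = solve-∀

      Ω : List (Vec (Label (Vec (Fin q) d) r 𝓡.t) n)
      Ω = vectors 𝓡.Λ n

      ∣Ω∣ : length Ω ≡ length 𝓡.Λ ^ n
      ∣Ω∣ = length-vectors 𝓡.Λ n

      λ≡ : length 𝓡.Λ ≡ r * k * suc w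
      λ≡ = trans 𝓡.λ≡ (cong (λ k → r * k * suc w) length-xs)

      length-xs>0 : 0 < length xs
      length-xs>0 = ≤-trans k>0 (≤-reflexive (sym length-xs))

      module 𝓠 = 𝓡.Rare y (K * suc m) (suc (suc ℓ)) refl r>0 length-xs>0 w>0
        (subst (λ k → K * suc m * (r * (2 * k * y) ^ suc (suc ℓ)) ≤ w ^ suc (suc ℓ)) (sym length-xs) dense)
        (subst (λ k → K * suc m * (r * k) ≤ 2 ^ y) (sym length-xs) exponential)

      value : Vec (Label (Vec (Fin q) d) r 𝓡.t) n → Fin r → Subset n → ℕ
      value φ i S = val (𝓡.hard i) (image φ S)

      large : ∀ φ → 𝓡.unsurjective φ ≡ false → ∀ i → ∃[ S ] (∣ S ∣ ≤ k × OPT ≤ value φ i S)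
      large φ e i =
        let (S , ∣S∣≤ , cov) = 𝓡.surjective⇒ φ e i
        in S , ≤-trans ∣S∣≤ (≤-reflexive length-xs) ,
           subst (λ k → r * k * (k * L ^ d) ≤ value φ i S) length-xs
             (𝓡.hard-large i xs rest refl (image φ S) cov)

      small : ∀ φ (S : Subset n) → ∣ S ∣ ≤ k → sumOf (allFin r) (λ i → value φ i S) ≤ bound
      small φ S ∣S∣≤k = begin
        sumOf (allFin r) (λ i → value φ i S)
          ≤⟨ 𝓡.sum-hard≤ (image φ S) ⟩
        r * (length (image φ S) * (τ + r * β)) + r * length xs * (length (image φ S) * β + r * (r * β))
          ≡⟨ cong₂ (λ l k → r * (l * (τ + r * β)) + r * k * (l * β + r * (r * β))) (length-image φ S) length-xs ⟩
        r * (∣ S ∣ * (τ + r * β)) + t * (∣ S ∣ * β + r * (r * β))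
          ≤⟨ +-mono-≤ (*-monoʳ-≤ r (*-monoˡ-≤ (τ + r * β) ∣S∣≤k)) (*-monoʳ-≤ t (+-monoˡ-≤ (r * (r * β)) (*-monoˡ-≤ β ∣S∣≤k))) ⟩
        bound ∎
        where open ≤-Reasoning

      size≤ : ∀ i → length (𝓡.hard i) ≤ r * k * (r * (q * k) ^ s)
      size≤ i = begin
        length (𝓡.hard i)                  ≤⟨ 𝓡.length-hard i ⟩
        r * length xs * (r * s ^ d)        ≡⟨ cong (λ k → r * k * (r * s ^ d)) length-xs ⟩
        r * k * (r * s ^ d)                ≤⟨ *-monoʳ-≤ (r * k) (*-monoʳ-≤ r s^d≤) ⟩
        r * k * (r * (q * k) ^ s)          ∎
        where
        open ≤-Reasoning
        -- As s ≤ q^s, exchanging the exponents s and d turns s^d into a power of q^d with the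
        -- constant exponent s: the family has size polynomial in k.
        s^d≤ : s ^ d ≤ (q * k) ^ s
        s^d≤ = begin
          s ^ d             ≤⟨ ^-monoˡ-≤ d (≤-trans (n≤2^n s) (^-monoˡ-≤ s 2≤q)) ⟩
          (q ^ s) ^ d       ≡⟨ trans (^-*-assoc q s d) (trans (cong (q ^_) (*-comm s d)) (sym (^-*-assoc q d s))) ⟩
          (q ^ d) ^ s       ≤⟨ ^-monoˡ-≤ s (proj₂ (proj₂ near)) ⟩
          (q * k) ^ s       ∎

    not-optimizable : ¬ OptimizableAt 𝓕 D k m α δ
    not-optimizable = Averaging.Failure.impossible Ω value (λ φ S → 𝓡.bad (image φ S)) 𝓡.unsurjective k OPT bound
      r>0 (subst (0 <_) (sym ∣Ω∣) (m^n>0 (length 𝓡.Λ) {{>-nonZero (subst (0 <_) (sym λ≡) (*-mono-≤ (*-mono-≤ r>0 k>0) (s≤s z≤n)))}} n))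
      (λ φ S → 𝓡.indistinguishable (image φ S)) large small
      𝓕 (λ φ i → inClass _ (length (𝓡.hard i)) (size≤ i) (pullback-coverage (𝓡.hard i) φ)) D m K α δ 0≼α 0≼δ 4≼
      (λ S → ≤-trans (𝓠.bad-rare S) (≤-reflexive (sym ∣Ω∣)))
      (≤-trans (𝓠.unsurjective-rare (≤-trans (≤-reflexive (cong (_* y) λ≡)) fits)) (≤-reflexive (sym ∣Ω∣)))
      (λ h → gap OPT OPT>0 (≼-trans h (fromℕ-mono (≤-trans (*-monoʳ-≤ K bound≤) (≤-reflexive (sym (*-assoc K (c * y) OPT)))))))

-- Choice of parameters

-- The largest x with F x ≤ n. A strictly increasing F gains at least 1 per step, so raising n by
-- one raises x by at most one. The value 0 at n = 0 is a default.
inverse : (ℕ → ℕ) → ℕ → ℕ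
inverse F zero = 0
inverse F (suc n) with F (suc (inverse F n)) ≤? suc n
... | yes _ = suc (inverse F n)
... | no  _ = inverse F n

module Inverse (F : ℕ → ℕ) (F-step : ∀ x → F x < F (suc x)) (F0 : F 0 ≤ 1) where

  F-mono : ∀ {x y} → x ≤ y → F x ≤ F y
  F-mono {x} {y} x≤y = subst (λ y → F x ≤ F y) (m+[n∸m]≡n x≤y) (go (y ∸ x))
    where
    go : ∀ i → F x ≤ F (x + i)
    go zero    = ≤-reflexive (cong F (sym (+-identityʳ x)))
    go (suc i) = ≤-trans (go i) (≤-trans (<⇒≤ (F-step (x + i))) (≤-reflexive (cong F (sym (+-suc x i)))))

  inverse-upper : ∀ n → n < F (suc (inverse F n))
  inverse-upper zero = ≤-trans (s≤s z≤n) (F-step 0)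
  inverse-upper (suc n) with F (suc (inverse F n)) ≤? suc n
  ... | yes _  = ≤-trans (s≤s (inverse-upper n)) (F-step (suc (inverse F n)))
  ... | no  gt = ≰⇒> gt

  -- `suc (pred n)` is the maximum of n and 1, which makes the default at n = 0 admissible when F 0
  -- = 1.
  inverse-lower′ : ∀ n → F (inverse F n) ≤ suc (pred n)
  inverse-lower′ zero = F0
  inverse-lower′ (suc n) with F (suc (inverse F n)) ≤? suc n
  ... | yes le = le
  ... | no  _  = ≤-trans (inverse-lower′ n) (s≤s (pred[n]≤n))

  inverse-lower : ∀ n → 0 < n → F (inverse F n) ≤ n
  inverse-lower (suc n) _ = inverse-lower′ (suc n)

  inverse-grows : ∀ y n → F y ≤ n → y ≤ inverse F n
  inverse-grows y n Fy≤n = ≮⇒≥ λ lt → <⇒≱ (inverse-upper n) (≤-trans (F-mono lt) Fy≤n)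

n<2^n : ∀ n → suc n ≤ 2 ^ n
n<2^n zero    = ≤-refl
n<2^n (suc n) = ≤-trans (+-mono-≤ (m^n>0 2 n) (n<2^n n)) (≤-reflexive (cong (λ z → 2 ^ n + z) (sym (+-identityʳ (2 ^ n)))))

-- Split u = e + d with e < d. The factor e is at most 2^e, and u + 1 ≤ 2d ≤ 2^d.
linear≤exponential : ∀ e u → 2 * e < u → e * suc u ≤ 2 ^ u
linear≤exponential e u h = begin
  e * suc u              ≤⟨ *-mono-≤ (n≤2^n e) suc-u≤ ⟩
  2 ^ e * 2 ^ (u ∸ e)    ≡⟨ ^-distribˡ-+-* 2 e (u ∸ e) ⟨
  2 ^ (e + (u ∸ e))      ≡⟨ cong (2 ^_) (m+[n∸m]≡n e≤u) ⟩
  2 ^ u                  ∎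
  where
  open ≤-Reasoning
  e≤u : e ≤ u
  e≤u = ≤-trans (m≤m+n e (e + 0)) (<⇒≤ h)
  d = u ∸ e
  e<d : e < d
  e<d = +-cancelˡ-< e e d (≤-trans (≤-reflexive (cong suc (cong (λ z → e + z) (sym (+-identityʳ e))))) (≤-trans h (≤-reflexive (sym (m+[n∸m]≡n e≤u)))))
  d≡ : suc (pred d) ≡ d
  d≡ = suc-pred d {{>-nonZero (≤-trans (s≤s z≤n) e<d)}}
  suc-u≤ : suc u ≤ 2 ^ d
  suc-u≤ = begin
    suc u                    ≡⟨ cong suc (m+[n∸m]≡n e≤u) ⟨
    suc e + d                ≤⟨ +-monoˡ-≤ d e<d ⟩
    d + d                    ≡⟨ cong (λ z → d + z) (sym (+-identityʳ d)) ⟩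
    2 * d                    ≡⟨ cong (2 *_) d≡ ⟨
    2 * suc (pred d)         ≤⟨ *-monoʳ-≤ 2 (n<2^n (pred d)) ⟩
    2 ^ suc (pred d)         ≡⟨ cong (2 ^_) d≡ ⟩
    2 ^ d                    ∎

-- Taking roots of order e + 1 reduces this to the linear case for the quotient d of y by e + 1,
-- since y ≤ (e + 1)(d + 1).
polynomial≤exponential : ∀ e y → suc e * (2 * suc e + 1) ≤ y → y ^ suc e ≤ 2 ^ y
polynomial≤exponential e y h = begin
  y ^ e′                ≤⟨ ^-monoˡ-≤ e′ y≤ ⟩
  (e′ * suc d) ^ e′     ≤⟨ ^-monoˡ-≤ e′ (linear≤exponential e′ d 2e<d) ⟩
  (2 ^ d) ^ e′          ≡⟨ ^-*-assoc 2 d e′ ⟩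
  2 ^ (d * e′)          ≤⟨ ^-monoʳ-≤ 2 (m/n*n≤m y e′) ⟩
  2 ^ y                 ∎
  where
  open ≤-Reasoning
  e′ = suc e
  d = y ℕ./ e′
  2e<d : 2 * e′ < d
  2e<d = ≤-trans (≤-reflexive (trans (+-comm 1 (2 * e′)) (sym (m*n/n≡m (2 * e′ + 1) e′))))
    (/-monoˡ-≤ e′ (≤-trans (≤-reflexive (*-comm (2 * e′ + 1) e′)) h))
  y≤ : y ≤ e′ * suc d
  y≤ = begin
    y                     ≡⟨ m≡m%n+[m/n]*n y e′ ⟩
    y ℕ.% e′ + d * e′       ≤⟨ +-monoˡ-≤ (d * e′) (<⇒≤ (m%n<n y e′)) ⟩
    e′ + d * e′           ≡⟨ *-comm (suc d) e′ ⟩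
    e′ * suc d            ∎

-- α may be irrational and is known only through comparisons of its powers with integers. Raising αr
-- ≤ T to the q-th power eliminates it.
ratio-bound : ∀ α q {U V r T P} → 0ᵣ ≼ α → 0 < P → fromℕ U ≼ α ^ᵣ q *ᵣ fromℕ V →
  α *ᵣ fromℕ (r * P) ≼ fromℕ (T * P) → U * r ^ q ≤ T ^ q * V
ratio-bound α q {U} {V} {r} {T} {P} 0≼α P>0 U≼ h = *-cancelʳ-≤ _ _ (P ^ q) {{m^n≢0 P q {{>-nonZero P>0}}}} (begin
  U * r ^ q * P ^ q       ≡⟨ trans (*-assoc U (r ^ q) (P ^ q)) (cong (U *_) (sym (^-distribʳ-* r P q))) ⟩
  U * (r * P) ^ q         ≤⟨ fromℕ-cancel real ⟩
  (T * P) ^ q * V         ≡⟨ trans (cong (_* V) (^-distribʳ-* T P q)) (lem (T ^ q) (P ^ q) V) ⟩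
  T ^ q * V * P ^ q       ∎)
  where
  open ≤-Reasoning
  lem : ∀ a b c → a * b * c ≡ a * c * b
  lem = solve-∀
  real : fromℕ (U * (r * P) ^ q) ≼ fromℕ ((T * P) ^ q * V)
  real = ≼-R.begin
    fromℕ (U * (r * P) ^ q)                               ≼-R.≈⟨ ≋-trans (fromℕ-* U _) (*ᵣ-cong ≋-refl (fromℕ-^ (r * P) q)) ⟩
    fromℕ U *ᵣ fromℕ (r * P) ^ᵣ q                         ≼-R.≲⟨ *ᵣ-monoˡ (0≼^ q (0≼fromℕ (r * P))) U≼ ⟩
    α ^ᵣ q *ᵣ fromℕ V *ᵣ fromℕ (r * P) ^ᵣ q               ≼-R.≈⟨ ≋-trans (*ᵣ-assoc _ _ _) (≋-trans (*ᵣ-cong ≋-refl (*ᵣ-comm (fromℕ V) _)) (≋-sym (*ᵣ-assoc _ _ _))) ⟩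
    α ^ᵣ q *ᵣ fromℕ (r * P) ^ᵣ q *ᵣ fromℕ V               ≼-R.≈⟨ *ᵣ-cong (≋-sym (*ᵣ-^ α (fromℕ (r * P)) q)) ≋-refl ⟩
    (α *ᵣ fromℕ (r * P)) ^ᵣ q *ᵣ fromℕ V                  ≼-R.≲⟨ *ᵣ-monoˡ (0≼fromℕ V) (^ᵣ-mono q (0≼* 0≼α (0≼fromℕ (r * P))) h) ⟩
    fromℕ (T * P) ^ᵣ q *ᵣ fromℕ V                         ≼-R.≈⟨ ≋-trans (*ᵣ-cong (≋-sym (fromℕ-^ (T * P) q)) ≋-refl) (≋-sym (fromℕ-* ((T * P) ^ q) V)) ⟩
    fromℕ ((T * P) ^ q * V)                               ≼-R.∎
    where import Relation.Binary.Reasoning.Preorder ≼-preorder as ≼-R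

module Scaled (a ℓ : ℕ) (a>0 : 0 < a) where
  open Core a ℓ a>0

  not-optimizable-scaled : ∀ {n y z m K : ℕ} (𝓕 : Class) (D : Distribution n) (α δ : ℝ) →
    3 ≤ y → 0 < z →
    K * suc m * y ^ (3 * a) ≤ z ^ suc (suc ℓ) → K * suc m * y ^ (3 * a) ≤ 2 ^ y →
    y ^ (5 * a + 3) * z ≤ n →
    (∀ (f : SetFunction n) u → u ≤ y ^ a * (y ^ a * y ^ a) * (y ^ a * (q * (y ^ a * y ^ a)) ^ s) → IsCoverageOver u f → 𝓕 f) →
    0ᵣ ≼ α → 0ᵣ ≼ δ → fromℕ 4 ≼ fromℕ K *ᵣ (1ᵣ -ᵣ δ) →
    (∀ P → 0 < P → ¬ (α *ᵣ fromℕ (y ^ a * P) ≼ fromℕ (K * (c * y) * P))) →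
    ¬ OptimizableAt 𝓕 D (y ^ a * y ^ a) m α δ
  not-optimizable-scaled {n} {y} {z} {m} {K} 𝓕 D α δ 3≤y z>0 dense expo fits inClass 0≼α 0≼δ 4≼ gap =
    -- With w = 2kyz the powers of 2ky in the density condition cancel, which leaves κr ≤ z^(ℓ+2).
    not-optimizable {n} {y} {2 * k * y * z} {m} {K} 𝓕 D α δ y>0 w>0 dense′
      (≤-trans (≤-reflexive (cong (κ *_) rk≡)) expo) fits′ inClass 0≼α 0≼δ 4≼ gap
    where
    open ≤-Reasoning
    r = y ^ a
    k = r * r
    κ = K * suc m
    e = suc (suc ℓ)
    y>0 : 0 < y
    y>0 = ≤-trans (s≤s z≤n) 3≤y
    r>0 : 0 < r
    r>0 = m^n>0 y {{>-nonZero y>0}} a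
    kyz>0 : 0 < k * y * z
    kyz>0 = *-mono-≤ (*-mono-≤ (*-mono-≤ r>0 r>0) y>0) z>0
    w>0 : 0 < 2 * k * y * z
    w>0 = ≤-trans kyz>0 (*-monoˡ-≤ z (*-monoˡ-≤ y (m≤m+n k _)))
    rk≡ : r * k ≡ y ^ (3 * a)
    rk≡ = trans (lem r) (trans (^-*-assoc y a 3) (cong (y ^_) (*-comm a 3)))
      where
      lem : ∀ r → r * (r * r) ≡ r * (r * (r * 1))
      lem = solve-∀
    dense′ : κ * (r * (2 * k * y) ^ e) ≤ (2 * k * y * z) ^ e
    dense′ = begin
      κ * (r * (2 * k * y) ^ e)        ≡⟨ *-assoc κ r _ ⟨
      κ * r * (2 * k * y) ^ e          ≤⟨ *-monoˡ-≤ ((2 * k * y) ^ e) (≤-trans (*-monoʳ-≤ κ (≤-trans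
                                            (m≤m*n r k {{>-nonZero (*-mono-≤ r>0 r>0)}}) (≤-reflexive rk≡))) dense) ⟩
      z ^ e * (2 * k * y) ^ e          ≡⟨ trans (*-comm (z ^ e) _) (sym (^-distribʳ-* (2 * k * y) z e)) ⟩
      (2 * k * y * z) ^ e              ∎
    -- r · k · w · y is of order r⁵y²z; a further factor y absorbs the constant 3. This is the
    -- exponent 5a + 3.
    fits′ : r * k * suc (2 * k * y * z) * y ≤ n
    fits′ = begin
      r * k * suc (2 * k * y * z) * y           ≤⟨ *-monoˡ-≤ y (*-monoʳ-≤ (r * k) (+-monoˡ-≤ (2 * k * y * z) kyz>0)) ⟩
      r * k * (k * y * z + 2 * k * y * z) * y   ≡⟨ lem₁ r y z ⟩
      3 * (r ^ 5 * y ^ 2 * z)                   ≤⟨ *-monoˡ-≤ (r ^ 5 * y ^ 2 * z) 3≤y ⟩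
      y * (r ^ 5 * y ^ 2 * z)                   ≡⟨ lem₂ y (r ^ 5) z ⟩
      r ^ 5 * y ^ 3 * z                         ≡⟨ cong (λ p → p * y ^ 3 * z) (trans (^-*-assoc y a 5) (cong (y ^_) (*-comm a 5))) ⟩
      y ^ (5 * a) * y ^ 3 * z                   ≡⟨ cong (_* z) (^-distribˡ-+-* y (5 * a) 3) ⟨
      y ^ (5 * a + 3) * z                       ≤⟨ fits ⟩
      n                                         ∎
      where
      lem₁ : ∀ r y z → r * (r * r) * (r * r * y * z + 2 * (r * r) * y * z) * y ≡ 3 * (r * (r * (r * (r * (r * 1)))) * (y * (y * 1)) * z)
      lem₁ = solve-∀
      lem₂ : ∀ y R z → y * (R * (y * (y * 1)) * z) ≡ R * (y * (y * (y * 1))) * z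
      lem₂ = solve-∀

<ᵣ⇒≼ : ∀ {x y} → x <ᵣ y → x ≼ y
<ᵣ⇒≼ {x} (e , 0<e , M , h) = mk≼ λ ε 0<ε → M , λ n M≤n →
  ℚ-slack (ℚ.≤-trans (ℚ-slack ℚ.≤-refl 0<e) (h n M≤n)) 0<ε

-- Order on the reals is undecidable, but one term x_N of a Cauchy tail can be compared with q +
-- ε/2. If it is below, the tail stays below q + ε; if above, the tail stays above q, which is
-- excluded.
≰ᵣ⇒≽ : ∀ x q → ¬ (fromℚ q ≼ x) → x ≼ fromℚ q
≰ᵣ⇒≽ x q ≰ = mk≼ λ ε 0<ε → go ε 0<ε (cauchy x (½ ℚ.* ε) (0<½* 0<ε))
  where
  open ℚ.≤-Reasoning
  open +-*-Solver using (solve; _:=_; _:+_; _:-_; :-_)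
  go : ∀ ε → 0ℚ ℚ.< ε → ∃[ N ] (∀ m n → N ≤ m → N ≤ n → ℚ.∣ seq x m ℚ.- seq x n ∣ ℚ.≤ ½ ℚ.* ε) →
    ∃[ N ] (∀ n → N ≤ n → seq x n ℚ.≤ q ℚ.+ ε)
  go ε 0<ε (N , h) with seq x N ℚ.≤? q ℚ.+ ½ ℚ.* ε
  ... | yes le = N , λ n N≤n → begin
    seq x n                                  ≡⟨ solve 2 (λ a b → a := b :+ (a :- b)) refl (seq x n) (seq x N) ⟩
    seq x N ℚ.+ (seq x n ℚ.- seq x N)        ≤⟨ ℚ.+-mono-≤ le (ℚ.≤-trans (p≤∣p∣ _) (h n N N≤n ≤-refl)) ⟩
    q ℚ.+ ½ ℚ.* ε ℚ.+ ½ ℚ.* ε                ≡⟨ trans (ℚ.+-assoc q _ _) (cong (q ℚ.+_) (halve ε)) ⟩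
    q ℚ.+ ε                                  ∎
  ... | no gt = contradiction (mk≼ λ ε′ 0<ε′ → N , λ n N≤n → ℚ-slack (begin
    q                                        ≡⟨ solve 2 (λ q e → q := q :+ e :- e) refl q (½ ℚ.* ε) ⟩
    q ℚ.+ ½ ℚ.* ε ℚ.- ½ ℚ.* ε                ≤⟨ ℚ.+-mono-≤ (ℚ.<⇒≤ (ℚ.≰⇒> gt)) (ℚ.neg-antimono-≤ (ℚ.≤-trans (p≤∣p∣ _) (h N n ≤-refl N≤n))) ⟩
    seq x N ℚ.- (seq x N ℚ.- seq x n)        ≡⟨ solve 2 (λ a b → a :- (a :- b) := b) refl (seq x N) (seq x n) ⟩
    seq x n                                  ∎) 0<ε′) ≰

-- The 4 exceeds the number of error terms (three) in Averaging.
slack : ∀ {δ} → δ <ᵣ 1ᵣ → ∃[ K ] (fromℕ 4 ≼ fromℕ K *ᵣ (1ᵣ -ᵣ δ))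
slack {δ} δ<1 = let (K , _ , h) = archimedean {δ} {1ᵣ} δ<1 in 4 * K , (begin
  fromℕ 4                               ≈⟨ ≋-sym (*ᵣ-identityʳ (fromℕ 4)) ⟩
  fromℕ 4 *ᵣ 1ᵣ                         ≲⟨ *ᵣ-monoʳ (0≼fromℕ 4) h ⟩
  fromℕ 4 *ᵣ (fromℕ K *ᵣ (1ᵣ -ᵣ δ))     ≈⟨ ≋-trans (≋-sym (*ᵣ-assoc _ _ _)) (*ᵣ-cong (≋-sym (fromℕ-* 4 K)) ≋-refl) ⟩
  fromℕ (4 * K) *ᵣ (1ᵣ -ᵣ δ)            ∎)
  where open import Relation.Binary.Reasoning.Preorder ≼-preorder

power-lower : ∀ {b x α} q u v → IsPower b x α → fromℕ u ≼ fromℕ q *ᵣ x +ᵣ fromℕ v →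
  fromℕ (b ^ u) ≼ α ^ᵣ q *ᵣ fromℕ (b ^ v)
power-lower {b} {x} {α} q u v (_ , h) le = ≼-trans (≋⇒≼ (fromℕ-^ b u))
  (≼-trans (mk≼ (proj₁ (h q u v) (_≼_.un≼ le))) (≋⇒≼ (*ᵣ-cong ≋-refl (≋-sym (fromℕ-^ b v)))))

sample-bound : ∀ K m n cₘ → 0 < n → m ≤ n ^ cₘ → K * suc m ≤ 2 * K * n ^ cₘ
sample-bound K m n cₘ n>0 m≤ = ≤-trans (*-monoʳ-≤ K (+-mono-≤ (m^n>0 n {{>-nonZero n>0}} cₘ) m≤))
  (≤-reflexive (lem K (n ^ cₘ)))
  where
  lem : ∀ K x → K * (x + x) ≡ 2 * K * x
  lem = solve-∀

-- Here r = y^N with 1/N ≤ ε and y = ⌊n^(1/Q)⌋.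
module Polynomial (ε : ℝ) (0<ε : 0ᵣ <ᵣ ε) where

  N₀ N Q : ℕ
  N₀ = proj₁ (archimedean {0ᵣ} {ε} 0<ε)
  -- N ≥ 5 allows n^N to be split as n^5 n^(N₀) when ratios are compared. Below, Q is the exponent
  -- 5N + 3 plus one for z = y.
  N = 5 + N₀
  Q = 5 * N + 4

  1≼Nε : 1ᵣ ≼ fromℕ N *ᵣ ε
  1≼Nε = begin
    1ᵣ                         ≲⟨ proj₂ (proj₂ (archimedean {0ᵣ} {ε} 0<ε)) ⟩
    fromℕ N₀ *ᵣ (ε -ᵣ 0ᵣ)      ≈⟨ *ᵣ-cong ≋-refl (mk≋ λ n → ℚ.+-identityʳ (seq ε n)) ⟩
    fromℕ N₀ *ᵣ ε              ≲⟨ *ᵣ-monoˡ (<ᵣ⇒≼ {0ᵣ} {ε} 0<ε) (fromℕ-mono (m≤n+m N₀ 5)) ⟩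
    fromℕ N *ᵣ ε               ∎
    where open import Relation.Binary.Reasoning.Preorder ≼-preorder

  open Inverse (_^ Q) (λ x → ^-monoˡ-< Q {{>-nonZero (≤-trans (s≤s z≤n) (m≤n+m 4 (5 * N)))}} (n<1+n x))
    (≤-trans (≤-reflexive (cong (0 ^_) (+-comm (5 * N) 4))) z≤n)

  root k : ℕ → ℕ
  root = inverse (_^ Q)
  k n = root n ^ N * root n ^ N

  -- 5N (-1/5 + ε) + N = 5Nε ≥ 5. Thus α^(5N) n^N ≥ n^5, that is, α ≥ n^(-1/5 + 1/N).
  exponent : fromℕ 5 ≼ fromℕ (5 * N) *ᵣ ((-ᵣ fromℚ (+ 1 / 5)) +ᵣ ε) +ᵣ fromℕ N
  exponent = begin
    fromℕ 5                         ≈⟨ ≋-sym (*ᵣ-identityʳ (fromℕ 5)) ⟩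
    fromℕ 5 *ᵣ 1ᵣ                   ≲⟨ *ᵣ-monoʳ (0≼fromℕ 5) 1≼Nε ⟩
    fromℕ 5 *ᵣ (fromℕ N *ᵣ ε)       ≈⟨ mk≋ (λ n → sym (trans (cong (λ z → z ℚ.* (ℚ.- (+ 1 / 5) ℚ.+ seq ε n) ℚ.+ (+ N / 1)) (/1-* 5 N))
                                         (trans (solve 4 (λ F M f e → (F :* M) :* (:- f :+ e) :+ M := F :* (M :* e) :+ M :* (con 1ℚ :- F :* f)) refl
                                                   (+ 5 / 1) (+ N / 1) (+ 1 / 5) (seq ε n))
                                           (trans (cong ((+ 5 / 1) ℚ.* ((+ N / 1) ℚ.* seq ε n) ℚ.+_) (ℚ.*-zeroʳ (+ N / 1))) (ℚ.+-identityʳ ((+ 5 / 1) ℚ.* ((+ N / 1) ℚ.* seq ε n))))))) ⟩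
    fromℕ (5 * N) *ᵣ ((-ᵣ fromℚ (+ 1 / 5)) +ᵣ ε) +ᵣ fromℕ N ∎
    where
    open import Relation.Binary.Reasoning.Preorder ≼-preorder
    open +-*-Solver using (solve; _:=_; _:+_; _:-_; _:*_; :-_; con)

  hard : NotOptimizable Coverage k (λ n α → IsPower n ((-ᵣ fromℚ (+ 1 / 5)) +ᵣ ε) α)
  hard m (cₘ , n₁ , m≤) δ 0≤δ δ<1 = y₀ ^ Q + n₁ , λ n n₀≤n α isPower D →
    let y        = root n
        n>0      = ≤-trans (≤-trans (m^n>0 y₀ Q) (m≤m+n (y₀ ^ Q) n₁)) n₀≤n
        y₀≤y     = inverse-grows y₀ n (≤-trans (m≤m+n (y₀ ^ Q) n₁) n₀≤n)
        n≤2y^Q   = upper {n} {y} (≤-trans (s≤s z≤n) y₀≤y) (<⇒≤ (inverse-upper n))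
        few      = sampled n y n>0 y₀≤y n≤2y^Q (m≤ n (≤-trans (m≤n+m n₁ (y₀ ^ Q)) n₀≤n))
    in not-optimizable-scaled {n} {y} {y} {m n} {K} Coverage D α δ
        (≤-trans (m≤m+n 3 _) y₀≤y) (≤-trans (s≤s z≤n) y₀≤y)
        few (≤-trans few (polynomial≤exponential (suc ℓ) y (≤-trans y₁≤y₀ y₀≤y)))
        (≤-trans (≤-reflexive (lemQ y)) (inverse-lower n n>0))
        (λ f u _ cov → u , cov) (mk≼ (proj₁ isPower)) (mk≼ 0≤δ) (proj₂ (slack {δ} δ<1))
        (λ P P>0 h → contradiction
          (ratio-bound α (5 * N) {n ^ 5} {n ^ N} {y ^ N} {K * (c * y)} {P} (mk≼ (proj₁ isPower)) P>0
            (power-lower {n} {(-ᵣ fromℚ (+ 1 / 5)) +ᵣ ε} {α} (5 * N) 5 N isPower exponent) h)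
          (<⇒≱ (ratio< n y n>0 (≤-trans (s≤s z≤n) y₀≤y) (≤-trans Θ<y₀ y₀≤y) n≤2y^Q)))
    where
    open ≤-Reasoning
    K = proj₁ (slack {δ} δ<1)
    -- n ≤ (2y)^Q ≤ y^(2Q), so the samples cost y^(2Q cₘ) and the labels y^(3N). Of the two further
    -- factors y in y^(ℓ+2), one absorbs 2K.
    ℓ = 2 * Q * cₘ + 3 * N
    open Core N ℓ (s≤s z≤n) using (c)
    open Scaled N ℓ (s≤s z≤n)
    Θ = (K * c) ^ (5 * N) * 2 ^ (Q * N₀)
    y₁ = suc (suc ℓ) * (2 * suc (suc ℓ) + 1)
    y₀ = 3 + (2 * K + (y₁ + Θ))
    y₁≤y₀ : y₁ ≤ y₀
    y₁≤y₀ = ≤-trans (m≤m+n y₁ Θ) (≤-trans (m≤n+m (y₁ + Θ) (2 * K)) (m≤n+m _ 3))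
    Θ<y₀ : Θ < y₀
    Θ<y₀ = ≤-trans (s≤s (≤-trans (m≤n+m Θ y₁) (m≤n+m (y₁ + Θ) (2 * K)))) (m≤n+m _ 2)
    upper : ∀ {n y} → 0 < y → n ≤ suc y ^ Q → n ≤ (2 * y) ^ Q
    upper {n} {y} y>0 h = ≤-trans h (^-monoˡ-≤ Q (≤-trans (+-monoˡ-≤ y y>0) (≤-reflexive (cong (λ z → y + z) (sym (+-identityʳ y))))))
    lemQ : ∀ y → y ^ (5 * N + 3) * y ≡ y ^ Q
    lemQ y = trans (*-comm _ y) (cong (y ^_) (sym (+-suc (5 * N) 3)))
    sampled : ∀ n y → 0 < n → y₀ ≤ y → n ≤ (2 * y) ^ Q → m n ≤ n ^ cₘ →
      K * suc (m n) * y ^ (3 * N) ≤ y ^ suc (suc ℓ)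
    sampled n y n>0 y₀≤y n≤ m≤ = begin
      K * suc (m n) * y ^ (3 * N)                  ≤⟨ *-monoˡ-≤ _ (sample-bound K (m n) n cₘ n>0 m≤) ⟩
      2 * K * n ^ cₘ * y ^ (3 * N)                 ≤⟨ *-monoˡ-≤ _ (*-mono-≤ 2K≤y (^-monoˡ-≤ cₘ n≤y)) ⟩
      y * (y ^ (2 * Q)) ^ cₘ * y ^ (3 * N)         ≡⟨ trans (*-assoc y _ _) (cong (y *_) (trans (cong (_* y ^ (3 * N)) (^-*-assoc y (2 * Q) cₘ))
                                                        (sym (^-distribˡ-+-* y (2 * Q * cₘ) (3 * N))))) ⟩
      y ^ suc ℓ                                    ≤⟨ ^-monoʳ-≤ y {{>-nonZero y>0}} (n≤1+n (suc ℓ)) ⟩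
      y ^ suc (suc ℓ)                              ∎
      where
      y>0 : 0 < y
      y>0 = ≤-trans (s≤s z≤n) y₀≤y
      2K≤y : 2 * K ≤ y
      2K≤y = ≤-trans (≤-trans (m≤m+n (2 * K) _) (m≤n+m _ 3)) y₀≤y
      n≤y : n ≤ y ^ (2 * Q)
      n≤y = ≤-trans n≤ (≤-trans (^-monoˡ-≤ Q (*-monoˡ-≤ y (≤-trans (s≤s (s≤s z≤n)) y₀≤y)))
        (≤-reflexive (trans (cong (_^ Q) (cong (y *_) (sym (*-identityʳ y)))) (^-*-assoc y 2 Q))))
    -- Up to constants n is y^Q, so the two sides are compared as powers of y. As 5N² = 5N + Q N₀ +
    -- 16N + 20, the right side has 16N + 20 factors to spare, and a single one beats the constant
    -- Θ.
    ratio< : ∀ n y → 0 < n → 0 < y → Θ < y → n ≤ (2 * y) ^ Q →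
      (K * (c * y)) ^ (5 * N) * n ^ N < n ^ 5 * (y ^ N) ^ (5 * N)
    ratio< n y n>0 y>0 Θ<y n≤ = begin-strict
      (K * (c * y)) ^ (5 * N) * n ^ N
        ≡⟨ cong₂ _*_ (trans (cong (_^ (5 * N)) (sym (*-assoc K c y))) (^-distribʳ-* (K * c) y (5 * N))) (^-distribˡ-+-* n 5 N₀) ⟩
      (K * c) ^ (5 * N) * y ^ (5 * N) * (n ^ 5 * n ^ N₀)
        ≤⟨ *-monoʳ-≤ ((K * c) ^ (5 * N) * y ^ (5 * N)) (*-monoʳ-≤ (n ^ 5) n^≤) ⟩
      (K * c) ^ (5 * N) * y ^ (5 * N) * (n ^ 5 * (2 ^ (Q * N₀) * y ^ (Q * N₀)))
        ≡⟨ lem₁ ((K * c) ^ (5 * N)) (y ^ (5 * N)) (n ^ 5) (2 ^ (Q * N₀)) (y ^ (Q * N₀)) ⟩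
      n ^ 5 * (y ^ (5 * N) * y ^ (Q * N₀) * Θ)
        <⟨ *-monoʳ-< (n ^ 5) {{m^n≢0 n 5 {{>-nonZero n>0}}}} (*-monoʳ-< (y ^ (5 * N) * y ^ (Q * N₀)) {{m*n≢0 _ _ {{m^n≢0 y (5 * N) {{>-nonZero y>0}}}} {{m^n≢0 y (Q * N₀) {{>-nonZero y>0}}}}}} Θ<y) ⟩
      n ^ 5 * (y ^ (5 * N) * y ^ (Q * N₀) * y)
        ≤⟨ *-monoʳ-≤ (n ^ 5) (*-monoʳ-≤ (y ^ (5 * N) * y ^ (Q * N₀)) (m≤m*n y (y ^ (16 * N + 19)) {{m^n≢0 y (16 * N + 19) {{>-nonZero y>0}}}})) ⟩
      n ^ 5 * (y ^ (5 * N) * y ^ (Q * N₀) * y ^ suc (16 * N + 19))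
        ≡⟨ cong (n ^ 5 *_) (trans (cong (_* y ^ suc (16 * N + 19)) (sym (^-distribˡ-+-* y (5 * N) (Q * N₀))))
             (sym (^-distribˡ-+-* y (5 * N + Q * N₀) (suc (16 * N + 19))))) ⟩
      n ^ 5 * y ^ (5 * N + Q * N₀ + suc (16 * N + 19))
        ≡⟨ cong (λ z → n ^ 5 * y ^ z) (lem₂ N₀) ⟨
      n ^ 5 * y ^ (N * (5 * N))
        ≡⟨ cong (n ^ 5 *_) (^-*-assoc y N (5 * N)) ⟨
      n ^ 5 * (y ^ N) ^ (5 * N) ∎
      where
      n^≤ : n ^ N₀ ≤ 2 ^ (Q * N₀) * y ^ (Q * N₀)
      n^≤ = ≤-trans (^-monoˡ-≤ N₀ n≤) (≤-reflexive (trans (^-*-assoc (2 * y) Q N₀) (^-distribʳ-* 2 y (Q * N₀))))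
      lem₁ : ∀ A B C D E → A * B * (C * (D * E)) ≡ C * (B * E * (A * D))
      lem₁ = solve-∀
      lem₂ : ∀ N₀ → (5 + N₀) * (5 * (5 + N₀)) ≡ 5 * (5 + N₀) + (5 * (5 + N₀) + 4) * N₀ + suc (16 * (5 + N₀) + 19)
      lem₂ = solve-∀

-- Here r = y² with y = 2^x and x = ⌊√(log₂ n)⌋.
module Subpolynomial where

  open Inverse (λ x → 2 ^ (x * x))
    (λ x → ^-monoʳ-< 2 (s≤s (s≤s z≤n)) (*-mono-< (n<1+n x) (n<1+n x))) ≤-refl

  √log k : ℕ → ℕ
  √log = inverse (λ x → 2 ^ (x * x))
  k n = (2 ^ √log n) ^ 2 * (2 ^ √log n) ^ 2

  -- x ≤ s would give 2^(x²) ≤ n. This refutes the lower bound, and `≰ᵣ⇒≽` turns the refutation into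
  -- the upper bound.
  sqrt-log≤ : ∀ n x s → n < 2 ^ (x * x) → IsSqrtLog₂ n s → s ≼ fromℕ x
  sqrt-log≤ n x s n< (0≤s , isPower) = ≰ᵣ⇒≽ s (+ x / 1) λ x≼s →
    <⇒≱ n< (fromℕ-cancel (begin
      fromℕ (2 ^ (x * x))                  ≲⟨ power-lower {2} {s *ᵣ s} {fromℕ n} 1 (x * x) 0 isPower (square x≼s) ⟩
      fromℕ n ^ᵣ 1 *ᵣ fromℕ (2 ^ 0)        ≈⟨ ≋-trans (*ᵣ-identityʳ _) (*ᵣ-identityʳ (fromℕ n)) ⟩
      fromℕ n                              ∎))
    where
    open import Relation.Binary.Reasoning.Preorder ≼-preorder
    square : fromℕ x ≼ s → fromℕ (x * x) ≼ fromℕ 1 *ᵣ (s *ᵣ s) +ᵣ fromℕ 0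
    square x≼s = begin
      fromℕ (x * x)                        ≈⟨ fromℕ-* x x ⟩
      fromℕ x *ᵣ fromℕ x                   ≲⟨ *ᵣ-mono (0≼fromℕ x) (mk≼ 0≤s) x≼s x≼s ⟩
      s *ᵣ s                               ≈⟨ ≋-sym (≋-trans (+ᵣ-identityʳ _) (*ᵣ-identityˡ (s *ᵣ s))) ⟩
      fromℕ 1 *ᵣ (s *ᵣ s) +ᵣ fromℕ 0       ∎

  -- Read through `IsPower`, this says α² 2^x ≥ 1: the irrational exponent is replaced by an integer
  -- at the cost of rounding s up.
  exponent : ∀ x s → s ≼ fromℕ x → fromℕ 0 ≼ fromℕ 2 *ᵣ (-ᵣ (fromℚ ½ *ᵣ s)) +ᵣ fromℕ x
  exponent x s s≼x = begin
    fromℕ 0                                       ≈⟨ ≋-sym (+ᵣ-inverseʳ s) ⟩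
    s -ᵣ s                                        ≲⟨ +ᵣ-mono s≼x ≼-refl ⟩
    fromℕ x -ᵣ s                                  ≈⟨ mk≋ (λ n → trans (cong (λ z → (+ x / 1) ℚ.- z) (sym (ℚ.*-identityˡ (seq s n))))
                                                       (solve 4 (λ Θ a b s → Θ :- (a :* b) :* s := a :* (:- (b :* s)) :+ Θ) refl (+ x / 1) (+ 2 / 1) ½ (seq s n))) ⟩
    fromℕ 2 *ᵣ (-ᵣ (fromℚ ½ *ᵣ s)) +ᵣ fromℕ x     ∎
    where
    open import Relation.Binary.Reasoning.Preorder ≼-preorder
    open +-*-Solver using (solve; _:=_; _:+_; _:-_; _:*_; :-_)

  module Parameters (K cₘ : ℕ) where
    open ≤-Reasoning
    -- n ≤ 2^((x+1)²) ≤ 2^(4x²), so the samples cost 4 cₘ x² in the exponent; 2K and y^6 add 7x ≤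
    -- 7x². Since z = y^(x-13) has x - 13 ≥ x/2, it suffices that ℓ + 2 = 2G. The 13 is 5a + 3 for a
    -- = 2.
    G = 4 * cₘ + 7
    ℓ = 8 * cₘ + 12
    open Core 2 ℓ (s≤s z≤n) using (c; q; s)
    Θ = 2 * (K * c) ^ 2
    E = 8 + 5 * s

    abstract
      x₀ : ℕ
      x₀ = 26 + (2 * K + (G + (E + (q + Θ))))
      26≤x₀ : 26 ≤ x₀
      26≤x₀ = m≤m+n 26 _
      2K≤x₀ : 2 * K ≤ x₀
      2K≤x₀ = ≤-trans (m≤m+n (2 * K) _) (m≤n+m _ 26)
      G≤x₀ : G ≤ x₀
      G≤x₀ = ≤-trans (m≤m+n G _) (≤-trans (m≤n+m _ (2 * K)) (m≤n+m _ 26))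
      E≤x₀ : E ≤ x₀
      E≤x₀ = ≤-trans (m≤m+n E _) (≤-trans (m≤n+m _ G) (≤-trans (m≤n+m _ (2 * K)) (m≤n+m _ 26)))
      q≤x₀ : q ≤ x₀
      q≤x₀ = ≤-trans (m≤m+n q Θ) (≤-trans (m≤n+m _ E) (≤-trans (m≤n+m _ G) (≤-trans (m≤n+m _ (2 * K)) (m≤n+m _ 26))))
      Θ<x₀ : Θ < x₀
      Θ<x₀ = ≤-trans (s≤s (≤-trans (m≤n+m Θ q) (≤-trans (m≤n+m _ E) (≤-trans (m≤n+m _ G) (m≤n+m _ (2 * K)))))) (m≤n+m _ 25)

    sampled : ∀ n x m → 0 < n → x₀ ≤ x → n ≤ 2 ^ (suc x * suc x) → m ≤ n ^ cₘ →
      K * suc m * (2 ^ x) ^ (3 * 2) ≤ 2 ^ (G * (x * x))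
    sampled n x m n>0 x₀≤x n≤ m≤ = begin
      K * suc m * (2 ^ x) ^ 6
        ≤⟨ *-monoˡ-≤ ((2 ^ x) ^ 6) (sample-bound K m n cₘ n>0 m≤) ⟩
      2 * K * n ^ cₘ * (2 ^ x) ^ 6
        ≤⟨ *-mono-≤ (*-mono-≤ (≤-trans 2K≤x₀ (≤-trans x₀≤x (n≤2^n x))) (^-monoˡ-≤ cₘ (≤-trans n≤ (^-monoʳ-≤ 2 square≤)))) (≤-reflexive (^-*-assoc 2 x 6)) ⟩
      2 ^ x * (2 ^ (4 * (x * x))) ^ cₘ * 2 ^ (x * 6)
        ≡⟨ cong (λ z → 2 ^ x * z * 2 ^ (x * 6)) (^-*-assoc 2 (4 * (x * x)) cₘ) ⟩
      2 ^ x * 2 ^ (4 * (x * x) * cₘ) * 2 ^ (x * 6)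
        ≡⟨ trans (cong (_* 2 ^ (x * 6)) (sym (^-distribˡ-+-* 2 x (4 * (x * x) * cₘ)))) (sym (^-distribˡ-+-* 2 (x + 4 * (x * x) * cₘ) (x * 6))) ⟩
      2 ^ (x + 4 * (x * x) * cₘ + x * 6)
        ≤⟨ ^-monoʳ-≤ 2 (≤-trans (≤-reflexive (lem₁ x (x * x) cₘ)) (≤-trans (+-monoʳ-≤ (4 * (x * x) * cₘ) (*-monoʳ-≤ 7 x≤xx)) (≤-reflexive (lem₂ (x * x) cₘ)))) ⟩
      2 ^ (G * (x * x)) ∎
      where
      x>0 : 0 < x
      x>0 = ≤-trans (≤-trans (s≤s z≤n) 26≤x₀) x₀≤x
      x≤xx : x ≤ x * x
      x≤xx = m≤m*n x x {{>-nonZero x>0}}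
      square≤ : suc x * suc x ≤ 4 * (x * x)
      square≤ = ≤-trans (*-mono-≤ (+-monoˡ-≤ x x>0) (+-monoˡ-≤ x x>0)) (≤-reflexive (lem₃ x))
        where
        lem₃ : ∀ x → (x + x) * (x + x) ≡ 4 * (x * x)
        lem₃ = solve-∀
      lem₁ : ∀ x y c → x + 4 * y * c + x * 6 ≡ 4 * y * c + 7 * x
      lem₁ = solve-∀
      lem₂ : ∀ y c → 4 * y * c + 7 * y ≡ (4 * c + 7) * y
      lem₂ = solve-∀

    spread : ∀ x → x₀ ≤ x → 2 ^ (G * (x * x)) ≤ ((2 ^ x) ^ (x ∸ 13)) ^ suc (suc ℓ)
    spread x x₀≤x = begin
      2 ^ (G * (x * x))                          ≤⟨ ^-monoʳ-≤ 2 (*-monoʳ-≤ G (*-monoʳ-≤ x x≤)) ⟩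
      2 ^ (G * (x * (2 * (x ∸ 13))))             ≡⟨ cong (2 ^_) (lem cₘ x (x ∸ 13)) ⟩
      2 ^ (x * (x ∸ 13) * suc (suc ℓ))           ≡⟨ trans (cong (_^ suc (suc ℓ)) (^-*-assoc 2 x (x ∸ 13))) (^-*-assoc 2 (x * (x ∸ 13)) (suc (suc ℓ))) ⟨
      ((2 ^ x) ^ (x ∸ 13)) ^ suc (suc ℓ)         ∎
      where
      26≤x : 26 ≤ x
      26≤x = ≤-trans 26≤x₀ x₀≤x
      x≡ : 13 + (x ∸ 13) ≡ x
      x≡ = m+[n∸m]≡n (≤-trans (m≤m+n 13 13) 26≤x)
      x≤ : x ≤ 2 * (x ∸ 13)
      x≤ = begin
        x                       ≡⟨ x≡ ⟨
        13 + (x ∸ 13)           ≤⟨ +-monoˡ-≤ (x ∸ 13) (∸-monoˡ-≤ 13 26≤x) ⟩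
        (x ∸ 13) + (x ∸ 13)     ≡⟨ cong (λ z → (x ∸ 13) + z) (sym (+-identityʳ (x ∸ 13))) ⟩
        2 * (x ∸ 13)            ∎
      lem : ∀ c x y → (4 * c + 7) * (x * (2 * y)) ≡ x * y * (2 + (8 * c + 12))
      lem = solve-∀

    -- The exponential condition compares 2^(G x²) with 2^y for y = 2^x, so only the exponents need
    -- comparing.
    cubic : ∀ x → x₀ ≤ x → G * (x * x) ≤ 2 ^ x
    cubic x x₀≤x = begin
      G * (x * x)    ≤⟨ *-monoˡ-≤ (x * x) (≤-trans G≤x₀ x₀≤x) ⟩
      x * (x * x)    ≡⟨ cong (λ z → x * (x * z)) (*-identityʳ x) ⟨
      x ^ 3          ≤⟨ polynomial≤exponential 2 x (≤-trans (≤-trans (m≤m+n 21 5) 26≤x₀) x₀≤x) ⟩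
      2 ^ x          ∎

    fits : ∀ x → x₀ ≤ x → (2 ^ x) ^ 13 * (2 ^ x) ^ (x ∸ 13) ≡ 2 ^ (x * x)
    fits x x₀≤x = trans (sym (^-distribˡ-+-* (2 ^ x) 13 (x ∸ 13)))
      (trans (cong ((2 ^ x) ^_) (m+[n∸m]≡n (≤-trans (≤-trans (m≤m+n 13 13) 26≤x₀) x₀≤x))) (^-*-assoc 2 x x))

    -- s is a constant, so the family has size at most y^E with E fixed, while y^x = 2^(x²) is at
    -- most n.
    sized : ∀ x → x₀ ≤ x →
      (2 ^ x) ^ 2 * ((2 ^ x) ^ 2 * (2 ^ x) ^ 2) * ((2 ^ x) ^ 2 * (q * ((2 ^ x) ^ 2 * (2 ^ x) ^ 2)) ^ s) ≤ 2 ^ (x * x)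
    sized x x₀≤x = begin
      b ^ 2 * (b ^ 2 * b ^ 2) * (b ^ 2 * (q * (b ^ 2 * b ^ 2)) ^ s)
        ≤⟨ *-monoʳ-≤ (b ^ 2 * (b ^ 2 * b ^ 2)) (*-monoʳ-≤ (b ^ 2) (^-monoˡ-≤ s (*-monoˡ-≤ (b ^ 2 * b ^ 2) (≤-trans q≤x₀ (≤-trans x₀≤x (n≤2^n x)))))) ⟩
      b ^ 2 * (b ^ 2 * b ^ 2) * (b ^ 2 * (b * (b ^ 2 * b ^ 2)) ^ s)
        ≡⟨ cong (λ z → b ^ 2 * (b ^ 2 * b ^ 2) * (b ^ 2 * z ^ s)) (lem₁ b) ⟩
      b ^ 2 * (b ^ 2 * b ^ 2) * (b ^ 2 * (b ^ 5) ^ s)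
        ≡⟨ trans (lem₂ b ((b ^ 5) ^ s)) (cong (b ^ 8 *_) (^-*-assoc b 5 s)) ⟩
      b ^ 8 * b ^ (5 * s)
        ≡⟨ ^-distribˡ-+-* b 8 (5 * s) ⟨
      b ^ E
        ≤⟨ ^-monoʳ-≤ b {{m^n≢0 2 x}} (≤-trans E≤x₀ x₀≤x) ⟩
      b ^ x
        ≡⟨ ^-*-assoc 2 x x ⟩
      2 ^ (x * x) ∎
      where
      b = 2 ^ x
      lem₁ : ∀ y → y * (y * (y * 1) * (y * (y * 1))) ≡ y * (y * (y * (y * (y * 1))))
      lem₁ = solve-∀
      lem₂ : ∀ y z → y * (y * 1) * (y * (y * 1) * (y * (y * 1))) * (y * (y * 1) * z) ≡ y * (y * (y * (y * (y * (y * (y * (y * 1))))))) * z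
      lem₂ = solve-∀

    -- r² is y⁴ and the left side is a constant times y³, where the third y comes from α² 2^(x+1) ≥
    -- 1.
    ratio< : ∀ x → Θ < x → (K * (c * 2 ^ x)) ^ 2 * 2 ^ suc x < 1 * ((2 ^ x) ^ 2) ^ 2
    ratio< x Θ<x = begin-strict
      (K * (c * b)) ^ 2 * (2 * b)      ≡⟨ lem₁ K c b ⟩
      b ^ 3 * Θ                        <⟨ *-monoʳ-< (b ^ 3) {{m^n≢0 b 3 {{m^n≢0 2 x}}}} (≤-trans Θ<x (n≤2^n x)) ⟩
      b ^ 3 * b                        ≡⟨ lem₂ b ⟩
      1 * (b ^ 2) ^ 2                  ∎
      where
      b = 2 ^ x
      lem₁ : ∀ K c y → K * (c * y) * (K * (c * y) * 1) * (2 * y) ≡ y * (y * (y * 1)) * (2 * (K * c * (K * c * 1)))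
      lem₁ = solve-∀
      lem₂ : ∀ y → y * (y * (y * 1)) * y ≡ 1 * (y * (y * 1) * (y * (y * 1) * 1))
      lem₂ = solve-∀

  hard : NotOptimizable (CoverageOfSize≤ (λ n → n)) k
    (λ n α → ∃[ s ] (IsSqrtLog₂ n s × IsPower 2 (-ᵣ (fromℚ ½ *ᵣ s)) α))
  hard m (cₘ , n₁ , m≤) δ 0≤δ δ<1 = 2 ^ (x₀ * x₀) + n₁ , λ n n₀≤n α (σ , isSqrt , isPower) D →
    let x        = √log n
        n>0      = ≤-trans (≤-trans (m^n>0 2 (x₀ * x₀)) (m≤m+n _ n₁)) n₀≤n
        x₀≤x     = inverse-grows x₀ n (≤-trans (m≤m+n _ n₁) n₀≤n)
        n<       = inverse-upper n
        few      = sampled n x (m n) n>0 x₀≤x (<⇒≤ n<) (m≤ n (≤-trans (m≤n+m n₁ _) n₀≤n))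
        lower    = inverse-lower n n>0
    in not-optimizable-scaled {n} {2 ^ x} {(2 ^ x) ^ (x ∸ 13)} {m n} {K} (CoverageOfSize≤ (λ n → n)) D α δ
        (≤-trans (≤-trans (≤-trans (m≤m+n 3 23) 26≤x₀) x₀≤x) (n≤2^n x)) (m^n>0 (2 ^ x) {{m^n≢0 2 x}} (x ∸ 13))
        (≤-trans few (spread x x₀≤x)) (≤-trans few (^-monoʳ-≤ 2 (cubic x x₀≤x)))
        (≤-trans (≤-reflexive (fits x x₀≤x)) lower)
        (λ f u u≤ cov → u , ≤-trans u≤ (≤-trans (sized x x₀≤x) lower) , cov)
        (mk≼ (proj₁ isPower)) (mk≼ 0≤δ) (proj₂ (slack {δ} δ<1))
        (λ P P>0 h → contradiction
          (ratio-bound α 2 {1} {2 ^ suc x} {(2 ^ x) ^ 2} {K * (c * 2 ^ x)} {P} (mk≼ (proj₁ isPower)) P>0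
            (power-lower {2} { -ᵣ (fromℚ ½ *ᵣ σ)} {α} 2 0 (suc x) isPower (exponent (suc x) σ (sqrt-log≤ n (suc x) σ n< isSqrt))) h)
          (<⇒≱ (ratio< x (≤-trans Θ<x₀ x₀≤x))))
    where
    K = proj₁ (slack {δ} δ<1)
    open Parameters K cₘ
    open Core 2 ℓ (s≤s z≤n) using (c)
    open Scaled 2 ℓ (s≤s z≤n)

theorem2 : (∀ (ε : ℝ) → 0ᵣ <ᵣ ε →
    Σ[ k ∈ (ℕ → ℕ) ]
    NotOptimizable Coverage k
    (λ n α → IsPower n ((-ᵣ fromℚ (+ 1 / 5)) +ᵣ ε) α))
    ×
    (Σ[ p ∈ (ℕ → ℕ) ] PolynomiallyBounded p ×
    Σ[ c ∈ ℝ ] 0ᵣ <ᵣ c ×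
    Σ[ k ∈ (ℕ → ℕ) ]
    NotOptimizable (CoverageOfSize≤ p) k
    (λ n α → ∃[ s ] (IsSqrtLog₂ n s × IsPower 2 (-ᵣ (c *ᵣ s)) α)))
theorem2 =
  (λ ε 0<ε → Polynomial.k ε 0<ε , Polynomial.hard ε 0<ε) ,
  (λ n → n) , (1 , 0 , λ n _ → ≤-reflexive (sym (*-identityʳ n))) ,
  -- The construction gains r/y = 2^x, where x is √(log₂ n) rounded down. Taking half the exponent
  -- leaves room for the rounding and all constants.
  fromℚ ½ , (½ , ℚ.positive⁻¹ ½ , 0 , λ _ _ → ℚ.≤-reflexive (ℚ.+-identityˡ ½)) ,
  Subpolynomial.k , Subpolynomial.hard
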